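{- There is an algorithm which, given a graph $G$ with $n$ vertices together with a nice tree decomposition of $G$ of width $w$ with $O(n)$ nodes, computes the exact number of perfect matchings of $G$ in time $O(3^w n)$. If the nice tree decomposition is a path decomposition (that is, it has no join nodes), the time is $O(w2^w n)$.
   Context: A tree decomposition of a graph $G=(V,E)$ is a pair $(T,X)$ where $T$ is a tree with node set $I$ and $X$ maps nodes of $T$ to subsets of $V$ such that (a) every $v\in V$ lies in some $X(i)$; (b) for every $uv\in E$ there is $i\in I$ with $\{u,v\}\subseteq X(i)$; (c) for every $v\in V$ the nodes $i$ with $v\in X(i)$ induce a connected subgraph of $T$. Its width is $\max_{i\in I}|X(i)|-1$. A nice tree decomposition is a rooted tree decomposition in which each node has at most two children and: every leaf $i$ has $X(i)=\emptyset$; if $i$ has exactly one child $j$, then $X(i)$ and $X(j)$ differ by exactly one vertex, with either $X(i)\supset X(j)$ (introduce node) or $X(i)\subset X(j)$ (forget node); if $i$ has two children $j,k$, then $X(i)=X(j)=X(k)$ (join node); and the root $r$ has $X(r)=\emptyset$. Time is measured with arithmetic operations on integers counted at unit cost. -}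

module Defs where

open import Data.Bool.Base using (Bool; true; false; not)
open import Data.Empty using (⊥)
open import Data.Fin.Base using (Fin; toℕ; _<_)
open import Data.Fin.Properties using (_≟_; _<?_; all?)
open import Data.Fin.Subset using (Subset; _∈_; _∉_; _∪_; ⁅_⁆; ∣_∣) renaming (⊥ to ∅)
open import Data.Fin.Subset.Properties using (_∈?_)
open import Data.Integer.Base as ℤ using (ℤ; +_; -[1+_])
import Data.Integer.Properties as ℤ
open import Data.List.Base using (List; []; _∷_; _++_; length; map; filter; concat; take; cartesianProduct; allFin; tabulate)
open import Data.List.Extrema.Nat using (max)
open import Data.Maybe.Base using (Maybe; just; nothing)
open import Data.Maybe.Properties using (≡-dec)
open import Data.Nat.Base using (ℕ; zero; suc; _+_; _∸_; _≤_)
import Data.Nat.Properties as ℕ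
open import Data.Product.Base using (Σ-syntax; ∃-syntax; _×_; _,_; proj₁; proj₂)
open import Data.Sum.Base using (_⊎_)
open import Function.Bundles using (_⇔_)
open import Level using (0ℓ)
open import Relation.Binary.Construct.Closure.ReflexiveTransitive using (Star)
open import Relation.Binary.Core using (Rel)
open import Relation.Binary.Definitions using (Decidable; Symmetric; Irreflexive)
open import Relation.Binary.PropositionalEquality using (_≡_)
open import Relation.Nullary.Decidable.Core using (Dec; does; _×-dec_; _⊎-dec_)
open import Relation.Nullary.Negation using (¬_)
open import Relation.Unary using (Pred)

------------------------------------------------------------------------
-- Graphs and perfect matchings

record Graph (n : ℕ) : Set₁ where
  field
    _~_     : Rel (Fin n) 0ℓ
    _~?_    : Decidable _~_
    ~-sym   : Symmetric _~_
    ~-irrefl : Irreflexive _≡_ _~_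

  -- Each undirected edge uv is listed once, as (u , v) with u < v.
  edges : List (Fin n × Fin n)
  edges = filter (λ e → (proj₁ e <? proj₂ e) ×-dec (proj₁ e ~? proj₂ e))
                 (cartesianProduct (allFin n) (allFin n))

  neighbours : Fin n → List (Fin n)
  neighbours v = filter (v ~?_) (allFin n)

-- Applied to a list without repetitions, this lists each subset of its
-- elements exactly once.
sublists : {A : Set} → List A → List (List A)
sublists []       = [] ∷ []
sublists (x ∷ xs) = map (x ∷_) (sublists xs) ++ sublists xs

Incident : ∀ {n} → Fin n → Fin n × Fin n → Set
Incident v e = (proj₁ e ≡ v) ⊎ (proj₂ e ≡ v)

incident? : ∀ {n} (v : Fin n) (e : Fin n × Fin n) → Dec (Incident v e)
incident? v e = (proj₁ e ≟ v) ⊎-dec (proj₂ e ≟ v)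

-- Meant for repetition-free edge lists, i.e. sets of edges.
Perfect : ∀ {n} → List (Fin n × Fin n) → Set
Perfect {n} M = ∀ (v : Fin n) → length (filter (incident? v) M) ≡ 1

perfect? : ∀ {n} (M : List (Fin n × Fin n)) → Dec (Perfect M)
perfect? M = all? (λ v → length (filter (incident? v) M) ℕ.≟ 1)

#perfectMatchings : ∀ {n} → Graph n → ℕ
#perfectMatchings G = length (filter perfect? (sublists (Graph.edges G)))

------------------------------------------------------------------------
-- Rooted trees and tree decompositions

record RootedTree (m : ℕ) : Set where
  field
    root        : Fin m
    parent      : Fin m → Maybe (Fin m)
    parent-root : ∀ i → (parent i ≡ nothing) ⇔ (i ≡ root)
    reach-root  : ∀ i → Star (λ j k → parent j ≡ just k) i root

  TreeEdge : Rel (Fin m) 0ℓ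
  TreeEdge i j = (parent i ≡ just j) ⊎ (parent j ≡ just i)

  children : Fin m → List (Fin m)
  children i = filter (λ j → ≡-dec _≟_ (parent j) (just i)) (allFin m)

  JoinNode : Fin m → Set
  JoinNode i = length (children i) ≡ 2

-- The subgraph of (A , R) induced by P is connected.
ConnectedOn : {A : Set} → Rel A 0ℓ → Pred A 0ℓ → Set
ConnectedOn R P = ∀ {i j} → P i → P j → Star (λ k l → P k × P l × R k l) i j

record TreeDecomposition {n : ℕ} (G : Graph n) (m : ℕ) : Set where
  open Graph G
  field
    tree : RootedTree m
    bag  : Fin m → Subset n
    vertex-covered : ∀ v → ∃[ i ] v ∈ bag i
    edge-covered   : ∀ {u v} → u ~ v → ∃[ i ] (u ∈ bag i × v ∈ bag i)
    bags-connected : ∀ v → ConnectedOn (RootedTree.TreeEdge tree) (λ i → v ∈ bag i)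
  open RootedTree tree public

  -- If G has a vertex then some bag is non-empty, so the truncated
  -- subtraction agrees with the integer one.
  width : ℕ
  width = max 0 (tabulate (λ i → ∣ bag i ∣)) ∸ 1

-- Y is X together with exactly one additional vertex.
_⋖_ : ∀ {n} → Subset n → Subset n → Set
X ⋖ Y = ∃[ v ] (v ∉ X × Y ≡ X ∪ ⁅ v ⁆)

module _ {n m : ℕ} {G : Graph n} (D : TreeDecomposition G m) where
  open TreeDecomposition D

  NiceNode : Fin m → List (Fin m) → Set
  NiceNode i []            = bag i ≡ ∅
  NiceNode i (j ∷ [])      = (bag j ⋖ bag i) ⊎ (bag i ⋖ bag j)
  NiceNode i (j ∷ k ∷ [])  = (bag i ≡ bag j) × (bag i ≡ bag k)
  NiceNode i (_ ∷ _ ∷ _ ∷ _) = ⊥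

  Nice : Set
  Nice = (∀ i → NiceNode i (children i)) × (bag root ≡ ∅)

  IsPathDecomposition : Set
  IsPathDecomposition = ∀ i → ¬ JoinNode i

------------------------------------------------------------------------
-- Random access machines on integers with unit-cost arithmetic
--
-- Programs are in structured form.  A program mentions finitely many
-- registers and arrays by literal names; K arrays can be interleaved in a
-- single memory (cell a of array k at address K a + k), so having several
-- arrays changes running times by a constant factor only.

data Expr : Set where
  lit  : ℤ → Expr
  reg  : ℕ → Expr
  load : ℕ → Expr → Expr
  _⊕_ _⊖_ _⊗_ : Expr → Expr → Expr

data Test : Set where
  _≐_ _≼_ : Expr → Expr → Test
  neg     : Test → Test

infixr 5 _⨾_

data Program : Set where
  skip  : Program
  _≔_   : ℕ → Expr → Program
  store : ℕ → Expr → Expr → Program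
  _⨾_   : Program → Program → Program
  cond  : Test → Program → Program → Program
  while : Test → Program → Program

record State : Set where
  constructor mkState
  field
    regs : ℕ → ℤ
    arrs : ℕ → ℤ → ℤ
open State public

eval : State → Expr → ℤ
eval σ (lit z)    = z
eval σ (reg x)    = regs σ x
eval σ (load a e) = arrs σ a (eval σ e)
eval σ (e ⊕ f)    = eval σ e ℤ.+ eval σ f
eval σ (e ⊖ f)    = eval σ e ℤ.- eval σ f
eval σ (e ⊗ f)    = eval σ e ℤ.* eval σ f

holds : State → Test → Bool
holds σ (e ≐ f) = does (eval σ e ℤ.≟ eval σ f)
holds σ (e ≼ f) = does (eval σ e ℤ.≤? eval σ f)
holds σ (neg b) = not (holds σ b)

costᵉ : Expr → ℕ
costᵉ (lit _)    = 1
costᵉ (reg _)    = 1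
costᵉ (load _ e) = 1 + costᵉ e
costᵉ (e ⊕ f)    = 1 + costᵉ e + costᵉ f
costᵉ (e ⊖ f)    = 1 + costᵉ e + costᵉ f
costᵉ (e ⊗ f)    = 1 + costᵉ e + costᵉ f

costᵗ : Test → ℕ
costᵗ (e ≐ f) = 1 + costᵉ e + costᵉ f
costᵗ (e ≼ f) = 1 + costᵉ e + costᵉ f
costᵗ (neg b) = 1 + costᵗ b

setReg : ℕ → ℤ → State → State
regs (setReg x z σ) y with does (y ℕ.≟ x)
... | true  = z
... | false = regs σ y
arrs (setReg x z σ) = arrs σ

setCell : ℕ → ℤ → ℤ → State → State
regs (setCell a p z σ) = regs σ
arrs (setCell a p z σ) b q with does (b ℕ.≟ a) | does (q ℤ.≟ p)
... | true  | true  = z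
... | true  | false = arrs σ b q
... | false | _     = arrs σ b q

-- ⟨ P , σ ⟩⇓ τ [ t ] : started in σ, the program P halts in τ after time t.
infix 4 ⟨_,_⟩⇓_[_]

data ⟨_,_⟩⇓_[_] : Program → State → State → ℕ → Set where
  ⇓skip  : ∀ {σ} → ⟨ skip , σ ⟩⇓ σ [ 1 ]
  ⇓assign : ∀ {σ x e} → ⟨ x ≔ e , σ ⟩⇓ setReg x (eval σ e) σ [ 1 + costᵉ e ]
  ⇓store : ∀ {σ a e f} →
           ⟨ store a e f , σ ⟩⇓ setCell a (eval σ e) (eval σ f) σ [ 1 + costᵉ e + costᵉ f ]
  ⇓seq   : ∀ {P Q σ τ υ s t} →
           ⟨ P , σ ⟩⇓ τ [ s ] → ⟨ Q , τ ⟩⇓ υ [ t ] → ⟨ P ⨾ Q , σ ⟩⇓ υ [ s + t ]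
  ⇓then  : ∀ {b P Q σ τ t} → holds σ b ≡ true →
           ⟨ P , σ ⟩⇓ τ [ t ] → ⟨ cond b P Q , σ ⟩⇓ τ [ 1 + costᵗ b + t ]
  ⇓else  : ∀ {b P Q σ τ t} → holds σ b ≡ false →
           ⟨ Q , σ ⟩⇓ τ [ t ] → ⟨ cond b P Q , σ ⟩⇓ τ [ 1 + costᵗ b + t ]
  ⇓stop  : ∀ {b P σ} → holds σ b ≡ false →
           ⟨ while b P , σ ⟩⇓ σ [ 1 + costᵗ b ]
  ⇓loop  : ∀ {b P σ τ υ s t} → holds σ b ≡ true →
           ⟨ P , σ ⟩⇓ τ [ s ] → ⟨ while b P , τ ⟩⇓ υ [ t ] →
           ⟨ while b P , σ ⟩⇓ υ [ 1 + costᵗ b + s + t ]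

-- By convention the result is left in register 0.
_on_Returns_Within_ : Program → State → ℤ → ℕ → Set
P on σ Returns z Within T =
  Σ[ τ ∈ State ] Σ[ t ∈ ℕ ] (⟨ P , σ ⟩⇓ τ [ t ] × regs τ 0 ≡ z × t ≤ T)

------------------------------------------------------------------------
-- Presenting a graph and a tree decomposition to the machine

nth : List ℕ → ℕ → ℤ
nth []       _       = + 0
nth (x ∷ _)  zero    = + x
nth (_ ∷ xs) (suc i) = nth xs i

cells : List ℕ → ℤ → ℤ
cells xs (+ i)    = nth xs i
cells xs -[1+ _ ] = + 0

-- A family of lists L₀ , … , L₍ₖ₋₁₎ is stored as two arrays: the
-- concatenation of the lists, and the k + 1 positions in it at which
-- L₀ , … , L₍ₖ₋₁₎ start, followed by its total length.
flat : ∀ {k} → (Fin k → List ℕ) → List ℕ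
flat L = concat (tabulate L)

starts : ∀ {k} → (Fin k → List ℕ) → List ℕ
starts {k} L = tabulate {n = suc k} (λ i → length (concat (take (toℕ i) (tabulate L))))

module _ {n m : ℕ} (G : Graph n) (D : TreeDecomposition G m) where
  open Graph G
  open TreeDecomposition D

  adjacencyLists : Fin n → List ℕ
  adjacencyLists v = map toℕ (neighbours v)

  childLists : Fin m → List ℕ
  childLists i = map toℕ (children i)

  bagLists : Fin m → List ℕ
  bagLists i = map toℕ (filter (_∈? bag i) (allFin n))

  inputRegs : ℕ → ℤ
  inputRegs 0 = + n
  inputRegs 1 = + m
  inputRegs 2 = + toℕ root
  inputRegs _ = + 0

  inputArrs : ℕ → ℤ → ℤ
  inputArrs 0 = cells (starts adjacencyLists)
  inputArrs 1 = cells (flat adjacencyLists)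
  inputArrs 2 = cells (starts childLists)
  inputArrs 3 = cells (flat childLists)
  inputArrs 4 = cells (starts bagLists)
  inputArrs 5 = cells (flat bagLists)
  inputArrs _ = λ _ → + 0

  input : State
  input = mkState inputRegs inputArrs

{-# OPTIONS --safe #-}

-- In the algebra of polynomials with x² = 0 for every variable, the number of
-- perfect matchings is the coefficient of the product of all x_v in the product
-- of the factors 1 + x_u x_v over the edges uv.  Let F be the set of vertices
-- forgotten below a node with bag X.  The table of the node holds, for S ⊆ X,
-- the coefficient at F ∪ S of the product over the edges that touch F.
-- Introducing a vertex leaves the table unchanged; forgetting v multiplies by
-- 1 + x_v Σ x_u, the sum being over the neighbours u of v in the bag; a join
-- multiplies two polynomials, whose edge sets are disjoint because the bags
-- containing a vertex are connected.  Over a bag of k vertices a join sums over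
-- the 3^k pairs of disjoint subsets, and the other nodes cost O((k + 1) 2^k).
-- The machine visits the nodes in reverse breadth-first order.  As Σ deg ≤ Σ |X|²,
-- reading the graph is not more expensive than that.

module Submission where

open import Defs
open import Data.Bool.Base using (Bool; true; false; not; if_then_else_; _∨_)
open import Data.Empty using (⊥-elim)
import Data.Fin.Base as Fin using (_<_)
open import Data.Fin.Base using (Fin; zero; suc; toℕ; inject₁)
import Data.Fin.Properties as Fin
open import Data.Fin.Subset using (Subset; _∈_; _∉_; _⊆_; _∪_; ⁅_⁆; ∣_∣; ⊤) renaming (⊥ to ∅)
open import Data.Fin.Subset.Properties using (_∈?_; ∪-identityʳ; ∪-assoc; ∪-comm; drop-∷-⊆; ∉⊥;
  ∈⊤; in⊆in; out⊆; ⊥⊆; x∈p∪q⁻; x∈p∪q⁺; x∈⁅x⁆; x∈⁅y⁆⇒x≡y; ⊆-antisym; ⊆⊤)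
open import Data.Integer.Base as ℤ using (ℤ; +_)
import Data.Integer.Properties as ℤ
open import Data.Integer.Tactic.RingSolver using () renaming (solve-∀ to ℤ-solve)
open import Data.List.Base using (List; []; _∷_; _++_; _∷ʳ_; _ʳ++_; length; map; filter; allFin;
  cartesianProduct; tabulate; concat; take; initLast; _∷ʳ′_)
import Data.List.Properties as List
import Data.List.Membership.Propositional as List
open import Data.List.Membership.Propositional.Properties using (∈-filter⁺; ∈-filter⁻;
  ∈-cartesianProduct⁺; ∈-allFin; ∈-map⁺; ∈-map⁻; ∈-++⁺ˡ; ∈-++⁺ʳ; ∈-++⁻; ∈-∃++; ∈-tabulate⁺)
open import Data.List.Membership.Propositional.Properties.WithK using (unique∧set⇒bag)
open import Data.List.Relation.Binary.BagAndSetEquality using (∼bag⇒↭)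
open import Data.List.Relation.Binary.Permutation.Propositional using (_↭_; prep; swap)
  renaming (refl to ↭-refl′; trans to ↭-trans′)
open import Data.List.Relation.Unary.Any using (here; there)
open import Data.List.Relation.Unary.All using (All; []; _∷_)
import Data.List.Relation.Unary.All as All
open import Data.List.Relation.Unary.AllPairs using ([]; _∷_)
open import Data.List.Relation.Unary.Unique.Propositional using (Unique)
import Data.List.Relation.Unary.Unique.Propositional.Properties as Unique
open import Data.Maybe.Base using (Maybe; just; nothing)
open import Data.Maybe.Properties using (just-injective)
import Data.Maybe.Properties as Maybe
open import Data.Nat.Base using (ℕ; zero; suc; _+_; _*_; _∸_; _^_; _≤_; _<_; _⊔_; z≤n; s≤s)
import Data.Nat.Properties as ℕ
open import Data.Nat.Tactic.RingSolver using () renaming (solve-∀ to ℕ-solve)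
open import Data.Product.Base using (Σ-syntax; ∃-syntax; _×_; _,_; proj₁; proj₂)
open import Data.Sum.Base using (_⊎_; inj₁; inj₂; [_,_]′)
open import Data.Unit.Base using (tt) renaming (⊤ to Unit)
open import Data.Vec.Base using ([]; _∷_; lookup; _[_]≔_)
import Data.Vec.Base as Vec
open import Data.Vec.Properties using (lookup∘update; lookup∘update′; []=⇒lookup; lookup-replicate)
open import Function.Base using (_∘_; case_of_; id)
open import Function.Bundles using (Equivalence; mk⇔)
open import Level using (0ℓ)
open import Relation.Binary.Construct.Closure.ReflexiveTransitive using (Star; ε; _◅_; _◅◅_)
open import Relation.Binary.Definitions using (tri<; tri≈; tri>)
open import Relation.Binary.PropositionalEquality using (_≡_; _≢_; refl; sym; trans; cong;
  cong₂; subst; module ≡-Reasoning)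
open import Relation.Nullary.Decidable.Core using (Dec; yes; no; does; _×-dec_; _⊎-dec_)
open import Relation.Nullary.Decidable using (dec-true; dec-false)
open import Relation.Nullary.Negation using (¬_; contradiction)
open import Relation.Unary using (Pred; Decidable)
open import Algebra.Properties.AbelianGroup ℤ.+-0-abelianGroup using (∙-cancelˡ)
open import Data.List.Extrema.Nat using (max; xs≤max)

-- Program verification

-- The machine has no bit operations, so a subset occurs in the program only as a sum of powers of
-- three, and a table is read at whatever address such sums produce. Hence a table is specified at
-- every integer: at an address that is not the code of a subset of the bag it must give 0. Memory
-- that starts out as zero provides this for free, and it replaces every membership test, both for
-- an introduced vertex and for a partner removed at a forget node. All four kinds of nodes run the
-- same code: for each pair (A , B), a value read for A times a value read for B is added at the
-- address of A + B. A node that is not a join makes two choices per vertex, so B is empty, and its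
-- second factor comes from the constant polynomial 1. The kind of a node is not part of the input.
-- Forgetting is recognised from the bags alone: the code of the first child exceeds that of the
-- node only at a forget node, and there the excess is 3^v. The program thus knows v only through
-- 3^v.

Run : Program → State → (State → Set) → ℕ → Set
Run P σ Q T = Σ[ τ ∈ State ] Σ[ t ∈ ℕ ] (⟨ P , σ ⟩⇓ τ [ t ] × Q τ × t ≤ T)

weaken : ∀ {P σ Q R s t} → (∀ {τ} → Q τ → R τ) → s ≤ t → Run P σ Q s → Run P σ R t
weaken f s≤t (τ , u , r , q , u≤s) = τ , u , r , f q , ℕ.≤-trans u≤s s≤t

skip-run : ∀ {σ} {Q : State → Set} → Q σ → Run skip σ Q 1
skip-run q = _ , _ , ⇓skip , q , ℕ.≤-refl

infixr 5 _⨾ᴿ_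

_⨾ᴿ_ : ∀ {P P′ σ Q R s t} → Run P σ Q s → (∀ {τ} → Q τ → Run P′ τ R t) → Run (P ⨾ P′) σ R (s + t)
(_ , _ , r , q , u≤s) ⨾ᴿ k with k q
... | υ , _ , r′ , q′ , v≤t = υ , _ , ⇓seq r r′ , q′ , ℕ.+-mono-≤ u≤s v≤t

assign-run : ∀ {σ e x z} {Q : State → Set} → eval σ e ≡ z → Q (setReg x z σ) →
             Run (x ≔ e) σ Q (1 + costᵉ e)
assign-run refl q = _ , _ , ⇓assign , q , ℕ.≤-refl

store-run : ∀ {σ a e f p z} {Q : State → Set} → eval σ e ≡ p → eval σ f ≡ z → Q (setCell a p z σ) →
            Run (store a e f) σ Q (1 + costᵉ e + costᵉ f)
store-run refl refl q = _ , _ , ⇓store , q , ℕ.≤-refl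

assign : ∀ {σ e x z P R t} → eval σ e ≡ z → Run P (setReg x z σ) R t →
         Run (x ≔ e ⨾ P) σ R (1 + costᵉ e + t)
assign refl (υ , _ , r , q , u≤t) = υ , _ , ⇓seq ⇓assign r , q , ℕ.+-monoʳ-≤ _ u≤t

store-then : ∀ {σ a e f p z P R t} → eval σ e ≡ p → eval σ f ≡ z → Run P (setCell a p z σ) R t →
             Run (store a e f ⨾ P) σ R (1 + costᵉ e + costᵉ f + t)
store-then refl refl (υ , _ , r , q , u≤t) = υ , _ , ⇓seq ⇓store r , q , ℕ.+-monoʳ-≤ _ u≤t

then-run : ∀ {σ b P P′ Q t} → holds σ b ≡ true → Run P σ Q t → Run (cond b P P′) σ Q (1 + costᵗ b + t)
then-run h (τ , _ , r , q , u≤t) = τ , _ , ⇓then h r , q , ℕ.+-monoʳ-≤ _ u≤t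

else-run : ∀ {σ b P P′ Q t} → holds σ b ≡ false → Run P′ σ Q t → Run (cond b P P′) σ Q (1 + costᵗ b + t)
else-run h (τ , _ , r , q , u≤t) = τ , _ , ⇓else h r , q , ℕ.+-monoʳ-≤ _ u≤t

-- The invariant is indexed by ghost data x, and cost x is a potential that pays
-- for the rest of the loop; since every test costs something, the potential
-- also bounds the number of iterations.
while-run : ∀ {b P} {X : Set} (I : X → State → Set) (cost : X → ℕ) (Q : State → Set) →
  (∀ x σ → I x σ →
     (holds σ b ≡ false × Q σ × 1 + costᵗ b ≤ cost x) ⊎
     (holds σ b ≡ true × Σ[ y ∈ X ] Σ[ T ∈ ℕ ]
        (Run P σ (I y) T × 1 + costᵗ b + T + cost y ≤ cost x))) →
  ∀ x σ → I x σ → Run (while b P) σ Q (cost x)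
while-run {b} {P} {X} I cost Q step x₀ σ₀ i₀ = go (cost x₀) x₀ σ₀ ℕ.≤-refl i₀
  where
  go : ∀ k x σ → cost x ≤ k → I x σ → Run (while b P) σ Q (cost x)
  go k x σ c≤k i with step x σ i
  ... | inj₁ (h , q , le) = σ , _ , ⇓stop h , q , le
  ... | inj₂ (h , y , T , (τ , t , r , j , t≤T) , le) with k | ℕ.≤-trans le c≤k
  ...   | suc k′ | s≤s lt with go k′ y τ (ℕ.≤-trans (ℕ.m≤n+m _ (costᵗ b + T)) lt) j
  ...     | υ , u , r′ , q , u≤c = υ , _ , ⇓loop h r r′ , q ,
            ℕ.≤-trans (ℕ.+-mono-≤ (ℕ.+-monoʳ-≤ (1 + costᵗ b) t≤T) u≤c) le

infix 4 _≺_

_≺_ : Expr → Expr → Test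
e ≺ f = neg (f ≼ e)

≺-true : ∀ {σ e f a b} → eval σ e ≡ + a → eval σ f ≡ + b → a < b → holds σ (e ≺ f) ≡ true
≺-true {a = a} {b} p q a<b rewrite p | q =
  cong not (dec-false (+ b ℤ.≤? + a) (λ { (ℤ.+≤+ b≤a) → ℕ.<⇒≱ a<b b≤a }))

≺-false : ∀ {σ e f a b} → eval σ e ≡ + a → eval σ f ≡ + b → b ≤ a → holds σ (e ≺ f) ≡ false
≺-false {a = a} {b} p q b≤a rewrite p | q = cong not (dec-true (+ b ℤ.≤? + a) (ℤ.+≤+ b≤a))

setCell-eq : ∀ a p z σ {q} → q ≡ p → arrs (setCell a p z σ) a q ≡ z
setCell-eq a p z σ {q} e
  rewrite dec-true (a ℕ.≟ a) refl | dec-true (q ℤ.≟ p) e = refl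

setCell-neq : ∀ a p z σ {q} → q ≢ p → arrs (setCell a p z σ) a q ≡ arrs σ a q
setCell-neq a p z σ {q} e
  rewrite dec-true (a ℕ.≟ a) refl | dec-false (q ℤ.≟ p) e = refl

-- Loops over stored lists and counting loops

Segment : ∀ {k} → (ℤ → ℤ) → ℕ → List (Fin k) → Set
Segment f s []       = Unit
Segment f s (x ∷ xs) = f (+ s) ≡ + toℕ x × Segment f (s + 1) xs

Segment-cong : ∀ {k f g} s (xs : List (Fin k)) → (∀ q → g q ≡ f q) → Segment f s xs → Segment g s xs
Segment-cong s []       eq _         = tt
Segment-cong s (x ∷ xs) eq (p , ps) = trans (eq _) p , Segment-cong (s + 1) xs eq ps

inc : ℕ → Program
inc x = x ≔ (reg x ⊕ lit (+ 1))

scan : Program → Program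
scan P = while (reg 5 ≺ reg 6) (P ⨾ inc 5)

Kept : ℕ → State → State → Set
Kept A σ τ = regs τ 5 ≡ regs σ 5 × regs τ 6 ≡ regs σ 6 × (∀ q → arrs τ A q ≡ arrs σ A q)

-- Every input list is read by this loop, with registers 5 and 6 delimiting the unread part of array
-- `A`. `J` has to tolerate changes of register 5 because the pointer moves after the body. The 9
-- consists of 5 for the test and 4 for `inc 5`.
scan-run : ∀ {k P} {X : Set} A (J : X → List (Fin k) → State → Set) (cost : X → List (Fin k) → ℕ) →
  (∀ {x ys σ} z → J x ys σ → J x ys (setReg 5 z σ)) →
  (∀ x → 5 ≤ cost x []) →
  (∀ x y ys σ s → regs σ 5 ≡ + s → arrs σ A (+ s) ≡ + toℕ y → J x (y ∷ ys) σ →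
     Σ[ x′ ∈ X ] Σ[ T ∈ ℕ ] (Run P σ (λ τ → J x′ ys τ × Kept A σ τ) T × 9 + T + cost x′ ys ≤ cost x (y ∷ ys))) →
  ∀ x xs σ s → regs σ 5 ≡ + s → regs σ 6 ≡ + (s + length xs) → Segment (arrs σ A) s xs → J x xs σ →
  Run (scan P) σ (λ τ → ∃[ x′ ] J x′ [] τ) (cost x xs)
scan-run {k} {P} {X} A J cost insens c-nil body x₀ xs₀ σ₀ s₀ h5 h6 seg j =
  while-run I (λ z → cost (proj₁ z) (proj₂ z)) _ step (x₀ , xs₀) σ₀ (s₀ , h5 , h6 , seg , j)
  where
  I : X × List (Fin k) → State → Set
  I (x , ys) σ = ∃[ s ] (regs σ 5 ≡ + s × regs σ 6 ≡ + (s + length ys) × Segment (arrs σ A) s ys × J x ys σ)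
  step : ∀ z σ → I z σ → _
  step (x , []) σ (s , h5 , h6 , _ , j) =
    inj₁ (≺-false {σ} {reg 5} {reg 6} h5 h6 (ℕ.≤-reflexive (ℕ.+-identityʳ s)) , (x , j) , c-nil x)
  step (x , y ∷ ys) σ (s , h5 , h6 , (hy , seg) , j) with body x y ys σ s h5 hy j
  ... | x′ , T , run , le = inj₂
    ( ≺-true {σ} {reg 5} {reg 6} h5 h6 (ℕ.m<m+n s (s≤s z≤n)) , (x′ , ys) , T + 4
    , (run ⨾ᴿ λ { {τ} (j′ , k5 , k6 , kA) →
        assign-run {τ} (cong (ℤ._+ + 1) (trans k5 h5))
          (s + 1 , refl , trans k6 (trans h6 (cong +_ (sym (ℕ.+-assoc s 1 _))))
          , Segment-cong (s + 1) ys kA seg , insens _ j′) })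
    , ℕ.≤-trans (ℕ.≤-reflexive (cong (_+ cost x′ ys) (lem T))) le )
    where
    lem : ∀ T → 5 + (T + 4) ≡ 9 + T
    lem T = cong (λ n → 5 + n) (ℕ.+-comm T 4)

count : Program → Program
count P = while (reg 16 ≺ reg 15) (P ⨾ inc 16)

count-run : ∀ {P} N T (J : ℕ → State → Set) →
  (∀ {t σ} z → J t σ → J t (setReg 16 z σ)) →
  (∀ t σ → t < N → regs σ 16 ≡ + t → J t σ →
     Run P σ (λ τ → J (suc t) τ × regs τ 16 ≡ regs σ 16 × regs τ 15 ≡ regs σ 15) T) →
  ∀ σ → regs σ 16 ≡ + 0 → regs σ 15 ≡ + N → J 0 σ →
  Run (count P) σ (J N) (N * (9 + T) + 5)
count-run {P} N T J insens body σ₀ h16 h15 j =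
  while-run I (λ k → k * (9 + T) + 5) _ step N σ₀ (0 , refl , h16 , h15 , j)
  where
  I : ℕ → State → Set
  I k σ = ∃[ t ] (t + k ≡ N × regs σ 16 ≡ + t × regs σ 15 ≡ + N × J t σ)
  step : ∀ k σ → I k σ → _
  step zero σ (t , refl , h16 , h15 , j) = inj₁
    ( ≺-false {σ} {reg 16} {reg 15} h16 h15 (ℕ.≤-reflexive (ℕ.+-identityʳ t))
    , subst (λ n → J n σ) (sym (ℕ.+-identityʳ t)) j , ℕ.≤-refl )
  step (suc k) σ (t , eq , h16 , h15 , j) = inj₂
    ( ≺-true {σ} {reg 16} {reg 15} h16 h15 t<N , k , T + 4
    , (body t σ t<N h16 j ⨾ᴿ λ { {τ} (j′ , k16 , k15) →
        assign-run {τ} (cong (ℤ._+ + 1) (trans k16 h16))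
          (suc t , trans (sym (ℕ.+-suc t k)) eq , cong +_ (ℕ.+-comm t 1) , trans k15 h15 , insens _ j′) })
    , ℕ.≤-reflexive lem )
    where
    t<N : t < N
    t<N = subst (t <_) eq (ℕ.m<m+n t (s≤s z≤n))
    lem : 5 + (T + 4) + (k * (9 + T) + 5) ≡ (9 + T) + k * (9 + T) + 5
    lem rewrite ℕ.+-comm T 4 = sym (ℕ.+-assoc (9 + T) _ 5)

-- Multilinear polynomials

-- A function f on subsets stands for the polynomial Σ f(S) x^S in variables
-- with x² = 0; shift u is multiplication by x_u.

shift : ∀ {n} → Fin n → (Subset n → ℤ) → Subset n → ℤ
shift u f S = if lookup S u then f (S [ u ]≔ false) else + 0

one : ∀ {n} → Subset n → ℤ
one []          = + 1
one (false ∷ S) = one S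
one (true ∷ S)  = + 0

-- The product of the 1 + x_u x_v over the listed pairs uv.
cnt : ∀ {n} → List (Fin n × Fin n) → Subset n → ℤ
cnt []            S = one S
cnt ((u , v) ∷ E) S = cnt E S ℤ.+ shift u (shift v (cnt E)) S

lsum : {A : Set} → (A → ℤ) → List A → ℤ
lsum f []       = + 0
lsum f (x ∷ xs) = f x ℤ.+ lsum f xs

lsum-cong : {A : Set} {f g : A → ℤ} → ∀ xs → (∀ {x} → x List.∈ xs → f x ≡ g x) → lsum f xs ≡ lsum g xs
lsum-cong []       eq = refl
lsum-cong (x ∷ xs) eq = cong₂ ℤ._+_ (eq (here refl)) (lsum-cong xs (eq ∘ there))

lsum-0 : {A : Set} (xs : List A) → lsum (λ _ → + 0) xs ≡ + 0
lsum-0 []       = refl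
lsum-0 (x ∷ xs) = trans (ℤ.+-identityˡ _) (lsum-0 xs)

if-0 : ∀ b → (if b then + 0 else + 0) ≡ + 0
if-0 true  = refl
if-0 false = refl

shift-cong : ∀ {n} (u : Fin n) {f g : Subset n → ℤ} → (∀ S → f S ≡ g S) → ∀ S → shift u f S ≡ shift u g S
shift-cong u eq S = cong (λ z → if lookup S u then z else + 0) (eq _)

shift-off : ∀ {n} (u : Fin n) f S → lookup S u ≡ false → shift u f S ≡ + 0
shift-off u f S h rewrite h = refl

shift-+ : ∀ {n} (u : Fin n) (f g : Subset n → ℤ) S → shift u (λ T → f T ℤ.+ g T) S ≡ shift u f S ℤ.+ shift u g S
shift-+ u f g S with lookup S u
... | true  = refl
... | false = refl

shift-* : ∀ {n} (u : Fin n) (f : Subset n → ℤ) c S → shift u f S ℤ.* c ≡ shift u (λ T → f T ℤ.* c) S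
shift-* u f c S with lookup S u
... | true  = refl
... | false = ℤ.*-zeroˡ c

shift-comm : ∀ {n} (u v : Fin n) f S → shift u (shift v f) S ≡ shift v (shift u f) S
shift-comm zero    zero    f S           = refl
shift-comm zero    (suc v) f (true ∷ S)  = refl
shift-comm zero    (suc v) f (false ∷ S) = sym (if-0 (lookup S v))
shift-comm (suc u) zero    f (true ∷ S)  = refl
shift-comm (suc u) zero    f (false ∷ S) = if-0 (lookup S u)
shift-comm (suc u) (suc v) f (b ∷ S)     = shift-comm u v (λ T → f (b ∷ T)) S

-- Multiplication is commutative: in the `swap` case both orders expand into the same four terms. It
-- is needed because the edges at a node are filtered from `edges`, while the recurrences produce
-- them as concatenations.
cnt-↭ : ∀ {n} {E E′ : List (Fin n × Fin n)} → E ↭ E′ → ∀ S → cnt E S ≡ cnt E′ S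
cnt-↭ ↭-refl′ S = refl
cnt-↭ (prep (u , v) p) S =
  cong₂ ℤ._+_ (cnt-↭ p S) (shift-cong u (shift-cong v (cnt-↭ p)) S)
cnt-↭ {E = _ ∷ _ ∷ E} {E′ = _ ∷ _ ∷ E′} (swap (u , v) (a , b) p) S = begin
  (c S ℤ.+ sh a b c S) ℤ.+ sh u v (λ T → c T ℤ.+ sh a b c T) S
    ≡⟨ cong (ℤ._+_ (c S ℤ.+ sh a b c S)) (sh-+ u v a b c S) ⟩
  (c S ℤ.+ sh a b c S) ℤ.+ (sh u v c S ℤ.+ sh u v (sh a b c) S)
    ≡⟨ cong (λ z → (c S ℤ.+ sh a b c S) ℤ.+ (sh u v c S ℤ.+ z)) (sh-comm S) ⟩
  (c S ℤ.+ sh a b c S) ℤ.+ (sh u v c S ℤ.+ sh a b (sh u v c) S)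
    ≡⟨ arith (c S) (sh a b c S) (sh u v c S) _ ⟩
  (c S ℤ.+ sh u v c S) ℤ.+ (sh a b c S ℤ.+ sh a b (sh u v c) S)
    ≡⟨ cong (ℤ._+_ (c S ℤ.+ sh u v c S)) (sh-+ a b u v c S) ⟨
  (c S ℤ.+ sh u v c S) ℤ.+ sh a b (λ T → c T ℤ.+ sh u v c T) S
    ≡⟨ cong₂ ℤ._+_ (cong₂ ℤ._+_ (cnt-↭ p S) (shift-cong u (shift-cong v (cnt-↭ p)) S))
         (shift-cong a (shift-cong b (λ T → cong₂ ℤ._+_ (cnt-↭ p T) (shift-cong u (shift-cong v (cnt-↭ p)) T))) S) ⟩
  cnt ((a , b) ∷ (u , v) ∷ E′) S ∎
  where
  open ≡-Reasoning
  c = cnt E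
  sh : ∀ u v → _ → _ → ℤ
  sh u v f = shift u (shift v f)
  sh-+ : ∀ u v a b f S → sh u v (λ T → f T ℤ.+ sh a b f T) S ≡ sh u v f S ℤ.+ sh u v (sh a b f) S
  sh-+ u v a b f S = trans (shift-cong u (shift-+ v f (sh a b f)) S) (shift-+ u (shift v f) (shift v (sh a b f)) S)
  sh-comm : ∀ S → sh u v (sh a b c) S ≡ sh a b (sh u v c) S
  sh-comm S = trans (shift-cong u (λ T → trans (shift-comm v a (shift b c) T) (shift-cong a (shift-comm v b c) T)) S)
    (trans (shift-comm u a (shift b (shift v c)) S) (shift-cong a (shift-comm u b (shift v c)) S))
  arith : ∀ x y z w → (x ℤ.+ y) ℤ.+ (z ℤ.+ w) ≡ (x ℤ.+ z) ℤ.+ (y ℤ.+ w)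
  arith = ℤ-solve
cnt-↭ (↭-trans′ p q) S = trans (cnt-↭ p S) (cnt-↭ q S)

one-avoids : ∀ {n} (v : Fin n) S → lookup S v ≡ true → one S ≡ + 0
one-avoids zero    (true ∷ S)  _ = refl
one-avoids (suc v) (true ∷ S)  _ = refl
one-avoids (suc v) (false ∷ S) h = one-avoids v S h

shift-avoids : ∀ {n} (u v : Fin n) {f : Subset n → ℤ} → u ≢ v →
               (∀ S → lookup S v ≡ true → f S ≡ + 0) → ∀ S → lookup S v ≡ true → shift u f S ≡ + 0
shift-avoids u v u≢v z S h =
  trans (cong (λ x → if lookup S u then x else + 0)
              (z (S [ u ]≔ false) (trans (lookup∘update′ (u≢v ∘ sym) S false) h)))
        (if-0 (lookup S u))

-- No factor involves x_v, so no monomial of the product does.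
cnt-avoids : ∀ {n} (v : Fin n) E → All (λ e → ¬ Incident v e) E → ∀ S → lookup S v ≡ true → cnt E S ≡ + 0
cnt-avoids v []            []       S h = one-avoids v S h
cnt-avoids v ((a , b) ∷ E) (p ∷ ps) S h =
  cong₂ ℤ._+_ (cnt-avoids v E ps S h)
    (shift-avoids a v (p ∘ inj₁) (shift-avoids b v (p ∘ inj₂) (cnt-avoids v E ps)) S h)

-- As x_v² = 0, the product of the factors 1 + x_v x_u is 1 + x_v Σ x_u.
cnt-star : ∀ {n} (v : Fin n) us E S →
           cnt (map (v ,_) us ++ E) S ≡ cnt E S ℤ.+ lsum (λ u → shift v (shift u (cnt E)) S) us
cnt-star v []       E S = sym (ℤ.+-identityʳ _)
cnt-star v (u ∷ us) E S = begin
  cnt E′ S ℤ.+ shift v (shift u (cnt E′)) S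
    ≡⟨ cong₂ ℤ._+_ (cnt-star v us E S) eq ⟩
  (cnt E S ℤ.+ rest) ℤ.+ shift v (shift u (cnt E)) S
    ≡⟨ arith (cnt E S) rest _ ⟩
  cnt E S ℤ.+ (shift v (shift u (cnt E)) S ℤ.+ rest) ∎
  where
  open ≡-Reasoning
  E′ = map (v ,_) us ++ E
  rest = lsum (λ u → shift v (shift u (cnt E)) S) us
  arith : ∀ x y z → (x ℤ.+ y) ℤ.+ z ≡ x ℤ.+ (z ℤ.+ y)
  arith = ℤ-solve
  off : ∀ T → cnt E′ (T [ v ]≔ false) ≡ cnt E (T [ v ]≔ false)
  off T = trans (cnt-star v us E _)
    (trans (cong (ℤ._+_ (cnt E (T [ v ]≔ false)))
      (trans (lsum-cong us (λ {u} _ → shift-off v (shift u (cnt E)) (T [ v ]≔ false) (lookup∘update v T false))) (lsum-0 us)))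
      (ℤ.+-identityʳ _))
  eq : shift v (shift u (cnt E′)) S ≡ shift v (shift u (cnt E)) S
  eq = trans (shift-comm v u (cnt E′) S)
    (trans (shift-cong u (λ T → cong (λ z → if lookup T v then z else + 0) (off T)) S)
      (shift-comm u v (cnt E) S))

-- The coefficient at S of the image of a polynomial Σ k(A,B) x^A y^B under y ↦ x.
conv : ∀ {n} → (Subset n → Subset n → ℤ) → Subset n → ℤ
conv k []          = k [] []
conv k (false ∷ S) = conv (λ A B → k (false ∷ A) (false ∷ B)) S
conv k (true ∷ S)  = conv (λ A B → k (true ∷ A) (false ∷ B)) S ℤ.+ conv (λ A B → k (false ∷ A) (true ∷ B)) S

-- Agreement is demanded only on parts of `S`, since a table is tied to its polynomial only on
-- subsets of the bag.
conv-cong : ∀ {n} S {k l : Subset n → Subset n → ℤ} → (∀ A B → A ⊆ S → B ⊆ S → k A B ≡ l A B) → conv k S ≡ conv l S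
conv-cong []          eq = eq [] [] id id
conv-cong (false ∷ S) eq = conv-cong S (λ A B p q → eq _ _ (out⊆ p) (out⊆ q))
conv-cong (true ∷ S)  eq = cong₂ ℤ._+_ (conv-cong S (λ A B p q → eq _ _ (in⊆in p) (out⊆ q)))
                                       (conv-cong S (λ A B p q → eq _ _ (out⊆ p) (in⊆in q)))

conv-0 : ∀ {n} (S : Subset n) → conv (λ _ _ → + 0) S ≡ + 0
conv-0 []          = refl
conv-0 (false ∷ S) = conv-0 S
conv-0 (true ∷ S)  = cong₂ ℤ._+_ (conv-0 S) (conv-0 S)

conv-vanish : ∀ {n} S {k : Subset n → Subset n → ℤ} → (∀ A B → k A B ≡ + 0) → conv k S ≡ + 0
conv-vanish S z = trans (conv-cong S (λ A B _ _ → z A B)) (conv-0 S)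

interchange : ∀ x y z w → (x ℤ.+ y) ℤ.+ (z ℤ.+ w) ≡ (x ℤ.+ z) ℤ.+ (y ℤ.+ w)
interchange = ℤ-solve

conv-+ : ∀ {n} S (k l : Subset n → Subset n → ℤ) → conv (λ A B → k A B ℤ.+ l A B) S ≡ conv k S ℤ.+ conv l S
conv-+ []          k l = refl
conv-+ (false ∷ S) k l = conv-+ S _ _
conv-+ (true ∷ S)  k l = trans (cong₂ ℤ._+_ (conv-+ S _ _) (conv-+ S _ _))
  (interchange (conv (λ A B → k (true ∷ A) (false ∷ B)) S) _ _ _)

conv-one : ∀ {n} S (g : Subset n → ℤ) → conv (λ A B → one A ℤ.* g B) S ≡ g S
conv-one []          g = ℤ.*-identityˡ _
conv-one (false ∷ S) g = conv-one S (λ B → g (false ∷ B))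
conv-one (true ∷ S)  g = trans (cong₂ ℤ._+_ (conv-vanish S (λ A B → ℤ.*-zeroˡ (g (false ∷ B)))) (conv-one S (λ B → g (true ∷ B))))
  (ℤ.+-identityˡ _)

-- Only the splittings that put u into the first part contribute, and taking u out of that part
-- leaves a splitting of S without u.
conv-shift : ∀ {n} u (k : Subset n → Subset n → ℤ) S →
             conv (λ A B → shift u (λ A′ → k A′ B) A) S ≡ shift u (conv k) S
conv-shift zero    k (false ∷ S) = conv-0 S
conv-shift zero    k (true ∷ S)  = trans (cong (ℤ._+_ (conv (λ A B → k (false ∷ A) (false ∷ B)) S)) (conv-0 S)) (ℤ.+-identityʳ _)
conv-shift (suc u) k (false ∷ S) = conv-shift u _ S
conv-shift (suc u) k (true ∷ S)  = trans (cong₂ ℤ._+_ (conv-shift u _ S) (conv-shift u _ S))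
  (sym (shift-+ u (conv (λ A B → k (true ∷ A) (false ∷ B))) (conv (λ A B → k (false ∷ A) (true ∷ B))) S))

cnt-++ : ∀ {n} (E E′ : List (Fin n × Fin n)) S → cnt (E ++ E′) S ≡ conv (λ A B → cnt E A ℤ.* cnt E′ B) S
cnt-++ []            E′ S = sym (conv-one S (cnt E′))
cnt-++ ((u , v) ∷ E) E′ S = begin
  cnt (E ++ E′) S ℤ.+ shift u (shift v (cnt (E ++ E′))) S
    ≡⟨ cong₂ ℤ._+_ (cnt-++ E E′ S) (shift-cong u (shift-cong v (cnt-++ E E′)) S) ⟩
  conv k S ℤ.+ shift u (shift v (conv k)) S
    ≡⟨ cong (ℤ._+_ (conv k S)) (shift-cong u (conv-shift v k) S) ⟨
  conv k S ℤ.+ shift u (conv (λ A B → shift v (λ A′ → k A′ B) A)) S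
    ≡⟨ cong (ℤ._+_ (conv k S)) (conv-shift u _ S) ⟨
  conv k S ℤ.+ conv (λ A B → shift u (shift v (λ A′ → k A′ B)) A) S
    ≡⟨ conv-+ S _ _ ⟨
  conv (λ A B → k A B ℤ.+ shift u (shift v (λ A′ → k A′ B)) A) S
    ≡⟨ conv-cong S (λ A B _ _ → sym (eq A B)) ⟩
  conv (λ A B → cnt ((u , v) ∷ E) A ℤ.* cnt E′ B) S ∎
  where
  open ≡-Reasoning
  k = λ A B → cnt E A ℤ.* cnt E′ B
  eq : ∀ A B → cnt ((u , v) ∷ E) A ℤ.* cnt E′ B ≡ k A B ℤ.+ shift u (shift v (λ A′ → k A′ B)) A
  eq A B = trans (ℤ.*-distribʳ-+ (cnt E′ B) (cnt E A) _)
    (cong (ℤ._+_ (k A B)) (trans (shift-* u (shift v (cnt E)) (cnt E′ B) A)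
      (shift-cong u (shift-* v (cnt E) (cnt E′ B)) A)))

Disjoint : ∀ {n} → Subset n → Subset n → Set
Disjoint A B = ∀ {v} → v ∈ A → v ∉ B

disjoint-tail : ∀ {n a b} {A B : Subset n} → Disjoint (a ∷ A) (b ∷ B) → Disjoint A B
disjoint-tail d p q = d (Vec.there p) (Vec.there q)

-- A splitting contributes only if it sends all of F to the first part and all of G to the second,
-- so the only freedom left is how to split S. This is what confines the work of a join to subsets
-- of the bag.
conv-split : ∀ {n} (F G S : Subset n) (k : Subset n → Subset n → ℤ) →
  Disjoint F G → Disjoint F S → Disjoint G S →
  (∀ {v A B} → v ∈ G → v ∈ A → k A B ≡ + 0) →
  (∀ {v A B} → v ∈ F → v ∈ B → k A B ≡ + 0) →
  conv k (F ∪ (G ∪ S)) ≡ conv (λ A B → k (F ∪ A) (G ∪ B)) S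
conv-split [] [] [] k _ _ _ _ _ = refl
conv-split (true ∷ F) (true ∷ G) (s ∷ S) k d e f z w = contradiction Vec.here (d Vec.here)
conv-split (true ∷ F) (false ∷ G) (true ∷ S) k d e f z w = contradiction Vec.here (e Vec.here)
conv-split (false ∷ F) (true ∷ G) (true ∷ S) k d e f z w = contradiction Vec.here (f Vec.here)
conv-split (true ∷ F) (false ∷ G) (false ∷ S) k d e f z w =
  trans (cong₂ ℤ._+_
    (conv-split F G S _ (disjoint-tail d) (disjoint-tail e) (disjoint-tail f)
      (λ p q → z (Vec.there p) (Vec.there q)) (λ p q → w (Vec.there p) (Vec.there q)))
    (conv-vanish (F ∪ (G ∪ S)) (λ A B → w Vec.here Vec.here))) (ℤ.+-identityʳ _)
conv-split (false ∷ F) (true ∷ G) (false ∷ S) k d e f z w =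
  trans (cong₂ ℤ._+_
    (conv-vanish (F ∪ (G ∪ S)) (λ A B → z Vec.here Vec.here))
    (conv-split F G S _ (disjoint-tail d) (disjoint-tail e) (disjoint-tail f)
      (λ p q → z (Vec.there p) (Vec.there q)) (λ p q → w (Vec.there p) (Vec.there q))))
    (ℤ.+-identityˡ _)
conv-split (false ∷ F) (false ∷ G) (false ∷ S) k d e f z w =
  conv-split F G S _ (disjoint-tail d) (disjoint-tail e) (disjoint-tail f)
    (λ p q → z (Vec.there p) (Vec.there q)) (λ p q → w (Vec.there p) (Vec.there q))
conv-split (false ∷ F) (false ∷ G) (true ∷ S) k d e f z w = cong₂ ℤ._+_
  (conv-split F G S _ (disjoint-tail d) (disjoint-tail e) (disjoint-tail f)
    (λ p q → z (Vec.there p) (Vec.there q)) (λ p q → w (Vec.there p) (Vec.there q)))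
  (conv-split F G S _ (disjoint-tail d) (disjoint-tail e) (disjoint-tail f)
    (λ p q → z (Vec.there p) (Vec.there q)) (λ p q → w (Vec.there p) (Vec.there q)))

-- Perfect matchings

bit : Bool → ℕ
bit true  = 1
bit false = 0

PerfectOn : ∀ {n} → Subset n → List (Fin n × Fin n) → Set
PerfectOn S M = ∀ v → length (filter (incident? v) M) ≡ bit (lookup S v)

perfectOn? : ∀ {n} (S : Subset n) M → Dec (PerfectOn S M)
perfectOn? S M = Fin.all? (λ v → length (filter (incident? v) M) ℕ.≟ bit (lookup S v))

length-filter-map : ∀ {A B : Set} {P : Pred B 0ℓ} (P? : Decidable P) (f : A → B) xs →
                    length (filter P? (map f xs)) ≡ length (filter (P? ∘ f) xs)
length-filter-map P? f []       = refl
length-filter-map P? f (x ∷ xs) with does (P? (f x))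
... | true  = cong suc (length-filter-map P? f xs)
... | false = length-filter-map P? f xs

deg-incident : ∀ {n} (v : Fin n) e M → Incident v e →
               length (filter (incident? v) (e ∷ M)) ≡ suc (length (filter (incident? v) M))
deg-incident v e M i = cong length (List.filter-accept (incident? v) i)

deg-other : ∀ {n} (v : Fin n) e M → ¬ Incident v e →
            length (filter (incident? v) (e ∷ M)) ≡ length (filter (incident? v) M)
deg-other v e M i = cong length (List.filter-reject (incident? v) i)

bit-suc : ∀ {b k} → suc k ≡ bit b → b ≡ true × k ≡ 0
bit-suc {true} refl = refl , refl

-- Choosing an edge ab leaves its two ends to be avoided by the remaining edges, so the induction
-- needs an arbitrary target S in place of the full vertex set. Loops have to be excluded: a loop at
-- a is counted once at a, whereas x_a² = 0.
count-perfectOn : ∀ {n} (E : List (Fin n × Fin n)) → All (λ e → proj₁ e ≢ proj₂ e) E → ∀ S →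
                  + length (filter (perfectOn? S) (sublists E)) ≡ cnt E S
count-perfectOn [] [] S = count-empty S
  where
  zeros : ∀ {n} (S : Subset n) → PerfectOn S [] → one S ≡ + 1
  zeros []          h = refl
  zeros (true ∷ S)  h = contradiction (h zero) λ ()
  zeros (false ∷ S) h = zeros S (h ∘ suc)
  nonzero : ∀ {n} (S : Subset n) → ¬ PerfectOn S [] → one S ≡ + 0
  nonzero []          h = contradiction (λ ()) h
  nonzero (true ∷ S)  h = refl
  nonzero (false ∷ S) h = nonzero S (λ p → h λ { zero → refl ; (suc v) → p v })
  count-empty : ∀ {n} (S : Subset n) → + length (filter (perfectOn? S) ([] ∷ [])) ≡ one S
  count-empty S with perfectOn? S []
  ... | yes p = trans (cong (+_ ∘ length) (List.filter-accept (perfectOn? S) p)) (sym (zeros S p))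
  ... | no ¬p = trans (cong (+_ ∘ length) (List.filter-reject (perfectOn? S) ¬p)) (sym (nonzero S ¬p))
count-perfectOn {n} ((a , b) ∷ E) (a≢b ∷ ps) S = begin
  + length (filter (perfectOn? S) (map (e ∷_) (sublists E) ++ sublists E))
    ≡⟨ cong (+_ ∘ length) (List.filter-++ (perfectOn? S) (map (e ∷_) (sublists E)) _) ⟩
  + length (filter (perfectOn? S) (map (e ∷_) (sublists E)) ++ filter (perfectOn? S) (sublists E))
    ≡⟨ cong +_ (List.length-++ (filter (perfectOn? S) (map (e ∷_) (sublists E)))) ⟩
  + length (filter (perfectOn? S) (map (e ∷_) (sublists E))) ℤ.+ + length (filter (perfectOn? S) (sublists E))
    ≡⟨ cong₂ ℤ._+_ (trans (cong +_ (length-filter-map (perfectOn? S) (e ∷_) (sublists E))) with-e)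
         (count-perfectOn E ps S) ⟩
  shift a (shift b (cnt E)) S ℤ.+ cnt E S
    ≡⟨ ℤ.+-comm _ (cnt E S) ⟩
  cnt E S ℤ.+ shift a (shift b (cnt E)) S ∎
  where
  open ≡-Reasoning
  e = a , b
  S′ = (S [ a ]≔ false) [ b ]≔ false
  at-b : lookup (S [ a ]≔ false) b ≡ lookup S b
  at-b = lookup∘update′ (a≢b ∘ sym) S false
  at-a : lookup S′ a ≡ false
  at-a = trans (lookup∘update′ a≢b (S [ a ]≔ false) false) (lookup∘update a S false)
  elsewhere : ∀ v → ¬ Incident v e → lookup S′ v ≡ lookup S v
  elsewhere v i = trans (lookup∘update′ (i ∘ inj₂ ∘ sym) (S [ a ]≔ false) false)
                        (lookup∘update′ (i ∘ inj₁ ∘ sym) S false)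
  covers : ∀ v M → Incident v e → PerfectOn S (e ∷ M) → lookup S v ≡ true × length (filter (incident? v) M) ≡ 0
  covers v M i p = bit-suc (trans (sym (deg-incident v e M i)) (p v))
  reduce : ∀ {M} → PerfectOn S (e ∷ M) → PerfectOn S′ M
  reduce {M} p v with incident? v e
  ... | yes i@(inj₁ refl) = trans (proj₂ (covers v M i p)) (cong bit (sym at-a))
  ... | yes i@(inj₂ refl) = trans (proj₂ (covers v M i p)) (cong bit (sym (lookup∘update b (S [ a ]≔ false) false)))
  ... | no i = trans (sym (deg-other v e M i)) (trans (p v) (cong bit (sym (elsewhere v i))))
  extend : lookup S a ≡ true → lookup S b ≡ true → ∀ {M} → PerfectOn S′ M → PerfectOn S (e ∷ M)
  extend Sa Sb {M} p v with incident? v e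
  ... | yes i@(inj₁ refl) = trans (deg-incident v e M i)
          (trans (cong suc (trans (p v) (cong bit at-a))) (cong bit (sym Sa)))
  ... | yes i@(inj₂ refl) = trans (deg-incident v e M i)
          (trans (cong suc (trans (p v) (cong bit (lookup∘update b (S [ a ]≔ false) false)))) (cong bit (sym Sb)))
  ... | no i = trans (deg-other v e M i) (trans (p v) (cong bit (elsewhere v i)))
  none : (∀ M → ¬ PerfectOn S (e ∷ M)) → + length (filter (λ M → perfectOn? S (e ∷ M)) (sublists E)) ≡ + 0
  none h = cong (+_ ∘ length) (List.filter-none (λ M → perfectOn? S (e ∷ M)) (All.universal h (sublists E)))
  with-e : + length (filter (λ M → perfectOn? S (e ∷ M)) (sublists E)) ≡ shift a (shift b (cnt E)) S
  with-e with lookup S a in Sa | lookup (S [ a ]≔ false) b in Sb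
  ... | false | _ = none (λ M p → contradiction (trans (sym Sa) (proj₁ (covers a M (inj₁ refl) p))) λ ())
  ... | true | false = none (λ M p →
          contradiction (trans (sym Sb) (trans at-b (proj₁ (covers b M (inj₂ refl) p)))) λ ())
  ... | true | true = trans
          (cong (+_ ∘ length) (List.filter-≐ (λ M → perfectOn? S (e ∷ M)) (perfectOn? S′)
            (reduce , extend Sa (trans (sym at-b) Sb)) (sublists E)))
          (count-perfectOn E ps S′)

module _ {n : ℕ} (G : Graph n) where
  open Graph G

  edge? : Decidable (λ (e : Fin n × Fin n) → proj₁ e Fin.< proj₂ e × proj₁ e ~ proj₂ e)
  edge? e = (proj₁ e Fin.<? proj₂ e) ×-dec (proj₁ e ~? proj₂ e)

  ∈-edges⁻ : ∀ {e} → e List.∈ edges → proj₁ e Fin.< proj₂ e × proj₁ e ~ proj₂ e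
  ∈-edges⁻ p = proj₂ (∈-filter⁻ edge? {xs = cartesianProduct (allFin n) (allFin n)} p)

  ∈-edges⁺ : ∀ {u v} → u Fin.< v → u ~ v → (u , v) List.∈ edges
  ∈-edges⁺ {u} {v} u<v u~v = ∈-filter⁺ edge? (∈-cartesianProduct⁺ (∈-allFin u) (∈-allFin v)) (u<v , u~v)

  unique-edges : Unique edges
  unique-edges = Unique.filter⁺ edge? (Unique.cartesianProduct⁺ (Unique.allFin⁺ n) (Unique.allFin⁺ n))

  edge-distinct : All (λ e → proj₁ e ≢ proj₂ e) edges
  edge-distinct = All.tabulate λ p eq → Fin.<⇒≢ (proj₁ (∈-edges⁻ p)) eq

perfectMatchings-cnt : ∀ {n} (G : Graph n) → + #perfectMatchings G ≡ cnt (Graph.edges G) ⊤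
perfectMatchings-cnt G = trans
  (cong (+_ ∘ length) (List.filter-≐ perfect? (perfectOn? ⊤)
    ((λ p v → trans (p v) (cong bit (sym (lookup-replicate v true)))) , (λ p v → trans (p v) (cong bit (lookup-replicate v true))))
    (sublists (Graph.edges G))))
  (count-perfectOn (Graph.edges G) (edge-distinct G) ⊤)

-- Addressing

-- The row is an integer because the difference of two codes may be negative. The same scheme
-- addresses the tables (rows are codes), the adjacency matrix (rows are powers of three) and the
-- blocks of the enumeration.
cell : ℕ → ℤ → ℕ → ℤ
cell M z j = z ℤ.* + M ℤ.+ + j

cell-< : ∀ M {x y i j} → i < M → x ℤ.< y → cell M x i ℤ.< cell M y j
cell-< M {x} {y} {i} {j} i<M x<y = begin-strict
  x ℤ.* + M ℤ.+ + i     <⟨ ℤ.+-monoʳ-< (x ℤ.* + M) (ℤ.+<+ i<M) ⟩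
  x ℤ.* + M ℤ.+ + M     ≡⟨ arith x (+ M) ⟩
  (+ 1 ℤ.+ x) ℤ.* + M   ≤⟨ ℤ.*-monoʳ-≤-nonNeg (+ M) (ℤ.i<j⇒suc[i]≤j x<y) ⟩
  y ℤ.* + M             ≤⟨ ℤ.i≤i+j (y ℤ.* + M) (+ j) ⟩
  y ℤ.* + M ℤ.+ + j     ∎
  where
  open ℤ.≤-Reasoning
  arith : ∀ x m → x ℤ.* m ℤ.+ m ≡ (+ 1 ℤ.+ x) ℤ.* m
  arith = ℤ-solve

cell-injective : ∀ M {x y i j} → i < M → j < M → cell M x i ≡ cell M y j → x ≡ y × i ≡ j
cell-injective M {x} {y} {i} {j} i<M j<M eq with ℤ.<-cmp x y
... | tri< x<y _ _ = contradiction (cell-< M i<M x<y) (ℤ.<-irrefl eq)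
... | tri> _ _ y<x = contradiction (cell-< M j<M y<x) (ℤ.<-irrefl (sym eq))
... | tri≈ _ refl _ = refl , ℤ.+-injective (∙-cancelˡ (x ℤ.* + M) (+ i) (+ j) eq)

-- Coding subsets in base three

-- A borrow in a difference of codes produces a digit 2, so enc S - 3^u is a
-- code only if u ∈ S.
enc : ∀ {n} → Subset n → ℕ
enc []      = 0
enc (b ∷ S) = bit b + 3 * enc S

digit : ∀ {a b} x y → a < 3 → b < 3 → a + 3 * x ≡ b + 3 * y → a ≡ b × x ≡ y
digit {a} {b} zero    zero    _ _ eq = trans (sym (ℕ.+-identityʳ a)) (trans eq (ℕ.+-identityʳ b)) , refl
digit {a} {b} zero    (suc y) p _ eq =
  contradiction p (ℕ.≤⇒≯ (ℕ.≤-trans (ℕ.≤-trans (ℕ.m≤m*n 3 (suc y)) (ℕ.m≤n+m _ b)) (ℕ.≤-reflexive (trans (sym eq) (ℕ.+-identityʳ a)))))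
digit {a} {b} (suc x) zero    _ q eq =
  contradiction q (ℕ.≤⇒≯ (ℕ.≤-trans (ℕ.≤-trans (ℕ.m≤m*n 3 (suc x)) (ℕ.m≤n+m _ a)) (ℕ.≤-reflexive (trans eq (ℕ.+-identityʳ b)))))
digit {a} {b} (suc x) (suc y) p q eq with digit x y p q (ℕ.+-cancelˡ-≡ 3 _ _ (trans (arith a x) (trans eq (sym (arith b y)))))
  where
  arith : ∀ a x → 3 + (a + 3 * x) ≡ a + 3 * suc x
  arith = ℕ-solve
... | refl , refl = refl , refl

bit<2 : ∀ b → bit b < 2
bit<2 true  = s≤s (s≤s z≤n)
bit<2 false = s≤s z≤n

bit<3 : ∀ b → bit b < 3
bit<3 b = ℕ.<-trans (bit<2 b) (s≤s (s≤s (s≤s z≤n)))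

bit-injective : ∀ {a b} → bit a ≡ bit b → a ≡ b
bit-injective {true}  {true}  _ = refl
bit-injective {false} {false} _ = refl

enc-injective : ∀ {n} (S T : Subset n) → enc S ≡ enc T → S ≡ T
enc-injective []      []      _  = refl
enc-injective (a ∷ S) (b ∷ T) eq with digit _ _ (bit<3 a) (bit<3 b) eq
... | p , q = cong₂ _∷_ (bit-injective p) (enc-injective S T q)

enc-∅ : ∀ n → enc {n} ∅ ≡ 0
enc-∅ zero    = refl
enc-∅ (suc n) = cong (λ x → 3 * x) (enc-∅ n)

enc-remove : ∀ {n} u (S : Subset n) → lookup S u ≡ true → enc S ≡ enc (S [ u ]≔ false) + 3 ^ toℕ u
enc-remove zero    (true ∷ S) _ = ℕ.+-comm 1 _
enc-remove (suc u) (b ∷ S)    h = trans (cong (λ x → bit b + 3 * x) (enc-remove u S h))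
  (arith (bit b) (enc (S [ u ]≔ false)) (3 ^ toℕ u))
  where
  arith : ∀ b x p → b + 3 * (x + p) ≡ (b + 3 * x) + 3 * p
  arith = ℕ-solve

enc-borrow : ∀ {n} u (S T : Subset n) → enc S ≡ enc T + 3 ^ toℕ u → lookup S u ≡ true × T ≡ S [ u ]≔ false
enc-borrow zero (a ∷ S) (b ∷ T) eq
  -- The lowest digit `1 + bit b` is still below 3, so there is no carry and it must equal `bit a`;
  -- this leaves only a = true and b = false.
  with digit (enc S) (enc T) (bit<3 a) (s≤s (bit<2 b)) (trans eq (ℕ.+-comm (bit b + 3 * enc T) 1))
enc-borrow zero (true ∷ S) (false ∷ T) eq | _ , q = refl , cong (false ∷_) (sym (enc-injective S T q))
enc-borrow (suc u) (a ∷ S) (b ∷ T) eq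
  with digit (enc S) (enc T + 3 ^ toℕ u) (bit<3 a) (bit<3 b) (trans eq (arith (bit b) (enc T) (3 ^ toℕ u)))
  where
  arith : ∀ b x p → (b + 3 * x) + 3 * p ≡ b + 3 * (x + p)
  arith = ℕ-solve
... | p , q with bit-injective p | enc-borrow u S T q
...   | refl | h , refl = h , refl

enc-insert : ∀ {n} v (S : Subset n) → v ∉ S → enc (S ∪ ⁅ v ⁆) ≡ enc S + 3 ^ toℕ v
enc-insert zero    (true ∷ S)  v∉S = contradiction Vec.here v∉S
enc-insert zero    (false ∷ S) v∉S rewrite ∪-identityʳ S = ℕ.+-comm 1 _
enc-insert (suc v) (b ∷ S)     v∉S rewrite enc-insert v S (v∉S ∘ Vec.there) = arith b (enc S) (3 ^ toℕ v)
  where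
  arith : ∀ b x p → bit (b ∨ false) + 3 * (x + p) ≡ (bit b + 3 * x) + 3 * p
  arith true  = ℕ-solve
  arith false = ℕ-solve

-- Sums over pairs of disjoint subsets

sumN : ℕ → (ℕ → ℤ) → ℤ
sumN zero    f = + 0
sumN (suc n) f = sumN n f ℤ.+ f n

sumN-cong : ∀ n {f g} → (∀ i → i < n → f i ≡ g i) → sumN n f ≡ sumN n g
sumN-cong zero    eq = refl
sumN-cong (suc n) eq = cong₂ ℤ._+_ (sumN-cong n (λ i i<n → eq i (ℕ.m<n⇒m<1+n i<n))) (eq n ℕ.≤-refl)

sumN-0 : ∀ n → sumN n (λ _ → + 0) ≡ + 0
sumN-0 zero    = refl
sumN-0 (suc n) = cong (ℤ._+ + 0) (sumN-0 n)

sumN-+ : ∀ n f g → sumN n (λ i → f i ℤ.+ g i) ≡ sumN n f ℤ.+ sumN n g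
sumN-+ zero    f g = refl
sumN-+ (suc n) f g = trans (cong (ℤ._+ (f n ℤ.+ g n)) (sumN-+ n f g)) (interchange (sumN n f) _ _ _)

sumN-append : ∀ a b f → sumN (b + a) f ≡ sumN a f ℤ.+ sumN b (λ i → f (i + a))
sumN-append a zero    f = sym (ℤ.+-identityʳ _)
sumN-append a (suc b) f = trans (cong (ℤ._+ f (b + a)) (sumN-append a b f)) (ℤ.+-assoc (sumN a f) _ _)

sumN-swap : ∀ a b (f : ℕ → ℕ → ℤ) → sumN a (λ i → sumN b (f i)) ≡ sumN b (λ j → sumN a (λ i → f i j))
sumN-swap zero    b f = sym (sumN-0 b)
sumN-swap (suc a) b f = trans (cong (ℤ._+ sumN b (f a)) (sumN-swap a b f)) (sym (sumN-+ b _ (f a)))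

sumN-* : ∀ k n f → sumN (k * n) f ≡ sumN k (λ d → sumN n (λ i → f (i + d * n)))
sumN-* zero    n f = refl
sumN-* (suc k) n f = trans (sumN-append (k * n) n f) (cong (ℤ._+ sumN n (λ i → f (i + k * n))) (sumN-* k n f))

-- A vertex joins neither part, the first part or the second part according as
-- the digit d is 0, 1 or 2.
left right : ℕ → Bool
left 1  = true
left _  = false
right 2 = true
right _ = false

plus : Bool → ℤ → ℤ → ℤ
plus b p a = if b then a ℤ.+ p else a

-- The form in which the machine meets the sum: `a` and `b` are the codes chosen so far, the list
-- holds the undecided vertices, and `h` is summed over all completions. `pairSum` is the same sum
-- over actual subsets.
spread : ∀ {n} → ℕ → List (Fin n) → (ℤ → ℤ → ℤ) → ℤ → ℤ → ℤ
spread κ []       h a b = h a b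
spread κ (x ∷ xs) h a b =
  sumN κ (λ d → spread κ xs h (plus (left d) (+ (3 ^ toℕ x)) a) (plus (right d) (+ (3 ^ toℕ x)) b))

-- With κ = 3 the sum of k(A,B) over disjoint A, B ⊆ X; with κ = 2 only B = ∅.
pairSum : ∀ {n} → ℕ → Subset n → (Subset n → Subset n → ℤ) → ℤ
pairSum κ []          k = k [] []
pairSum κ (false ∷ X) k = pairSum κ X (λ A B → k (false ∷ A) (false ∷ B))
pairSum κ (true ∷ X)  k = sumN κ (λ d → pairSum κ X (λ A B → k (left d ∷ A) (right d ∷ B)))

pairSum-cong : ∀ {n} κ (X : Subset n) {k l : Subset n → Subset n → ℤ} →
               (∀ A B → k A B ≡ l A B) → pairSum κ X k ≡ pairSum κ X l
pairSum-cong κ []          eq = eq [] []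
pairSum-cong κ (false ∷ X) eq = pairSum-cong κ X (λ A B → eq _ _)
pairSum-cong κ (true ∷ X)  eq = sumN-cong κ (λ d _ → pairSum-cong κ X (λ A B → eq _ _))

elems : ∀ {n} → Subset n → List (Fin n)
elems X = filter (_∈? X) (allFin _)

filter-suc : ∀ {n} b (X : Subset n) → filter (_∈? (b ∷ X)) (tabulate suc) ≡ map suc (elems X)
filter-suc {n} b X = go (allFin n) (List.map-tabulate id suc)
  where
  step : ∀ xs → filter (_∈? (b ∷ X)) (map suc xs) ≡ map suc (filter (_∈? X) xs)
  step []       = refl
  step (x ∷ xs) with does (x ∈? X)
  ... | true  = cong (suc x ∷_) (step xs)
  ... | false = step xs
  go : ∀ {ys} xs → map suc xs ≡ ys → filter (_∈? (b ∷ X)) ys ≡ map suc (filter (_∈? X) xs)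
  go xs refl = step xs

elems-out : ∀ {n} (X : Subset n) → elems (false ∷ X) ≡ map suc (elems X)
elems-out X = filter-suc false X

elems-in : ∀ {n} (X : Subset n) → elems (true ∷ X) ≡ zero ∷ map suc (elems X)
elems-in X = cong (zero ∷_) (filter-suc true X)

length-elems : ∀ {n} (X : Subset n) → length (elems X) ≡ ∣ X ∣
length-elems []          = refl
length-elems (false ∷ X) = trans (cong length (elems-out X)) (trans (List.length-map suc (elems X)) (length-elems X))
length-elems (true ∷ X)  = trans (cong length (elems-in X)) (cong suc (trans (List.length-map suc (elems X)) (length-elems X)))

weight : ∀ {n} → List (Fin n) → ℕ
weight []       = 0
weight (x ∷ xs) = 3 ^ toℕ x + weight xs

weight-elems : ∀ {n} (X : Subset n) → weight (elems X) ≡ enc X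
weight-suc : ∀ {n} (xs : List (Fin n)) → weight (map suc xs) ≡ 3 * weight xs
weight-suc []       = refl
weight-suc (x ∷ xs) = trans (cong (λ w → 3 * 3 ^ toℕ x + w) (weight-suc xs)) (sym (ℕ.*-distribˡ-+ 3 (3 ^ toℕ x) (weight xs)))
weight-elems []          = refl
weight-elems (false ∷ X) = trans (cong weight (elems-out X)) (trans (weight-suc (elems X)) (cong (λ w → 3 * w) (weight-elems X)))
weight-elems (true ∷ X)  = trans (cong weight (elems-in X))
  (cong suc (trans (weight-suc (elems X)) (cong (λ w → 3 * w) (weight-elems X))))

-- Passing from x to `suc x` multiplies its power of three by 3, which frees the lowest digit for
-- `c` and `d`.
spread-suc : ∀ {n} κ (xs : List (Fin n)) h c d a b →
             spread κ (map suc xs) h (c ℤ.+ + 3 ℤ.* a) (d ℤ.+ + 3 ℤ.* b)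
             ≡ spread κ xs (λ a b → h (c ℤ.+ + 3 ℤ.* a) (d ℤ.+ + 3 ℤ.* b)) a b
spread-suc κ []       h c d a b = refl
spread-suc κ (x ∷ xs) h c d a b = sumN-cong κ λ i _ →
  trans (cong₂ (spread κ (map suc xs) h) (plus-suc (left i) c a) (plus-suc (right i) d b))
        (spread-suc κ xs h c d _ _)
  where
  plus-suc : ∀ t c a → plus t (+ (3 ^ toℕ (suc x))) (c ℤ.+ + 3 ℤ.* a) ≡ c ℤ.+ + 3 ℤ.* plus t (+ (3 ^ toℕ x)) a
  plus-suc false c a = refl
  plus-suc true  c a = trans (cong (λ p → c ℤ.+ + 3 ℤ.* a ℤ.+ p) (ℤ.pos-* 3 (3 ^ toℕ x))) (arith c a (+ (3 ^ toℕ x)))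
    where
    arith : ∀ c a p → c ℤ.+ + 3 ℤ.* a ℤ.+ + 3 ℤ.* p ≡ c ℤ.+ + 3 ℤ.* (a ℤ.+ p)
    arith = ℤ-solve

pos-digit : ∀ b x → + bit b ℤ.+ + 3 ℤ.* + x ≡ + (bit b + 3 * x)
pos-digit b x = cong (ℤ._+_ (+ bit b)) (sym (ℤ.pos-* 3 x))

spread-elems : ∀ {n} κ (X : Subset n) h →
               spread κ (elems X) h (+ 0) (+ 0) ≡ pairSum κ X (λ A B → h (+ enc A) (+ enc B))
spread-elems κ []          h = refl
spread-elems κ (false ∷ X) h = begin
  spread κ (elems (false ∷ X)) h (+ 0) (+ 0)
    ≡⟨ cong (λ xs → spread κ xs h (+ 0) (+ 0)) (elems-out X) ⟩
  spread κ (map suc (elems X)) h (+ 0) (+ 0)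
    ≡⟨ spread-suc κ (elems X) h (+ 0) (+ 0) (+ 0) (+ 0) ⟩
  spread κ (elems X) (λ a b → h (+ 0 ℤ.+ + 3 ℤ.* a) (+ 0 ℤ.+ + 3 ℤ.* b)) (+ 0) (+ 0)
    ≡⟨ spread-elems κ X _ ⟩
  pairSum κ X (λ A B → h (+ 0 ℤ.+ + 3 ℤ.* + enc A) (+ 0 ℤ.+ + 3 ℤ.* + enc B))
    ≡⟨ pairSum-cong κ X (λ A B → cong₂ h (pos-digit false (enc A)) (pos-digit false (enc B))) ⟩
  pairSum κ X (λ A B → h (+ enc (false ∷ A)) (+ enc (false ∷ B))) ∎
  where open ≡-Reasoning
spread-elems κ (true ∷ X)  h = trans (cong (λ xs → spread κ xs h (+ 0) (+ 0)) (elems-in X)) (sumN-cong κ λ d _ → begin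
  spread κ (map suc (elems X)) h (plus (left d) (+ 1) (+ 0)) (plus (right d) (+ 1) (+ 0))
    ≡⟨ cong₂ (spread κ (map suc (elems X)) h) (plus-bit (left d)) (plus-bit (right d)) ⟩
  spread κ (map suc (elems X)) h (+ bit (left d) ℤ.+ + 3 ℤ.* + 0) (+ bit (right d) ℤ.+ + 3 ℤ.* + 0)
    ≡⟨ spread-suc κ (elems X) h (+ bit (left d)) (+ bit (right d)) (+ 0) (+ 0) ⟩
  spread κ (elems X) (λ a b → h (+ bit (left d) ℤ.+ + 3 ℤ.* a) (+ bit (right d) ℤ.+ + 3 ℤ.* b)) (+ 0) (+ 0)
    ≡⟨ spread-elems κ X _ ⟩
  pairSum κ X (λ A B → h (+ bit (left d) ℤ.+ + 3 ℤ.* + enc A) (+ bit (right d) ℤ.+ + 3 ℤ.* + enc B))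
    ≡⟨ pairSum-cong κ X (λ A B → cong₂ h (pos-digit (left d) (enc A)) (pos-digit (right d) (enc B))) ⟩
  pairSum κ X (λ A B → h (+ enc (left d ∷ A)) (+ enc (right d ∷ B))) ∎)
  where
  open ≡-Reasoning
  plus-bit : ∀ b → plus b (+ 1) (+ 0) ≡ + bit b ℤ.+ + 3 ℤ.* + 0
  plus-bit true  = refl
  plus-bit false = refl

select : ℕ → ℕ → ℤ → ℤ
select a b x = if does (a ℕ.≟ b) then x else + 0

select-miss : ∀ {a b} x → a ≢ b → select a b x ≡ + 0
select-miss {a} {b} x a≢b rewrite dec-false (a ℕ.≟ b) a≢b = refl

select-hit : ∀ {a b} x → a ≡ b → select a b x ≡ x
select-hit {a} {b} x a≡b rewrite dec-true (a ℕ.≟ b) a≡b = refl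

carry : ∀ i j a b → (i + 3 * a) + (j + 3 * b) ≡ (i + j) + 3 * (a + b)
carry = ℕ-solve

-- The lowest digits add up to less than 3, so no carry occurs and the comparison of codes splits
-- off its lowest digit.
select-enc : ∀ {n} i j s (A B S : Subset n) x → bit i + bit j < 3 →
             select (enc (i ∷ A) + enc (j ∷ B)) (enc (s ∷ S)) x
             ≡ select (bit i + bit j) (bit s) (select (enc A + enc B) (enc S) x)
select-enc i j s A B S x i+j<3 with bit i + bit j ℕ.≟ bit s | enc A + enc B ℕ.≟ enc S
... | yes p | yes q = trans (select-hit x (trans (carry (bit i) (bit j) (enc A) (enc B)) (cong₂ (λ c z → c + 3 * z) p q)))
                            (sym (trans (select-hit _ p) (select-hit x q)))
... | yes p | no ¬q = trans (select-miss x (λ eq → ¬q (proj₂ (digit (enc A + enc B) (enc S) i+j<3 (bit<3 s) (trans (sym (carry (bit i) (bit j) (enc A) (enc B))) eq)))))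
                            (sym (trans (select-hit _ p) (select-miss x ¬q)))
... | no ¬p | _ = trans (select-miss x (λ eq → ¬p (proj₁ (digit (enc A + enc B) (enc S) i+j<3 (bit<3 s) (trans (sym (carry (bit i) (bit j) (enc A) (enc B))) eq)))))
                        (sym (select-miss _ ¬p))

left+right<3 : ∀ d → bit (left d) + bit (right d) < 3
left+right<3 0 = s≤s z≤n
left+right<3 1 = s≤s (s≤s z≤n)
left+right<3 2 = s≤s (s≤s z≤n)
left+right<3 (suc (suc (suc _))) = s≤s z≤n

-- The codes of a generated pair add up to the code of the union, again a subset of X. A summand
-- guarded by an address that is no such code therefore never fires.
pairSum-vanish : ∀ {n} κ (X : Subset n) {k : Subset n → Subset n → ℤ} →
                 (∀ A B S → S ⊆ X → A ⊆ X → enc A + enc B ≡ enc S → k A B ≡ + 0) → pairSum κ X k ≡ + 0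
pairSum-vanish κ []          z = z [] [] [] id id refl
pairSum-vanish κ (false ∷ X) z = pairSum-vanish κ X λ A B S p q eq →
  z _ _ (false ∷ S) (out⊆ p) (out⊆ q) (trans (arith (enc A) (enc B)) (cong (λ x → 3 * x) eq))
  where
  arith : ∀ a b → 3 * a + 3 * b ≡ 3 * (a + b)
  arith = ℕ-solve
pairSum-vanish κ (true ∷ X)  z = trans (sumN-cong κ λ d _ → pairSum-vanish κ X λ A B S p q eq →
  z _ _ ((left d ∨ right d) ∷ S) (in-⊆ p) (in-⊆ q)
    (trans (carry (bit (left d)) (bit (right d)) (enc A) (enc B)) (cong₂ (λ c x → c + 3 * x) (bits d) eq))) (sumN-0 κ)
  where
  in-⊆ : ∀ {b A} → A ⊆ X → (b ∷ A) ⊆ (true ∷ X)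
  in-⊆ {true}  p = in⊆in p
  in-⊆ {false} p = out⊆ p
  bits : ∀ d → bit (left d) + bit (right d) ≡ bit (left d ∨ right d)
  bits 0 = refl
  bits 1 = refl
  bits 2 = refl
  bits (suc (suc (suc _))) = refl

pairSum-0 : ∀ {n} κ (X : Subset n) → pairSum κ X (λ _ _ → + 0) ≡ + 0
pairSum-0 κ X = pairSum-vanish κ X (λ _ _ _ _ _ _ → refl)

pairSum-step : ∀ {n} κ (X S : Subset n) s d (k : Subset n → Subset n → ℤ) → ∀ {r} →
  bit (left d) + bit (right d) ≡ bit s →
  pairSum κ X (λ A B → select (enc A + enc B) (enc S) (k A B)) ≡ r →
  pairSum κ X (λ A B → select (enc (left d ∷ A) + enc (right d ∷ B)) (enc (s ∷ S)) (k A B)) ≡ r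
pairSum-step κ X S s d k hit eq = trans (pairSum-cong κ X λ A B →
  trans (select-enc (left d) (right d) s A B S _ (left+right<3 d)) (select-hit _ hit)) eq

pairSum-skip : ∀ {n} κ (X S : Subset n) s d (k : Subset n → Subset n → ℤ) →
  bit (left d) + bit (right d) ≢ bit s →
  pairSum κ X (λ A B → select (enc (left d ∷ A) + enc (right d ∷ B)) (enc (s ∷ S)) (k A B)) ≡ + 0
pairSum-skip κ X S s d k miss = trans (pairSum-cong κ X λ A B →
  trans (select-enc (left d) (right d) s A B S _ (left+right<3 d)) (select-miss _ miss)) (pairSum-0 κ X)

-- With the digits 0 and 1 only, the second part stays empty, and (S , ∅) is the only pair whose
-- code sum is that of S.
pairSum-single : ∀ {n} (X S : Subset n) → S ⊆ X → ∀ (k : Subset n → Subset n → ℤ) →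
                 pairSum 2 X (λ A B → select (enc A + enc B) (enc S) (k A B)) ≡ k S ∅
pairSum-single []          []          _   k = refl
pairSum-single (false ∷ X) (true ∷ S)  S⊆X k = contradiction (S⊆X Vec.here) λ ()
pairSum-single (false ∷ X) (false ∷ S) S⊆X k = pairSum-step 2 X S false 0 _ refl (pairSum-single X S (drop-∷-⊆ S⊆X) _)
pairSum-single (true ∷ X)  (false ∷ S) S⊆X k = trans (cong₂ (λ x y → + 0 ℤ.+ x ℤ.+ y)
  (pairSum-step 2 X S false 0 _ refl (pairSum-single X S (drop-∷-⊆ S⊆X) _))
  (pairSum-skip 2 X S false 1 _ λ ())) (trans (ℤ.+-identityʳ _) (ℤ.+-identityˡ _))
pairSum-single (true ∷ X)  (true ∷ S)  S⊆X k = trans (cong₂ (λ x y → + 0 ℤ.+ x ℤ.+ y)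
  (pairSum-skip 2 X S true 0 _ λ ())
  (pairSum-step 2 X S true 1 _ refl (pairSum-single X S (drop-∷-⊆ S⊆X) _))) (ℤ.+-identityˡ _)

-- The generated pairs with code sum `enc S` are exactly the splittings of S: a vertex of S takes
-- digit 1 or 2, any other vertex takes digit 0.
pairSum-conv : ∀ {n} (X S : Subset n) → S ⊆ X → ∀ (k : Subset n → Subset n → ℤ) →
               pairSum 3 X (λ A B → select (enc A + enc B) (enc S) (k A B)) ≡ conv k S
pairSum-conv []          []          _   k = refl
pairSum-conv (false ∷ X) (true ∷ S)  S⊆X k = contradiction (S⊆X Vec.here) λ ()
pairSum-conv (false ∷ X) (false ∷ S) S⊆X k = pairSum-step 3 X S false 0 _ refl (pairSum-conv X S (drop-∷-⊆ S⊆X) _)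
pairSum-conv (true ∷ X)  (false ∷ S) S⊆X k = trans (cong₂ ℤ._+_ (cong₂ (λ x y → + 0 ℤ.+ x ℤ.+ y)
  (pairSum-step 3 X S false 0 _ refl (pairSum-conv X S (drop-∷-⊆ S⊆X) _))
  (pairSum-skip 3 X S false 1 _ λ ())) (pairSum-skip 3 X S false 2 _ λ ()))
  (trans (ℤ.+-identityʳ _) (trans (ℤ.+-identityʳ _) (ℤ.+-identityˡ _)))
pairSum-conv (true ∷ X)  (true ∷ S)  S⊆X k = trans (cong₂ ℤ._+_ (cong₂ (λ x y → + 0 ℤ.+ x ℤ.+ y)
  (pairSum-skip 3 X S true 0 _ λ ())
  (pairSum-step 3 X S true 1 _ refl (pairSum-conv X S (drop-∷-⊆ S⊆X) _)))
  (pairSum-step 3 X S true 2 _ refl (pairSum-conv X S (drop-∷-⊆ S⊆X) _)))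
  (cong (ℤ._+ conv (λ A B → k (false ∷ A) (true ∷ B)) S)
    (ℤ.+-identityˡ (conv (λ A B → k (true ∷ A) (false ∷ B)) S)))

-- Combining tables

-- The program visits each pair once and adds its value at the cell of its code sum. This is the
-- outcome seen from one cell z, the test selecting the pairs that were added there.
combine : ∀ {n} → ℕ → Subset n → (ℤ → ℤ → ℤ) → ℤ → ℤ
combine κ X V z = pairSum κ X (λ A B →
  if does ((+ enc A ℤ.+ + enc B) ℤ.≟ z) then V (+ enc A) (+ enc B) else + 0)

combine-miss : ∀ {n} κ (X : Subset n) V z → (∀ S → S ⊆ X → z ≢ + enc S) → combine κ X V z ≡ + 0
combine-miss κ X V z h = pairSum-vanish κ X λ A B S S⊆X _ eq →
  cong (λ b → if b then V (+ enc A) (+ enc B) else + 0)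
    (dec-false ((+ enc A ℤ.+ + enc B) ℤ.≟ z) (λ eq′ → h S S⊆X (trans (sym eq′) (cong +_ eq))))

lookup-∈ : ∀ {n v} {S : Subset n} → v ∈ S → lookup S v ≡ true
lookup-∈ = []=⇒lookup

∈-elems⁻ : ∀ {n v} {S : Subset n} → v List.∈ elems S → v ∈ S
∈-elems⁻ {S = S} = proj₂ ∘ ∈-filter⁻ (_∈? S) {xs = allFin _}

∈-elems⁺ : ∀ {n v} {S : Subset n} → v ∈ S → v List.∈ elems S
∈-elems⁺ {v = v} {S} = ∈-filter⁺ (_∈? S) (∈-allFin v)

remove-⊆ : ∀ {n} u (S : Subset n) → (S [ u ]≔ false) ⊆ S
remove-⊆ zero    (b ∷ S) (Vec.there p) = Vec.there p
remove-⊆ (suc u) (b ∷ S) Vec.here      = Vec.here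
remove-⊆ (suc u) (b ∷ S) (Vec.there p) = Vec.there (remove-⊆ u S p)

remove-∪ : ∀ {n} u (F S : Subset n) → u ∉ F → (F ∪ S) [ u ]≔ false ≡ F ∪ (S [ u ]≔ false)
remove-∪ zero    (true ∷ F)  (s ∷ S) u∉F = contradiction Vec.here u∉F
remove-∪ zero    (false ∷ F) (s ∷ S) u∉F = refl
remove-∪ (suc u) (f ∷ F)     (s ∷ S) u∉F = cong ((f ∨ s) ∷_) (remove-∪ u F S (u∉F ∘ Vec.there))

lookup-∪ : ∀ {n} u (F S : Subset n) → u ∉ F → lookup (F ∪ S) u ≡ lookup S u
lookup-∪ zero    (true ∷ F)  (s ∷ S) u∉F = contradiction Vec.here u∉F
lookup-∪ zero    (false ∷ F) (s ∷ S) u∉F = refl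
lookup-∪ (suc u) (f ∷ F)     (s ∷ S) u∉F = lookup-∪ u F S (u∉F ∘ Vec.there)

remove-insert : ∀ {n} v (S : Subset n) → v ∉ S → (S ∪ ⁅ v ⁆) [ v ]≔ false ≡ S
remove-insert zero    (true ∷ S)  v∉S = contradiction Vec.here v∉S
remove-insert zero    (false ∷ S) v∉S = cong (false ∷_) (∪-identityʳ S)
remove-insert (suc v) (true ∷ S)  v∉S = cong (true ∷_) (remove-insert v S (v∉S ∘ Vec.there))
remove-insert (suc v) (false ∷ S) v∉S = cong (false ∷_) (remove-insert v S (v∉S ∘ Vec.there))

∪-⊆ : ∀ {n} {A B C : Subset n} → A ⊆ C → B ⊆ C → A ∪ B ⊆ C
∪-⊆ {A = A} {B} p q x∈ = [ p , q ]′ (x∈p∪q⁻ A B x∈)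

-- `edges` lists the smaller end first, and the star of v must take that form before it can be
-- compared with it.
orient : ∀ {n} → Fin n → Fin n → Fin n × Fin n
orient v u = if does (v Fin.<? u) then (v , u) else (u , v)

cnt-orient : ∀ {n} (v : Fin n) us E S → cnt (map (orient v) us ++ E) S ≡ cnt (map (v ,_) us ++ E) S
cnt-orient v []       E S = refl
cnt-orient v (u ∷ us) E S with does (v Fin.<? u)
... | true  = cong₂ ℤ._+_ (cnt-orient v us E S) (shift-cong v (shift-cong u (cnt-orient v us E)) S)
... | false = cong₂ ℤ._+_ (cnt-orient v us E S)
  (trans (shift-cong u (shift-cong v (cnt-orient v us E)) S) (shift-comm u v (cnt (map (v ,_) us ++ E)) S))

orient-injective : ∀ {n} (v : Fin n) {u u′} → orient v u ≡ orient v u′ → u ≡ u′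
orient-injective v {u} {u′} eq with does (v Fin.<? u) | does (v Fin.<? u′)
... | true  | true  = cong proj₂ eq
... | true  | false = trans (cong proj₂ eq) (cong proj₁ eq)
... | false | true  = trans (cong proj₁ eq) (cong proj₂ eq)
... | false | false = cong proj₁ eq

-- The program does not branch on adjacency but multiplies by an entry of the adjacency matrix.
lsum-filter : ∀ {A : Set} {P : Pred A 0ℓ} (P? : Decidable P) f xs →
              lsum f (filter P? xs) ≡ lsum (λ x → (if does (P? x) then + 1 else + 0) ℤ.* f x) xs
lsum-filter P? f []       = refl
lsum-filter P? f (x ∷ xs) with does (P? x)
... | true  = cong₂ ℤ._+_ (sym (ℤ.*-identityˡ (f x))) (lsum-filter P? f xs)
... | false = trans (lsum-filter P? f xs) (sym (trans (cong (ℤ._+ rest) (ℤ.*-zeroˡ (f x))) (ℤ.+-identityˡ rest)))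
  where rest = lsum (λ x → (if does (P? x) then + 1 else + 0) ℤ.* f x) xs

touches? : ∀ {n} (F : Subset n) (e : Fin n × Fin n) → Dec (proj₁ e ∈ F ⊎ proj₂ e ∈ F)
touches? F e = (proj₁ e ∈? F) ⊎-dec (proj₂ e ∈? F)

-- Forgotten vertices

module _ {n m : ℕ} {G : Graph n} (D : TreeDecomposition G m) where
  open Graph G
  open TreeDecomposition D

  infix 4 _⊑_

  _⊑_ : Fin m → Fin m → Set
  k ⊑ j = Star (λ a b → parent a ≡ just b) k j

  Below : Fin m → Fin n → Set
  Below i v = ∃[ k ] (k ⊑ i × v ∈ bag k)

  steps : ∀ {i j} → i ⊑ j → ℕ
  steps ε       = 0
  steps (_ ◅ p) = suc (steps p)

  steps-◅◅ : ∀ {i j k} (p : i ⊑ j) (q : j ⊑ k) → steps (p ◅◅ q) ≡ steps p + steps q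
  steps-◅◅ ε       q = refl
  steps-◅◅ (_ ◅ p) q = cong suc (steps-◅◅ p q)

  root-top : ∀ {j} → parent root ≢ just j
  root-top eq = case trans (sym (Equivalence.from (parent-root root) refl)) eq of λ ()

  steps-unique : ∀ {i} (p q : i ⊑ root) → steps p ≡ steps q
  steps-unique ε       ε       = refl
  steps-unique ε       (y ◅ q) = contradiction y root-top
  steps-unique (x ◅ p) ε       = contradiction x root-top
  steps-unique (x ◅ p) (y ◅ q) with just-injective (trans (sym x) y)
  ... | refl = cong suc (steps-unique p q)

  -- As `parent` is a function, the distance to the root is well defined; going round a cycle would
  -- make it larger than itself.
  acyclic : ∀ {i j} → parent j ≡ just i → ¬ (i ⊑ j)
  acyclic {i} {j} e s = ℕ.m≢1+n+m (steps p) (trans (steps-unique p (s ◅◅ (e ◅ p)))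
    (trans (steps-◅◅ s (e ◅ p)) (ℕ.+-suc (steps s) (steps p))))
    where p = reach-root i

  -- The only tree edge out of the subtree of j joins j to its parent. A walk inside the bags
  -- containing v therefore stays in the subtree or shows that v lies in both of these bags. All
  -- uses of connectedness go through this lemma.
  leave : ∀ {v j k l} → Star (λ k l → v ∈ bag k × v ∈ bag l × TreeEdge k l) k l → k ⊑ j →
          l ⊑ j ⊎ (v ∈ bag j × ∃[ b ] (parent j ≡ just b × v ∈ bag b))
  leave ε s = inj₁ s
  leave ((p , q , inj₁ e) ◅ path) ε = inj₂ (p , _ , e , q)
  leave ((p , q , inj₁ e) ◅ path) (e′ ◅ s) with just-injective (trans (sym e) e′)
  ... | refl = leave path s
  leave ((p , q , inj₂ e) ◅ path) s = leave path (e ◅ s)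

  ⊑-chain : ∀ {b j k} → b ⊑ j → b ⊑ k → j ⊑ k ⊎ k ⊑ j
  ⊑-chain ε       q = inj₁ q
  ⊑-chain (x ◅ p) ε = inj₂ (x ◅ p)
  ⊑-chain (x ◅ p) (y ◅ q) with just-injective (trans (sym x) y)
  ... | refl = ⊑-chain p q

  ⊑-last : ∀ {k i} → k ⊑ i → k ≡ i ⊎ ∃[ c ] (parent c ≡ just i × k ⊑ c)
  ⊑-last ε = inj₁ refl
  ⊑-last (x ◅ p) with ⊑-last p
  ... | inj₁ refl        = inj₂ (_ , x , ε)
  ... | inj₂ (c , e , q) = inj₂ (c , e , x ◅ q)

  below-child : ∀ {c i v} → parent c ≡ just i → Below c v → Below i v
  below-child e (k , s , v∈k) = k , s ◅◅ (e ◅ ε) , v∈k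

  below-split : ∀ {i v} → Below i v → v ∈ bag i ⊎ ∃[ c ] (parent c ≡ just i × Below c v)
  below-split (k , s , v∈k) with ⊑-last s
  ... | inj₁ refl        = inj₁ v∈k
  ... | inj₂ (c , e , q) = inj₂ (c , e , k , q , v∈k)

  below-bag : ∀ {c i v} → parent c ≡ just i → Below c v → v ∈ bag i → v ∈ bag c
  below-bag {v = v} e (k , s , v∈k) v∈i with leave (bags-connected v v∈k v∈i) s
  ... | inj₁ i⊑c     = contradiction i⊑c (acyclic e)
  ... | inj₂ (p , _) = p

  -- A walk between the two subtrees has to leave the first one through i. If it did not leave, its
  -- end would lie below both j and k; then one of them would be below the other, which is
  -- impossible for distinct children of i.
  siblings : ∀ {i j k v} → parent j ≡ just i → parent k ≡ just i → j ≢ k → Below j v → Below k v → v ∈ bag i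
  siblings {i} {j} {k} {v} ej ek j≢k (a , s , v∈a) (b , t , v∈b) with leave (bags-connected v v∈a v∈b) s
  ... | inj₂ (_ , i′ , e , p) = subst (λ i → v ∈ bag i) (just-injective (trans (sym e) ej)) p
  ... | inj₁ b⊑j = ⊥-elim ([ apart ej ek j≢k , apart ek ej (j≢k ∘ sym) ]′ (⊑-chain b⊑j t))
    where
    apart : ∀ {j k} → parent j ≡ just i → parent k ≡ just i → j ≢ k → ¬ (j ⊑ k)
    apart ej ek j≢k ε = j≢k refl
    apart ej ek j≢k (x ◅ p) with just-injective (trans (sym ej) x)
    ... | refl = acyclic ek p

  -- The bag covering the edge contains u, and since u is missing from the bag of i, the nodes
  -- holding u cannot extend beyond the subtree. So all edges at a forgotten vertex are already
  -- visible below.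
  below-edge : ∀ {i u v} → Below i u → u ∉ bag i → u ~ v → Below i v
  below-edge {u = u} (a , s , u∈a) u∉i u~v with edge-covered u~v
  ... | k , u∈k , v∈k with leave (bags-connected u u∈a u∈k) s
  ...   | inj₁ k⊑i       = k , k⊑i , v∈k
  ...   | inj₂ (u∈i , _) = contradiction u∈i u∉i

  ∈-children : ∀ {c i} → c List.∈ children i → parent c ≡ just i
  ∈-children {i = i} = proj₂ ∘ ∈-filter⁻ (λ j → Maybe.≡-dec Fin._≟_ (parent j) (just i)) {xs = allFin m}

  children-∈ : ∀ {c i} → parent c ≡ just i → c List.∈ children i
  children-∈ {c} {i} = ∈-filter⁺ (λ j → Maybe.≡-dec Fin._≟_ (parent j) (just i)) (∈-allFin c)

  unique-children : ∀ i → Unique (children i)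
  unique-children i = Unique.filter⁺ (λ j → Maybe.≡-dec Fin._≟_ (parent j) (just i)) (Unique.allFin⁺ m)

  -- F is characterised instead of computed, so that each kind of node can supply the expression its
  -- recurrence uses: ∅, F, F ∪ {v} or F₁ ∪ F₂.
  record Forgotten (i : Fin m) (F : Subset n) : Set where
    field
      ∉-bag    : ∀ {v} → v ∈ F → v ∉ bag i
      below    : ∀ {v} → v ∈ F → Below i v
      complete : ∀ {v} → Below i v → v ∉ bag i → v ∈ F
  open Forgotten

  touching : Subset n → List (Fin n × Fin n)
  touching F = filter (touches? F) edges

  -- Combinatorially, the number of sets of edges touching F that cover each vertex of F ∪ S exactly
  -- once and no other vertex.
  φ : Subset n → Subset n → ℤ
  φ F S = cnt (touching F) (F ∪ S)

  -- The table of a node with bag X and set F of forgotten vertices.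
  record Table (X F : Subset n) (t : ℤ → ℤ) : Set where
    field
      hit  : ∀ S → S ⊆ X → t (+ enc S) ≡ φ F S
      miss : ∀ z → (∀ S → S ⊆ X → z ≢ + enc S) → t z ≡ + 0
  open Table

  -- For leaf, introduce and forget nodes only the values at codes need an argument: nothing is ever
  -- deposited elsewhere.
  table-combine₂ : ∀ {X F V} → (∀ S → S ⊆ X → V (+ enc S) (+ 0) ≡ φ F S) → Table X F (combine 2 X V)
  table-combine₂ {X} {F} {V} h .hit S S⊆X = trans (pairSum-single X S S⊆X (λ A B → V (+ enc A) (+ enc B)))
    (trans (cong (λ e → V (+ enc S) (+ e)) (enc-∅ n)) (h S S⊆X))
  table-combine₂ {X} {F} {V} h .miss = combine-miss 2 X V

  ∅-touching : touching ∅ ≡ []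
  ∅-touching = List.filter-none (touches? ∅) (All.universal (λ _ → [ ∉⊥ , ∉⊥ ]′) edges)

  one-∅ : ∀ n → one {n} ∅ ≡ + 1
  one-∅ zero    = refl
  one-∅ (suc n) = one-∅ n

  φ-∅ : φ ∅ ∅ ≡ + 1
  φ-∅ = trans (cong₂ cnt ∅-touching (∪-identityʳ ∅)) (one-∅ n)

  leaf-forgotten : ∀ {i} → children i ≡ [] → Forgotten i ∅
  leaf-forgotten eq .∉-bag p = contradiction p ∉⊥
  leaf-forgotten eq .below p = contradiction p ∉⊥
  leaf-forgotten eq .complete b v∉i with below-split b
  ... | inj₁ v∈i         = contradiction v∈i v∉i
  ... | inj₂ (c , e , _) = case subst (c List.∈_) eq (children-∈ e) of λ ()

  leaf-table : ∀ {i V} → bag i ≡ ∅ → V (+ 0) (+ 0) ≡ + 1 → Table (bag i) ∅ (combine 2 (bag i) V)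
  leaf-table {i} {V} eq h = table-combine₂ {V = V} λ S S⊆i → case ⊆-antisym (subst (S ⊆_) eq S⊆i) ⊥⊆ of λ
    { refl → trans (cong (λ e → V (+ e) (+ 0)) (enc-∅ n)) (trans h (sym φ-∅)) }

  only-child : ∀ {i j v} → children i ≡ j ∷ [] → Below i v → v ∉ bag i → Below j v
  only-child eq b v∉i with below-split b
  ... | inj₁ v∈i         = contradiction v∈i v∉i
  ... | inj₂ (c , e , q) = case subst (c List.∈_) eq (children-∈ e) of λ { (here refl) → q }

  child-parent : ∀ {i j js} → children i ≡ j ∷ js → parent j ≡ just i
  child-parent eq = ∈-children (subst (_ List.∈_) (sym eq) (here refl))

  -- One end of the edge is forgotten, and `below-edge` puts the other end below the node as well.
  touching-below : ∀ {i F e v} → Forgotten i F → e List.∈ touching F → Incident v e → Below i v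
  touching-below {i} {F} {u , w} f p inc with ∈-filter⁻ (touches? F) {xs = edges} p
  ... | e∈ , t with proj₂ (∈-edges⁻ G e∈) | t | inc
  ...   | u~w | inj₁ u∈F | inj₁ refl = below f u∈F
  ...   | u~w | inj₁ u∈F | inj₂ refl = below-edge (below f u∈F) (∉-bag f u∈F) u~w
  ...   | u~w | inj₂ w∈F | inj₁ refl = below-edge (below f w∈F) (∉-bag f w∈F) (~-sym u~w)
  ...   | u~w | inj₂ w∈F | inj₂ refl = below f w∈F

  cnt-touching-0 : ∀ {i F v S} → Forgotten i F → ¬ Below i v → v ∈ S → cnt (touching F) S ≡ + 0
  cnt-touching-0 {v = v} {S} f ¬b v∈S =
    cnt-avoids v _ (All.tabulate λ p inc → ¬b (touching-below f p inc)) S (lookup-∈ v∈S)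

  module Introduce {i j v F} (eq : children i ≡ j ∷ []) (v∉j : v ∉ bag j) (bag-eq : bag i ≡ bag j ∪ ⁅ v ⁆)
                   (f : Forgotten j F) where

    ⊆-parent : bag j ⊆ bag i
    ⊆-parent p = subst (_ ∈_) (sym bag-eq) (x∈p∪q⁺ (inj₁ p))

    v∈i : v ∈ bag i
    v∈i = subst (_ ∈_) (sym bag-eq) (x∈p∪q⁺ (inj₂ (x∈⁅x⁆ v)))

    v-fresh : ¬ Below j v
    v-fresh b = v∉j (below-bag (child-parent eq) b v∈i)

    forgotten : Forgotten i F
    forgotten .∉-bag p p′ = ∉-bag f p (below-bag (child-parent eq) (below f p) p′)
    forgotten .below p = below-child (child-parent eq) (below f p)
    forgotten .complete b v∉i = complete f (only-child eq b v∉i) (v∉i ∘ ⊆-parent)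

    table : ∀ {t V} → Table (bag j) F t → (∀ a → V a (+ 0) ≡ t a) → Table (bag i) F (combine 2 (bag i) V)
    table {t} {V} T h = table-combine₂ {V = V} go
      where
      go : ∀ S → S ⊆ bag i → V (+ enc S) (+ 0) ≡ φ F S
      go S S⊆i with v ∈? S
      -- The code of S is not a code for the bag of the child, so the child's table is 0 there. The
      -- polynomial agrees, as no edge touching F reaches v.
      ... | yes v∈S = trans (h _) (trans (miss T _ (λ S′ S′⊆j eq′ → v∉j (S′⊆j
              (subst (v ∈_) (enc-injective S S′ (ℤ.+-injective eq′)) v∈S))))
              (sym (cnt-touching-0 f v-fresh (x∈p∪q⁺ (inj₂ v∈S)))))
      ... | no v∉S = trans (h _) (hit T S λ x∈S → case x∈p∪q⁻ (bag j) ⁅ v ⁆ (subst (_ ∈_) bag-eq (S⊆i x∈S)) of λ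
              { (inj₁ p) → p ; (inj₂ p) → contradiction (subst (_∈ S) (x∈⁅y⁆⇒x≡y v p) x∈S) v∉S })

  adj : Fin n → Fin n → ℤ
  adj v u = if does (v ~? u) then + 1 else + 0

  module Forget {i j v F} (eq : children i ≡ j ∷ []) (v∉i : v ∉ bag i) (bag-eq : bag j ≡ bag i ∪ ⁅ v ⁆)
                (f : Forgotten j F) where

    ⊆-child : bag i ⊆ bag j
    ⊆-child p = subst (_ ∈_) (sym bag-eq) (x∈p∪q⁺ (inj₁ p))

    v∈j : v ∈ bag j
    v∈j = subst (_ ∈_) (sym bag-eq) (x∈p∪q⁺ (inj₂ (x∈⁅x⁆ v)))

    v∉F : v ∉ F
    v∉F p = ∉-bag f p v∈j

    F′ : Subset n
    F′ = F ∪ ⁅ v ⁆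

    forgotten : Forgotten i F′
    forgotten .∉-bag p p′ with x∈p∪q⁻ F ⁅ v ⁆ p
    ... | inj₁ q = ∉-bag f q (⊆-child p′)
    ... | inj₂ q = v∉i (subst (_∈ bag i) (x∈⁅y⁆⇒x≡y v q) p′)
    forgotten .below p with x∈p∪q⁻ F ⁅ v ⁆ p
    ... | inj₁ q = below-child (child-parent eq) (below f q)
    ... | inj₂ q = below-child (child-parent eq) (j , ε , subst (_∈ bag j) (sym (x∈⁅y⁆⇒x≡y v q)) v∈j)
    forgotten .complete {x} b x∉i with x Fin.≟ v
    ... | yes refl = x∈p∪q⁺ (inj₂ (x∈⁅x⁆ x))
    ... | no x≢v = x∈p∪q⁺ (inj₁ (complete f (only-child eq b x∉i) λ x∈j →
            [ x∉i , x≢v ∘ x∈⁅y⁆⇒x≡y v ]′ (x∈p∪q⁻ (bag i) ⁅ v ⁆ (subst (x ∈_) bag-eq x∈j))))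

    us : List (Fin n)
    us = filter (v ~?_) (elems (bag i))

    us⁻ : ∀ {u} → u List.∈ us → u ∈ bag i × v ~ u
    us⁻ p with ∈-filter⁻ (v ~?_) {xs = elems (bag i)} p
    ... | q , v~u = ∈-elems⁻ q , v~u

    -- Once v is forgotten, all its neighbours are below i, hence in the bag or forgotten; and no
    -- vertex is adjacent to itself.
    partner : ∀ {u} → v ~ u → u ∉ F → u ∈ bag i
    partner {u} v~u u∉F with u ∈? bag i
    ... | yes u∈i = u∈i
    ... | no u∉i with x∈p∪q⁻ F ⁅ v ⁆ (complete forgotten
                       (below-edge (below forgotten (x∈p∪q⁺ (inj₂ (x∈⁅x⁆ v)))) v∉i v~u) u∉i)
    ...   | inj₁ u∈F = contradiction u∈F u∉F
    ...   | inj₂ q   = contradiction v~u (~-irrefl (sym (x∈⁅y⁆⇒x≡y v q)))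

    orient-< : ∀ {u} → v Fin.< u → orient v u ≡ (v , u)
    orient-< {u} p = cong (λ b → if b then (v , u) else (u , v)) (dec-true (v Fin.<? u) p)

    orient-> : ∀ {u} → u Fin.< v → orient v u ≡ (u , v)
    orient-> {u} p = cong (λ b → if b then (v , u) else (u , v)) (dec-false (v Fin.<? u) (ℕ.<-asym p))

    orient∈ : ∀ {u} → v ~ u → orient v u List.∈ edges
    orient∈ {u} v~u with Fin.<-cmp v u
    ... | tri< v<u _ _ = subst (List._∈ edges) (sym (orient-< v<u)) (∈-edges⁺ G v<u v~u)
    ... | tri≈ _ v≡u _ = contradiction v~u (~-irrefl v≡u)
    ... | tri> _ _ u<v = subst (List._∈ edges) (sym (orient-> u<v)) (∈-edges⁺ G u<v (~-sym v~u))

    orient-touches : ∀ u {Q : Subset n} → v ∈ Q → proj₁ (orient v u) ∈ Q ⊎ proj₂ (orient v u) ∈ Q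
    orient-touches u v∈Q with does (v Fin.<? u)
    ... | true  = inj₁ v∈Q
    ... | false = inj₂ v∈Q

    orient-avoids : ∀ u {Q : Subset n} → v ∉ Q → u ∉ Q → ¬ (proj₁ (orient v u) ∈ Q ⊎ proj₂ (orient v u) ∈ Q)
    orient-avoids u v∉Q u∉Q with does (v Fin.<? u)
    ... | true  = [ v∉Q , u∉Q ]′
    ... | false = [ u∉Q , v∉Q ]′

    -- By `partner`, an edge at v that does not touch F ends in the bag. Both lists are free of
    -- repetitions, so equality of their members gives a permutation.
    new-edges : touching F′ ↭ map (orient v) us ++ touching F
    new-edges = ∼bag⇒↭ (unique∧set⇒bag (Unique.filter⁺ (touches? F′) (unique-edges G))
      (Unique.++⁺ (Unique.map⁺ (orient-injective v) (Unique.filter⁺ (v ~?_) (Unique.filter⁺ (_∈? bag i) (Unique.allFin⁺ n))))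
        (Unique.filter⁺ (touches? F) (unique-edges G)) disjoint)
      (mk⇔ to from))
      where
      disjoint : ∀ {e} → ¬ (e List.∈ map (orient v) us × e List.∈ touching F)
      disjoint (p , q) with ∈-map⁻ (orient v) p
      ... | u , u∈us , refl = orient-avoids u v∉F (λ u∈F → ∉-bag f u∈F (⊆-child (proj₁ (us⁻ u∈us))))
                                (proj₂ (∈-filter⁻ (touches? F) {xs = edges} q))
      from : ∀ {e} → e List.∈ map (orient v) us ++ touching F → e List.∈ touching F′
      from p with ∈-++⁻ (map (orient v) us) p
      ... | inj₂ q with ∈-filter⁻ (touches? F) {xs = edges} q
      ...   | e∈ , t = ∈-filter⁺ (touches? F′) e∈ ([ (λ r → inj₁ (x∈p∪q⁺ (inj₁ r))) , (λ r → inj₂ (x∈p∪q⁺ (inj₁ r))) ]′ t)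
      from p | inj₁ q with ∈-map⁻ (orient v) q
      ...   | u , u∈us , refl = ∈-filter⁺ (touches? F′) (orient∈ (proj₂ (us⁻ u∈us))) (orient-touches u (x∈p∪q⁺ (inj₂ (x∈⁅x⁆ v))))
      star : ∀ {u e} → v ~ u → u ∉ F → orient v u ≡ e → e List.∈ map (orient v) us ++ touching F
      star v~u u∉F refl = ∈-++⁺ˡ (∈-map⁺ (orient v) (∈-filter⁺ (v ~?_) (∈-elems⁺ (partner v~u u∉F)) v~u))
      to : ∀ {e} → e List.∈ touching F′ → e List.∈ map (orient v) us ++ touching F
      to {a , b} p with ∈-filter⁻ (touches? F′) {xs = edges} p
      ... | e∈ , t with touches? F (a , b)
      ...   | yes t′ = ∈-++⁺ʳ (map (orient v) us) (∈-filter⁺ (touches? F) e∈ t′)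
      ...   | no ¬t with ∈-edges⁻ G e∈ | t
      ...     | a<b , a~b | inj₁ a∈F′ with x∈p∪q⁻ F ⁅ v ⁆ a∈F′
      ...       | inj₁ a∈F = contradiction (inj₁ a∈F) ¬t
      ...       | inj₂ q with x∈⁅y⁆⇒x≡y v q
      ...         | refl = star a~b (¬t ∘ inj₂) (orient-< a<b)
      to {a , b} p | e∈ , t | no ¬t | a<b , a~b | inj₂ b∈F′ with x∈p∪q⁻ F ⁅ v ⁆ b∈F′
      ...       | inj₁ b∈F = contradiction (inj₂ b∈F) ¬t
      ...       | inj₂ q with x∈⁅y⁆⇒x≡y v q
      ...         | refl = star (~-sym a~b) (¬t ∘ inj₁) (orient-> a<b)

    module _ {S} (S⊆i : S ⊆ bag i) where

      v∉S : v ∉ S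
      v∉S p = v∉i (S⊆i p)

      F′∪S : F′ ∪ S ≡ F ∪ (S ∪ ⁅ v ⁆)
      F′∪S = trans (∪-assoc F ⁅ v ⁆ S) (cong (F ∪_) (∪-comm ⁅ v ⁆ S))

      shift-v : ∀ (g : Subset n → ℤ) → shift v g (F′ ∪ S) ≡ g (F ∪ S)
      shift-v g = trans (cong (λ b → if b then g ((F′ ∪ S) [ v ]≔ false) else + 0)
                          (lookup-∈ (x∈p∪q⁺ (inj₁ (x∈p∪q⁺ {p = F} (inj₂ (x∈⁅x⁆ v)))))))
        (cong g (trans (cong (_[ v ]≔ false) F′∪S) (trans (remove-∪ v F (S ∪ ⁅ v ⁆) v∉F) (cong (F ∪_) (remove-insert v S v∉S)))))

      partner-term : ∀ {t} → Table (bag j) F t → ∀ u → u ∈ bag i →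
                     shift v (shift u (cnt (touching F))) (F′ ∪ S) ≡ t (+ enc S ℤ.- + (3 ^ toℕ u))
      partner-term {t} T u u∈i = trans (shift-v (shift u (cnt (touching F))))
        (trans (cong (λ b → if b then cnt (touching F) ((F ∪ S) [ u ]≔ false) else + 0) (lookup-∪ u F S u∉F)) go)
        where
        u∉F : u ∉ F
        u∉F p = ∉-bag f p (⊆-child u∈i)
        minus : ∀ x p → x ≡ x ℤ.+ p ℤ.- p
        minus = ℤ-solve
        minus′ : ∀ x p → x ℤ.- p ℤ.+ p ≡ x
        minus′ = ℤ-solve
        go : (if lookup S u then cnt (touching F) ((F ∪ S) [ u ]≔ false) else + 0) ≡ t (+ enc S ℤ.- + (3 ^ toℕ u))
        go with lookup S u in h
        ... | true = trans (cong (cnt (touching F)) (remove-∪ u F S u∉F))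
          (trans (sym (hit T (S [ u ]≔ false) (⊆-child ∘ S⊆i ∘ remove-⊆ u S)))
            (cong t (trans (minus (+ enc (S [ u ]≔ false)) (+ (3 ^ toℕ u)))
              (cong (ℤ._- + (3 ^ toℕ u)) (cong +_ (sym (enc-remove u S h)))))))
        -- For u outside S the subtraction of 3^u borrows, so the address is no code and the table
        -- returns the required 0.
        ... | false = sym (miss T _ λ S′ _ eq′ → case trans (sym h) (proj₁ (enc-borrow u S S′
              (ℤ.+-injective (trans (sym (minus′ (+ enc S) (+ (3 ^ toℕ u)))) (cong (ℤ._+ + (3 ^ toℕ u)) eq′))))) of λ ())

      -- The forgotten v is matched either by an edge touching F, which the entry at S ∪ {v} counts,
      -- or to a vertex u of the bag, which leaves S without u to the child.
      value : ∀ {t} → Table (bag j) F t →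
              t (+ enc S ℤ.+ + (3 ^ toℕ v)) ℤ.+ lsum (λ u → adj v u ℤ.* t (+ enc S ℤ.- + (3 ^ toℕ u))) (elems (bag i)) ≡ φ F′ S
      value {t} T = sym (begin
        cnt (touching F′) (F′ ∪ S)
          ≡⟨ cnt-↭ new-edges (F′ ∪ S) ⟩
        cnt (map (orient v) us ++ touching F) (F′ ∪ S)
          ≡⟨ cnt-orient v us (touching F) (F′ ∪ S) ⟩
        cnt (map (v ,_) us ++ touching F) (F′ ∪ S)
          ≡⟨ cnt-star v us (touching F) (F′ ∪ S) ⟩
        cnt (touching F) (F′ ∪ S) ℤ.+ lsum (λ u → shift v (shift u (cnt (touching F))) (F′ ∪ S)) us
          ≡⟨ cong₂ ℤ._+_ first second ⟩
        t (+ enc S ℤ.+ + (3 ^ toℕ v)) ℤ.+ lsum (λ u → adj v u ℤ.* t (+ enc S ℤ.- + (3 ^ toℕ u))) (elems (bag i)) ∎)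
        where
        open ≡-Reasoning
        first : cnt (touching F) (F′ ∪ S) ≡ t (+ enc S ℤ.+ + (3 ^ toℕ v))
        first = trans (cong (cnt (touching F)) F′∪S)
          (trans (sym (hit T (S ∪ ⁅ v ⁆) (∪-⊆ (⊆-child ∘ S⊆i) (λ p → subst (_∈ bag j) (sym (x∈⁅y⁆⇒x≡y v p)) v∈j))))
            (cong (t ∘ +_) (enc-insert v S v∉S)))
        second : lsum (λ u → shift v (shift u (cnt (touching F))) (F′ ∪ S)) us
                 ≡ lsum (λ u → adj v u ℤ.* t (+ enc S ℤ.- + (3 ^ toℕ u))) (elems (bag i))
        second = trans (lsum-cong us (λ {u} u∈us → partner-term T u (proj₁ (us⁻ u∈us))))
          (lsum-filter (v ~?_) (λ u → t (+ enc S ℤ.- + (3 ^ toℕ u))) (elems (bag i)))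

  module Join {i j k F₁ F₂} (eq : children i ≡ j ∷ k ∷ []) (bag-j : bag i ≡ bag j) (bag-k : bag i ≡ bag k)
              (f₁ : Forgotten j F₁) (f₂ : Forgotten k F₂) where

    ej : parent j ≡ just i
    ej = child-parent eq

    ek : parent k ≡ just i
    ek = ∈-children (subst (k List.∈_) (sym eq) (there (here refl)))

    j≢k : j ≢ k
    j≢k refl with subst Unique eq (unique-children i)
    ... | (j≢j ∷ _) ∷ _ = j≢j refl

    -- A vertex below both children lies in the common bag, whereas a forgotten vertex does not.
    apart₁ : ∀ {v} → v ∈ F₁ → ¬ Below k v
    apart₁ p b = ∉-bag f₁ p (subst (_ ∈_) bag-j (siblings ej ek j≢k (below f₁ p) b))

    apart₂ : ∀ {v} → v ∈ F₂ → ¬ Below j v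
    apart₂ p b = ∉-bag f₂ p (subst (_ ∈_) bag-k (siblings ej ek j≢k b (below f₂ p)))

    forgotten : Forgotten i (F₁ ∪ F₂)
    forgotten .∉-bag p p′ with x∈p∪q⁻ F₁ F₂ p
    ... | inj₁ q = ∉-bag f₁ q (subst (_ ∈_) bag-j p′)
    ... | inj₂ q = ∉-bag f₂ q (subst (_ ∈_) bag-k p′)
    forgotten .below p with x∈p∪q⁻ F₁ F₂ p
    ... | inj₁ q = below-child ej (below f₁ q)
    ... | inj₂ q = below-child ek (below f₂ q)
    forgotten .complete b v∉i with below-split b
    ... | inj₁ v∈i = contradiction v∈i v∉i
    ... | inj₂ (c , e , q) with subst (c List.∈_) eq (children-∈ e)
    ...   | here refl         = x∈p∪q⁺ (inj₁ (complete f₁ q (v∉i ∘ subst (_ ∈_) (sym bag-j))))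
    ...   | there (here refl) = x∈p∪q⁺ (inj₂ (complete f₂ q (v∉i ∘ subst (_ ∈_) (sym bag-k))))

    -- No edge is listed twice: both ends of an edge touching F₁ are below j, and no vertex of F₂
    -- is.
    split-edges : touching (F₁ ∪ F₂) ↭ touching F₁ ++ touching F₂
    split-edges = ∼bag⇒↭ (unique∧set⇒bag (Unique.filter⁺ (touches? (F₁ ∪ F₂)) (unique-edges G))
      (Unique.++⁺ (Unique.filter⁺ (touches? F₁) (unique-edges G)) (Unique.filter⁺ (touches? F₂) (unique-edges G)) disjoint)
      (mk⇔ to from))
      where
      disjoint : ∀ {e} → ¬ (e List.∈ touching F₁ × e List.∈ touching F₂)
      disjoint (p , q) with proj₂ (∈-filter⁻ (touches? F₂) {xs = edges} q)
      ... | inj₁ r = apart₂ r (touching-below f₁ p (inj₁ refl))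
      ... | inj₂ r = apart₂ r (touching-below f₁ p (inj₂ refl))
      to : ∀ {e} → e List.∈ touching (F₁ ∪ F₂) → e List.∈ touching F₁ ++ touching F₂
      to p with ∈-filter⁻ (touches? (F₁ ∪ F₂)) {xs = edges} p
      ... | e∈ , inj₁ r = [ (λ q → ∈-++⁺ˡ (∈-filter⁺ (touches? F₁) e∈ (inj₁ q)))
                          , (λ q → ∈-++⁺ʳ (touching F₁) (∈-filter⁺ (touches? F₂) e∈ (inj₁ q))) ]′ (x∈p∪q⁻ F₁ F₂ r)
      ... | e∈ , inj₂ r = [ (λ q → ∈-++⁺ˡ (∈-filter⁺ (touches? F₁) e∈ (inj₂ q)))
                          , (λ q → ∈-++⁺ʳ (touching F₁) (∈-filter⁺ (touches? F₂) e∈ (inj₂ q))) ]′ (x∈p∪q⁻ F₁ F₂ r)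
      from : ∀ {e} → e List.∈ touching F₁ ++ touching F₂ → e List.∈ touching (F₁ ∪ F₂)
      from p with ∈-++⁻ (touching F₁) p
      ... | inj₁ q with ∈-filter⁻ (touches? F₁) {xs = edges} q
      ...   | e∈ , t = ∈-filter⁺ (touches? (F₁ ∪ F₂)) e∈ ([ (λ r → inj₁ (x∈p∪q⁺ (inj₁ r))) , (λ r → inj₂ (x∈p∪q⁺ (inj₁ r))) ]′ t)
      from p | inj₂ q with ∈-filter⁻ (touches? F₂) {xs = edges} q
      ...   | e∈ , t = ∈-filter⁺ (touches? (F₁ ∪ F₂)) e∈ ([ (λ r → inj₁ (x∈p∪q⁺ (inj₂ r))) , (λ r → inj₂ (x∈p∪q⁺ (inj₂ r))) ]′ t)

    table : ∀ {s t V} → Table (bag j) F₁ s → Table (bag k) F₂ t → (∀ a b → V a b ≡ s a ℤ.* t b) →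
            Table (bag i) (F₁ ∪ F₂) (combine 3 (bag i) V)
    table {s} {t} {V} T₁ T₂ h .miss = combine-miss 3 (bag i) V
    table {s} {t} {V} T₁ T₂ h .hit S S⊆i = begin
      combine 3 (bag i) V (+ enc S)
        ≡⟨ pairSum-conv (bag i) S S⊆i (λ A B → V (+ enc A) (+ enc B)) ⟩
      conv (λ A B → V (+ enc A) (+ enc B)) S
        ≡⟨ conv-cong S (λ A B A⊆S B⊆S → trans (h _ _) (cong₂ ℤ._*_
             (hit T₁ A (subst (_ ∈_) bag-j ∘ S⊆i ∘ A⊆S)) (hit T₂ B (subst (_ ∈_) bag-k ∘ S⊆i ∘ B⊆S)))) ⟩
      conv (λ A B → φ F₁ A ℤ.* φ F₂ B) S
        ≡⟨ conv-split F₁ F₂ S (λ A B → cnt (touching F₁) A ℤ.* cnt (touching F₂) B)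
             (λ p q → apart₁ p (below f₂ q))
             (λ p q → ∉-bag f₁ p (subst (_ ∈_) bag-j (S⊆i q)))
             (λ p q → ∉-bag f₂ p (subst (_ ∈_) bag-k (S⊆i q)))
             (λ {v} {A} {B} p q → trans (cong (ℤ._* cnt (touching F₂) B) (cnt-touching-0 f₁ (apart₂ p) q)) (ℤ.*-zeroˡ (cnt (touching F₂) B)))
             (λ {v} {A} {B} p q → trans (cong (cnt (touching F₁) A ℤ.*_) (cnt-touching-0 f₂ (apart₁ p) q)) (ℤ.*-zeroʳ (cnt (touching F₁) A))) ⟨
      conv (λ A B → cnt (touching F₁) A ℤ.* cnt (touching F₂) B) (F₁ ∪ (F₂ ∪ S))
        ≡⟨ cnt-++ (touching F₁) (touching F₂) _ ⟨
      cnt (touching F₁ ++ touching F₂) (F₁ ∪ (F₂ ∪ S))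
        ≡⟨ cnt-↭ split-edges _ ⟨
      cnt (touching (F₁ ∪ F₂)) (F₁ ∪ (F₂ ∪ S))
        ≡⟨ cong (cnt (touching (F₁ ∪ F₂))) (∪-assoc F₁ F₂ S) ⟨
      φ (F₁ ∪ F₂) S ∎
      where open ≡-Reasoning

  root-value : ∀ {F t} → bag root ≡ ∅ → Forgotten root F → Table (bag root) F t → t (+ 0) ≡ + #perfectMatchings G
  root-value {F} {t} empty f T = begin
    t (+ 0)                ≡⟨ cong (t ∘ +_) (enc-∅ n) ⟨
    t (+ enc {n} ∅)        ≡⟨ hit T ∅ ⊥⊆ ⟩
    φ F ∅                  ≡⟨ cong (λ F → φ F ∅) F≡⊤ ⟩
    φ ⊤ ∅                  ≡⟨ cong₂ cnt (List.filter-all (touches? ⊤) (All.universal (λ _ → inj₁ ∈⊤) edges)) (∪-identityʳ ⊤) ⟩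
    cnt edges ⊤            ≡⟨ perfectMatchings-cnt G ⟨
    + #perfectMatchings G  ∎
    where
    open ≡-Reasoning
    F≡⊤ : F ≡ ⊤
    -- Every node is below the root, and the bag of the root is empty, so every vertex has been
    -- forgotten.
    F≡⊤ = ⊆-antisym ⊆⊤ λ {v} _ → complete f (proj₁ (vertex-covered v) , reach-root _ , proj₂ (vertex-covered v))
      (∉⊥ ∘ subst (v ∈_) empty)

-- The program

-- Arrays 6 and 7 hold the powers 3^v and the adjacency matrix, array 8 the
-- nodes in breadth-first order, arrays 9 and 10 the codes of the pairs (A , B)
-- for the current node, array 12 the codes of the bags.  Array 11 holds the
-- tables: the entry of node i at z is at address z (m + 1) + i.  Node m is a
-- fictitious child whose table is the constant polynomial 1.

setup : Program
setup =
  3 ≔ lit (+ 0) ⨾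
  4 ≔ lit (+ 1) ⨾
  while (reg 3 ≺ reg 0) (
    store 6 (reg 3) (reg 4) ⨾
    5 ≔ load 0 (reg 3) ⨾
    6 ≔ load 0 (reg 3 ⊕ lit (+ 1)) ⨾
    scan (store 7 ((reg 4 ⊗ reg 0) ⊕ load 1 (reg 5)) (lit (+ 1))) ⨾
    4 ≔ (lit (+ 3) ⊗ reg 4) ⨾
    inc 3)

traverse : Program
traverse =
  store 8 (lit (+ 0)) (reg 2) ⨾
  7 ≔ lit (+ 0) ⨾
  8 ≔ lit (+ 1) ⨾
  while (reg 7 ≺ reg 8) (
    10 ≔ load 8 (reg 7) ⨾
    5 ≔ load 2 (reg 10) ⨾
    6 ≔ load 2 (reg 10 ⊕ lit (+ 1)) ⨾
    scan (store 8 (reg 8) (load 3 (reg 5)) ⨾ inc 8) ⨾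
    inc 7)

-- Input lists

Family : ∀ {k l} → (ℤ → ℤ) → (ℤ → ℤ) → (Fin k → List (Fin l)) → Set
Family f g L = ∀ i → ∃[ s ]
  (f (+ toℕ i) ≡ + s × f (+ (toℕ i + 1)) ≡ + (s + length (L i)) × Segment g s (L i))

nth-tabulate : ∀ {k} (h : Fin k → ℕ) i → nth (tabulate h) (toℕ i) ≡ + h i
nth-tabulate h zero    = refl
nth-tabulate h (suc i) = nth-tabulate (h ∘ suc) i

nth-++ : ∀ xs ys q → nth (xs ++ ys) (length xs + q) ≡ nth ys q
nth-++ []       ys q = refl
nth-++ (x ∷ xs) ys q = nth-++ xs ys q

segment-++ʳ : ∀ {l} xs ys s (zs : List (Fin l)) → Segment (cells ys) s zs → Segment (cells (xs ++ ys)) (length xs + s) zs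
segment-++ʳ xs ys s []       _        = tt
segment-++ʳ xs ys s (z ∷ zs) (p , ps) = trans (nth-++ xs ys s) p ,
  subst (λ t → Segment (cells (xs ++ ys)) t zs) (sym (ℕ.+-assoc (length xs) s 1)) (segment-++ʳ xs ys (s + 1) zs ps)

segment-self : ∀ {l} (zs : List (Fin l)) ys → Segment (cells (map toℕ zs ++ ys)) 0 zs
segment-self []       ys = tt
segment-self (z ∷ zs) ys = refl , segment-++ʳ (toℕ z ∷ []) (map toℕ zs ++ ys) 0 zs (segment-self zs ys)

module _ {l : ℕ} where

  offset : ∀ {k} → (Fin k → List (Fin l)) → ℕ → ℕ
  offset L t = length (concat (take t (tabulate (λ i → map toℕ (L i)))))

  offset-suc : ∀ {k} (L : Fin k → List (Fin l)) i → offset L (suc (toℕ i)) ≡ offset L (toℕ i) + length (L i)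
  offset-suc L zero    = trans (List.length-++ (map toℕ (L zero))) (trans (ℕ.+-identityʳ _) (List.length-map toℕ (L zero)))
  offset-suc L (suc i) = begin
    length (map toℕ (L zero) ++ rest (suc (toℕ i)))
      ≡⟨ List.length-++ (map toℕ (L zero)) ⟩
    length (map toℕ (L zero)) + length (rest (suc (toℕ i)))
      ≡⟨ cong (λ x → length (map toℕ (L zero)) + x) (offset-suc (L ∘ suc) i) ⟩
    length (map toℕ (L zero)) + (length (rest (toℕ i)) + length (L (suc i)))
      ≡⟨ ℕ.+-assoc (length (map toℕ (L zero))) _ _ ⟨
    length (map toℕ (L zero)) + length (rest (toℕ i)) + length (L (suc i))
      ≡⟨ cong (_+ length (L (suc i))) (List.length-++ (map toℕ (L zero))) ⟨
    length (map toℕ (L zero) ++ rest (toℕ i)) + length (L (suc i)) ∎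
    where
    open ≡-Reasoning
    rest : ℕ → List ℕ
    rest t = concat (take t (tabulate (λ i → map toℕ (L (suc i)))))

  flat-segment : ∀ {k} (L : Fin k → List (Fin l)) i → Segment (cells (flat (λ i → map toℕ (L i)))) (offset L (toℕ i)) (L i)
  flat-segment L zero    = segment-self (L zero) _
  flat-segment L (suc i) = subst (λ t → Segment (cells (flat (λ i → map toℕ (L i)))) t (L (suc i)))
    (sym (List.length-++ (map toℕ (L zero))))
    (segment-++ʳ (map toℕ (L zero)) (flat (λ i → map toℕ (L (suc i)))) _ (L (suc i)) (flat-segment (L ∘ suc) i))

  input-family : ∀ {k} (L : Fin k → List (Fin l)) →
                 Family (cells (starts (λ i → map toℕ (L i)))) (cells (flat (λ i → map toℕ (L i)))) L
  input-family {k} L i = offset L (toℕ i)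
    , trans (cong (nth (starts L′)) (sym (Fin.toℕ-inject₁ i))) (trans (nth-tabulate (offset L ∘ toℕ) (inject₁ i)) (cong (+_ ∘ offset L) (Fin.toℕ-inject₁ i)))
    , trans (cong (nth (starts L′)) (ℕ.+-comm (toℕ i) 1)) (trans (nth-tabulate (offset L ∘ toℕ) (suc i)) (cong +_ (offset-suc L i)))
    , flat-segment L i
    where
    L′ : Fin k → List ℕ
    L′ i = map toℕ (L i)

-- Reading the graph: powers of three and the adjacency matrix

CountsFrom : ∀ {n} → ℕ → List (Fin n) → Set
CountsFrom {n} k []       = k ≡ n
CountsFrom     k (v ∷ vs) = toℕ v ≡ k × CountsFrom (k + 1) vs

counts-tabulate : ∀ {n} l k (f : Fin l → Fin n) → (∀ i → toℕ (f i) ≡ k + toℕ i) → k + l ≡ n → CountsFrom k (tabulate f)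
counts-tabulate zero    k f h e = trans (sym (ℕ.+-identityʳ k)) e
counts-tabulate (suc l) k f h e = trans (h zero) (ℕ.+-identityʳ k) ,
  counts-tabulate l (k + 1) (f ∘ suc) (λ i → trans (h (suc i)) (sym (ℕ.+-assoc k 1 (toℕ i)))) (trans (ℕ.+-assoc k 1 l) e)

3^-injective : ∀ {a b} → 3 ^ a ≡ 3 ^ b → a ≡ b
3^-injective {a} {b} eq with ℕ.<-cmp a b
... | tri< a<b _ _ = contradiction eq (ℕ.<⇒≢ (ℕ.^-monoʳ-< 3 (s≤s (s≤s z≤n)) a<b))
... | tri≈ _ p _   = p
... | tri> _ _ b<a = contradiction (sym eq) (ℕ.<⇒≢ (ℕ.^-monoʳ-< 3 (s≤s (s≤s z≤n)) b<a))

budget : {A : Set} → ℕ → List A → ℕ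
budget c []       = 5
budget c (_ ∷ xs) = c + budget c xs

module _ {n m : ℕ} {G : Graph n} (D : TreeDecomposition G m) where
  open Graph G
  open TreeDecomposition D

  bagElems : Fin m → List (Fin n)
  bagElems i = elems (bag i)

  -- The parameters are the contents of memory and not the state, so the type is definitionally
  -- unchanged by assignments to other registers and arrays; no frame lemmas are needed.
  record Given (r0 r1 r2 : ℤ) (a2 a3 a4 a5 a11 a12 : ℤ → ℤ) : Set where
    field
      order-n   : r0 ≡ + n
      order-m   : r1 ≡ + m
      root-node : r2 ≡ + toℕ root
      child-lists : Family a2 a3 children
      bag-lists   : Family a4 a5 bagElems
      no-tables   : ∀ q → a11 q ≡ + 0
      no-codes    : ∀ q → a12 q ≡ + 0

  GivenIn : State → Set
  GivenIn σ = Given (regs σ 0) (regs σ 1) (regs σ 2) (arrs σ 2) (arrs σ 3) (arrs σ 4) (arrs σ 5) (arrs σ 11) (arrs σ 12)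

  given-input : GivenIn (input G D)
  given-input = record
    { order-n = refl ; order-m = refl ; root-node = refl
    ; child-lists = input-family children ; bag-lists = input-family bagElems
    ; no-tables = λ _ → refl ; no-codes = λ _ → refl }

  -- The row is 3^v and not v, because 3^v is what a forget node obtains as the difference of two
  -- bag codes.
  key : Fin n → Fin n → ℤ
  key v u = cell n (+ (3 ^ toℕ v)) (toℕ u)

  key-injective : ∀ {v u v′ u′} → key v u ≡ key v′ u′ → v ≡ v′ × u ≡ u′
  key-injective {v} {u} {v′} {u′} eq with cell-injective n (Fin.toℕ<n u) (Fin.toℕ<n u′) eq
  ... | p , q = Fin.toℕ-injective (3^-injective (ℤ.+-injective p)) , Fin.toℕ-injective q

  Powers : (ℤ → ℤ) → Set
  Powers a = ∀ (v : Fin n) → a (+ toℕ v) ≡ + (3 ^ toℕ v)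

  Adjacency : (ℤ → ℤ) → Set
  Adjacency a = ∀ v u → a (key v u) ≡ adj D v u

  -- The zeros of the matrix are never written but present from the start. `sound` records this, and
  -- the cost of the matrix is governed by the degrees instead of n².
  record Partial (a6 a7 : ℤ → ℤ) (vs : List (Fin n)) (Todo : Fin n → Fin n → Set) : Set where
    field
      powers : ∀ (v : Fin n) → a6 (+ toℕ v) ≡ + (3 ^ toℕ v) ⊎ v List.∈ vs
      sound  : ∀ q → a7 q ≡ + 0 ⊎ ∃[ v ] ∃[ u ] (v ~ u × q ≡ key v u)
      full   : ∀ v u → v ~ u → a7 (key v u) ≡ + 1 ⊎ Todo v u
  open Partial

  partial-powers : ∀ {a6 a7 E} → Partial a6 a7 [] E → Powers a6
  partial-powers P v with powers P v
  ... | inj₁ p = p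

  partial-adjacency : ∀ {a6 a7 E} → (∀ {v u} → ¬ E v u) → Partial a6 a7 [] E → Adjacency a7
  partial-adjacency {a7 = a7} ¬E P v u with v ~? u
  ... | yes v~u with full P v u v~u
  ...   | inj₁ p = p
  ...   | inj₂ e = contradiction e ¬E
  partial-adjacency {a7 = a7} ¬E P v u | no v≁u with sound P (key v u)
  ...   | inj₁ p = p
  ...   | inj₂ (v′ , u′ , v′~u′ , eq) with key-injective {v} {u} {v′} {u′} eq
  ...     | refl , refl = contradiction v′~u′ v≁u

  setupCost : List (Fin n) → ℕ
  setupCost []       = 5
  setupCost (v ∷ vs) = 24 + budget 17 (neighbours v) + setupCost vs

  TodoEdge : List (Fin n) → Fin n → List (Fin n) → Fin n → Fin n → Set
  TodoEdge vs v us v′ u = v′ List.∈ vs ⊎ (v′ ≡ v × u List.∈ us)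

  setup-run : ∀ σ → GivenIn σ → Family (arrs σ 0) (arrs σ 1) neighbours → (∀ q → arrs σ 7 q ≡ + 0) →
              Run setup σ (λ τ → GivenIn τ × Powers (arrs τ 6) × Adjacency (arrs τ 7)) (4 + setupCost (allFin n))
  setup-run σ₀ given₀ adjs₀ blank = assign {σ₀} refl (assign {setReg 3 (+ 0) σ₀} refl (weaken (λ {τ} → finish {τ}) ℕ.≤-refl
    (while-run I setupCost (I []) step (allFin n) (setReg 4 (+ 1) (setReg 3 (+ 0) σ₀))
      ((given₀ , adjs₀) , 0 , refl , refl , counts-tabulate n 0 id (λ _ → refl) refl , start))))
    where
    Known : State → Set
    Known σ = GivenIn σ × Family (arrs σ 0) (arrs σ 1) neighbours

    I : List (Fin n) → State → Set
    I vs σ = Known σ × ∃[ k ] (regs σ 3 ≡ + k × regs σ 4 ≡ + (3 ^ k) × CountsFrom k vs ×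
             Partial (arrs σ 6) (arrs σ 7) vs (λ v _ → v List.∈ vs))

    start : Partial (arrs σ₀ 6) (arrs σ₀ 7) (allFin n) (λ v _ → v List.∈ allFin n)
    start = record { powers = λ v → inj₂ (∈-allFin v) ; sound = λ q → inj₁ (blank q) ; full = λ v u _ → inj₂ (∈-allFin v) }

    finish : ∀ {τ} → I [] τ → GivenIn τ × Powers (arrs τ 6) × Adjacency (arrs τ 7)
    finish ((g , _) , _ , _ , _ , _ , P) = g , partial-powers P , partial-adjacency (λ ()) P

    J : ∀ (v : Fin n) (vs : List (Fin n)) → Unit → List (Fin n) → State → Set
    J v vs _ us σ = Known σ × regs σ 3 ≡ + toℕ v × regs σ 4 ≡ + (3 ^ toℕ v) ×
                    Partial (arrs σ 6) (arrs σ 7) vs (TodoEdge vs v us) × (∀ {u} → u List.∈ us → v ~ u)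

    step : ∀ vs σ → I vs σ → _
    step [] σ inv@((g , _) , k , h3 , _ , refl , _) =
      inj₁ (≺-false {σ} {reg 3} {reg 0} h3 (Given.order-n g) ℕ.≤-refl , inv , ℕ.≤-refl)
    step (v ∷ vs) σ ((g , fam) , k , h3 , h4 , (refl , counts) , P) with fam v
    ... | s , hs , he , seg = inj₂
      ( ≺-true {σ} {reg 3} {reg 0} h3 (Given.order-n g) (Fin.toℕ<n v) , vs , _
      , store-then {σ} h3 h4 (assign {σ₁} (trans (cong (arrs σ 0) h3) hs)
          (assign {σ₂} (trans (cong (λ z → arrs σ 0 (z ℤ.+ + 1)) h3) he)
            (scan-run 1 (J v vs) (λ _ us → budget 17 us) (λ _ j → j) (λ _ → ℕ.≤-refl) body tt (neighbours v)
               (setReg 6 (+ (s + length (neighbours v))) σ₂) s refl refl seg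
               ((g , fam) , h3 , h4 , P₁ , λ {_} u∈ → proj₂ (∈-filter⁻ (v ~?_) {xs = allFin n} u∈))
             ⨾ᴿ λ { {τ} (_ , known , k3 , k4 , Q , _) →
                  assign {τ} (trans (cong (+ 3 ℤ.*_) k4) (sym (ℤ.pos-* 3 (3 ^ toℕ v))))
                    (assign-run {setReg 4 (+ (3 * 3 ^ toℕ v)) τ} (cong (ℤ._+ + 1) k3)
                      (known , toℕ v + 1 , refl , cong (λ e → + (3 ^ e)) (ℕ.+-comm 1 (toℕ v)) , counts ,
                       record { powers = powers Q ; sound = sound Q ; full = λ x u x~u → [ inj₁ , (λ { (inj₁ x∈) → inj₂ x∈ }) ]′ (full Q x u x~u) })) })))
      , ℕ.≤-reflexive (arith (budget 17 (neighbours v)) (setupCost vs)) )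
      where
      σ₁ σ₂ : State
      σ₁ = setCell 6 (+ toℕ v) (+ (3 ^ toℕ v)) σ
      σ₂ = setReg 5 (+ s) σ₁
      arith : ∀ b c → 5 + (3 + (3 + (5 + (b + 8)))) + c ≡ 24 + b + c
      arith = ℕ-solve
      P₁ : Partial (arrs σ₁ 6) (arrs σ₁ 7) vs (TodoEdge vs v (neighbours v))
      P₁ .powers x with x Fin.≟ v
      ... | yes refl = inj₁ (setCell-eq 6 (+ toℕ v) _ σ refl)
      ... | no x≢v with powers P x
      ...   | inj₁ p = inj₁ (trans (setCell-neq 6 (+ toℕ v) _ σ (x≢v ∘ Fin.toℕ-injective ∘ ℤ.+-injective)) p)
      ...   | inj₂ (here x≡v) = contradiction x≡v x≢v
      ...   | inj₂ (there x∈) = inj₂ x∈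
      P₁ .sound = sound P
      P₁ .full x u x~u with full P x u x~u
      ... | inj₁ p = inj₁ p
      ... | inj₂ (here refl) = inj₂ (inj₂ (refl , ∈-filter⁺ (v ~?_) (∈-allFin u) x~u))
      ... | inj₂ (there x∈)  = inj₂ (inj₁ x∈)
      body : ∀ _ u us σ s → regs σ 5 ≡ + s → arrs σ 1 (+ s) ≡ + toℕ u → J v vs tt (u ∷ us) σ → _
      body _ u us σ s h5 hu ((g , fam) , k3 , k4 , Q , nb) = tt , _ ,
        store-run {σ} {7} {z = + 1} (cong₂ ℤ._+_ (cong₂ ℤ._*_ k4 (Given.order-n g)) (trans (cong (arrs σ 1) h5) hu)) refl
          (((g , fam) , k3 , k4 , Q′ , (λ {_} u∈ → nb (there u∈))) , refl , refl , λ _ → refl) , ℕ.≤-refl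
        where
        Q′ : Partial (arrs σ 6) (arrs (setCell 7 (key v u) (+ 1) σ) 7) vs (TodoEdge vs v us)
        Q′ .powers = powers Q
        Q′ .sound q with q ℤ.≟ key v u
        ... | yes refl = inj₂ (v , u , nb (here refl) , refl)
        ... | no q≢ with sound Q q
        ...   | inj₁ p = inj₁ p
        ...   | inj₂ p = inj₂ p
        Q′ .full x y x~y with key x y ℤ.≟ key v u
        ... | yes _ = inj₁ refl
        ... | no neq with full Q x y x~y
        ...   | inj₁ p = inj₁ p
        ...   | inj₂ (inj₁ p) = inj₂ (inj₁ p)
        ...   | inj₂ (inj₂ (refl , here refl)) = contradiction refl neq
        ...   | inj₂ (inj₂ (refl , there y∈)) = inj₂ (inj₂ (refl , y∈))

-- Breadth-first traversal

budget-length : {A : Set} (c : ℕ) (xs : List A) → budget c xs ≡ length xs * c + 5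
budget-length c []       = refl
budget-length c (_ ∷ xs) = trans (cong (λ b → c + b) (budget-length c xs)) (sym (ℕ.+-assoc c (length xs * c) 5))

module _ {A : Set} where

  ∈-ʳ++⁺ʳ : ∀ (xs : List A) {ys c} → c List.∈ ys → c List.∈ xs ʳ++ ys
  ∈-ʳ++⁺ʳ []       p = p
  ∈-ʳ++⁺ʳ (x ∷ xs) p = ∈-ʳ++⁺ʳ xs (there p)

  ∈-ʳ++⁺ˡ : ∀ {xs ys : List A} {c} → c List.∈ xs → c List.∈ xs ʳ++ ys
  ∈-ʳ++⁺ˡ {x ∷ xs} (here refl) = ∈-ʳ++⁺ʳ xs (here refl)
  ∈-ʳ++⁺ˡ {x ∷ xs} (there p)   = ∈-ʳ++⁺ˡ {xs} p

  ∈-ʳ++⁻ : ∀ (xs : List A) {ys c} → c List.∈ xs ʳ++ ys → c List.∈ xs ⊎ c List.∈ ys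
  ∈-ʳ++⁻ []       p = inj₂ p
  ∈-ʳ++⁻ (x ∷ xs) p with ∈-ʳ++⁻ xs p
  ... | inj₁ q           = inj₁ (there q)
  ... | inj₂ (here refl) = inj₁ (here refl)
  ... | inj₂ (there q)   = inj₂ q

  unique-ʳ++ : ∀ {xs ys : List A} → Unique xs → Unique ys → (∀ {c} → c List.∈ xs → ¬ c List.∈ ys) → Unique (xs ʳ++ ys)
  unique-ʳ++ {[]}     _        v d = v
  unique-ʳ++ {x ∷ xs} (p ∷ u) v d = unique-ʳ++ u
    (All.tabulate (λ q x≡y → d (here refl) (subst (List._∈ _) (sym x≡y) q)) ∷ v)
    λ { q (here refl) → Unique.Unique[x∷xs]⇒x∉xs (p ∷ u) q ; q (there r) → d (there q) r }

  ʳ++-++ : ∀ (xs {ys zs} : List A) → (xs ʳ++ ys) ++ zs ≡ xs ʳ++ (ys ++ zs)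
  ʳ++-++ []       = refl
  ʳ++-++ (x ∷ xs) = ʳ++-++ xs

  unique-∉ : ∀ (as : List A) {x bs} → Unique (as ++ x ∷ bs) → ¬ x List.∈ bs
  unique-∉ []       u       = Unique.Unique[x∷xs]⇒x∉xs u
  unique-∉ (_ ∷ as) (_ ∷ u) = unique-∉ as u

  unique-length : ∀ {xs ys : List A} → Unique xs → (∀ {x} → x List.∈ xs → x List.∈ ys) → length xs ≤ length ys
  unique-length {[]}     _       _  = z≤n
  unique-length {x ∷ xs} (p ∷ u) xs⊆ with ∈-∃++ (xs⊆ (here refl))
  ... | as , bs , refl = ℕ.≤-trans (s≤s (unique-length u tail⊆))
          (ℕ.≤-reflexive (trans (cong suc (List.length-++ as)) (trans (sym (ℕ.+-suc (length as) (length bs))) (sym (List.length-++ as)))))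
    where
    tail⊆ : ∀ {y} → y List.∈ xs → y List.∈ as ++ bs
    tail⊆ q with ∈-++⁻ as (xs⊆ (there q))
    ... | inj₁ r           = ∈-++⁺ˡ r
    ... | inj₂ (here refl) = contradiction q (Unique.Unique[x∷xs]⇒x∉xs (p ∷ u))
    ... | inj₂ (there r)   = ∈-++⁺ʳ as r

-- A stack in cells 0, 1, …, with its top in the last cell.
Stack : ∀ {k} → (ℤ → ℤ) → List (Fin k) → Set
Stack f []       = Unit
Stack f (x ∷ xs) = f (+ length xs) ≡ + toℕ x × Stack f xs

stack-lookup : ∀ {k f} (as : List (Fin k)) {x bs} → Stack f (as ++ x ∷ bs) → f (+ length bs) ≡ + toℕ x
stack-lookup []       (p , _) = p
stack-lookup (_ ∷ as) (_ , s) = stack-lookup as s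

stack-cong : ∀ {k f g} (xs : List (Fin k)) → (∀ q → q < length xs → g (+ q) ≡ f (+ q)) → Stack f xs → Stack g xs
stack-cong []       eq _       = tt
stack-cong (x ∷ xs) eq (p , s) = trans (eq _ ℕ.≤-refl) p , stack-cong xs (λ q q< → eq q (ℕ.m<n⇒m<1+n q<)) s

module _ {n m : ℕ} {G : Graph n} (D : TreeDecomposition G m) where
  open Graph G
  open TreeDecomposition D

  -- When ys is processed in order after done, children come before their parents.
  Scheduled : List (Fin m) → List (Fin m) → Set
  Scheduled done []       = Unit
  Scheduled done (y ∷ ys) = (∀ {c} → parent c ≡ just y → c List.∈ done) × Scheduled (y ∷ done) ys

  scheduled-mono : ∀ {xs zs} ys → (∀ {c} → c List.∈ xs → c List.∈ zs) → Scheduled xs ys → Scheduled zs ys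
  scheduled-mono []       f _       = tt
  scheduled-mono (y ∷ ys) f (p , s) = f ∘ p , scheduled-mono ys (λ { (here e) → here e ; (there q) → there (f q) }) s

  -- as is the waiting queue, served from its end; bs are the finished nodes.
  record Queue (as bs : List (Fin m)) : Set where
    field
      unique    : Unique (as ++ bs)
      rooted    : root List.∈ as ++ bs
      origin    : ∀ {c} → c List.∈ as ++ bs → c ≡ root ⊎ ∃[ y ] (y List.∈ bs × parent c ≡ just y)
      scheduled : Scheduled as bs
  open Queue

  queue-start : Queue (root ∷ []) []
  queue-start = record { unique = [] ∷ [] ; rooted = here refl ; origin = λ { (here refl) → inj₁ refl } ; scheduled = tt }

  queue-step : ∀ {as x bs} → Queue (as ∷ʳ x) bs → Queue (children x ʳ++ as) (x ∷ bs)
  queue-step {as} {x} {bs} Q = record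
    { unique    = subst Unique (sym (ʳ++-++ (children x))) (unique-ʳ++ (unique-children D x) uniq disjoint)
    ; rooted    = old (rooted Q)
    ; origin    = λ c∈ → origin′ (subst (_ List.∈_) (ʳ++-++ (children x)) c∈)
    ; scheduled = (λ e → ∈-ʳ++⁺ˡ (children-∈ D e)) , scheduled-mono bs more (scheduled Q) }
    where
    move : (as ∷ʳ x) ++ bs ≡ as ++ x ∷ bs
    move = List.∷ʳ-++ as x bs
    uniq : Unique (as ++ x ∷ bs)
    uniq = subst Unique move (unique Q)
    old : ∀ {c} → c List.∈ (as ∷ʳ x) ++ bs → c List.∈ (children x ʳ++ as) ++ x ∷ bs
    old p = subst (_ List.∈_) (sym (ʳ++-++ (children x))) (∈-ʳ++⁺ʳ (children x) (subst (_ List.∈_) move p))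
    disjoint : ∀ {c} → c List.∈ children x → ¬ c List.∈ as ++ x ∷ bs
    -- If a child of x had been queued already, its parent x would be among the finished nodes; but
    -- x is being served and occurs only once.
    disjoint p q with ∈-children D p | origin Q (subst (_ List.∈_) (sym move) q)
    ... | e | inj₁ refl = root-top D e
    ... | e | inj₂ (y , y∈ , e′) = unique-∉ as uniq (subst (List._∈ bs) (just-injective (trans (sym e′) e)) y∈)
    origin′ : ∀ {c} → c List.∈ children x ʳ++ (as ++ x ∷ bs) → c ≡ root ⊎ ∃[ y ] (y List.∈ x ∷ bs × parent c ≡ just y)
    origin′ p with ∈-ʳ++⁻ (children x) p
    ... | inj₁ q = inj₂ (x , here refl , ∈-children D q)
    ... | inj₂ q with origin Q (subst (_ List.∈_) (sym move) q)
    ...   | inj₁ e = inj₁ e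
    ...   | inj₂ (y , y∈ , e) = inj₂ (y , there y∈ , e)
    more : ∀ {c} → c List.∈ as ∷ʳ x → c List.∈ x ∷ (children x ʳ++ as)
    more p with ∈-++⁻ as p
    ... | inj₁ q           = there (∈-ʳ++⁺ʳ (children x) q)
    ... | inj₂ (here refl) = here refl

  length-≤-m : ∀ {xs : List (Fin m)} → Unique xs → length xs ≤ m
  length-≤-m u = ℕ.≤-trans (unique-length u (λ {x} _ → ∈-allFin x)) (ℕ.≤-reflexive (List.length-tabulate {n = m} id))

  Ready : State → Set
  Ready σ = GivenIn D σ × Powers D (arrs σ 6) × Adjacency D (arrs σ 7)

  traverse-run : (∀ i → length (children i) ≤ 2) → ∀ σ → Ready σ →
    Run traverse σ (λ τ → Ready τ × ∃[ rs ] (regs τ 7 ≡ + length rs × Stack (arrs τ 8) rs × Queue [] rs)) (12 + m * 59)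
  traverse-run binary σ₀ ready₀ = store-then {σ₀} refl (Given.root-node (proj₁ ready₀)) (assign {σ₁} refl (assign {setReg 7 (+ 0) σ₁} refl
    (while-run I cost _ step (root ∷ [] , []) (setReg 8 (+ 1) (setReg 7 (+ 0) σ₁))
      (ready₀ , refl , refl , (setCell-eq 8 (+ 0) _ σ₀ refl , tt) , queue-start))))
    where
    σ₁ : State
    σ₁ = setCell 8 (+ 0) (+ toℕ root) σ₀
    I : List (Fin m) × List (Fin m) → State → Set
    I (as , bs) σ = Ready σ × regs σ 7 ≡ + length bs × regs σ 8 ≡ + length (as ++ bs) × Stack (arrs σ 8) (as ++ bs) × Queue as bs
    cost : List (Fin m) × List (Fin m) → ℕ
    cost (as , bs) = 5 + (m ∸ length bs) * 59
    step : ∀ x σ → I x σ → _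
    step (as , bs) σ (ready , h7 , h8 , stk , Q) with initLast as
    ... | [] = inj₁ (≺-false {σ} {reg 7} {reg 8} h7 h8 ℕ.≤-refl , (ready , bs , h7 , stk , Q) , ℕ.m≤m+n 5 _)
    ... | as′ ∷ʳ′ x with Given.child-lists (proj₁ ready) x
    ...   | s , hs , he , seg = inj₂
      ( ≺-true {σ} {reg 7} {reg 8} h7 h8 shorter , (children x ʳ++ as′ , x ∷ bs) , _
      , assign {σ} (trans (cong (arrs σ 8) h7) (stack-lookup as′ stk′))
          (assign {σ₂} hs (assign {setReg 5 (+ s) σ₂} he
            (scan-run 3 J (λ _ ys → budget 17 ys) (λ _ j → j) (λ _ → ℕ.≤-refl) body (as′ ++ x ∷ bs) (children x)
               (setReg 6 (+ (s + length (children x))) (setReg 5 (+ s) σ₂)) s refl refl seg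
               (ready , h7 , trans h8 (cong (+_ ∘ length) move) , stk′ , refl)
             ⨾ᴿ λ { {τ} (ls , ready′ , k7 , k8 , stk″ , eq) →
               assign-run {τ} (cong (ℤ._+ + 1) k7)
                 (ready′ , cong +_ (ℕ.+-comm (length bs) 1)
                 , trans k8 (cong (+_ ∘ length) (trans eq (sym (ʳ++-++ (children x)))))
                 , subst (Stack (arrs τ 8)) (trans eq (sym (ʳ++-++ (children x)))) stk″ , queue-step Q) })))
      , fits )
      where
      open ℕ.≤-Reasoning
      σ₂ : State
      σ₂ = setReg 10 (+ toℕ x) σ
      move : (as′ ∷ʳ x) ++ bs ≡ as′ ++ x ∷ bs
      move = List.∷ʳ-++ as′ x bs
      stk′ : Stack (arrs σ 8) (as′ ++ x ∷ bs)
      stk′ = subst (Stack (arrs σ 8)) move stk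
      shorter : length bs < length ((as′ ∷ʳ x) ++ bs)
      shorter = ℕ.≤-trans (ℕ.m≤n+m (length (x ∷ bs)) (length as′)) (ℕ.≤-reflexive (trans (sym (List.length-++ as′)) (cong length (sym move))))
      J : List (Fin m) → List (Fin m) → State → Set
      J ls ys τ = Ready τ × regs τ 7 ≡ + length bs × regs τ 8 ≡ + length ls × Stack (arrs τ 8) ls ×
                  ys ʳ++ ls ≡ children x ʳ++ (as′ ++ x ∷ bs)
      body : ∀ ls y ys σ s → regs σ 5 ≡ + s → arrs σ 3 (+ s) ≡ + toℕ y → J ls (y ∷ ys) σ → _
      body ls y ys σ s h5 hy (ready , k7 , k8 , stk , eq) = y ∷ ls , _ ,
        store-then {σ} {8} k8 (trans (cong (arrs σ 3) h5) hy)
          (assign-run {setCell 8 (+ length ls) (+ toℕ y) σ} {reg 8 ⊕ lit (+ 1)} {8} (cong (ℤ._+ + 1) k8)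
            ((ready , k7 , cong +_ (ℕ.+-comm (length ls) 1)
             , ( setCell-eq 8 (+ length ls) (+ toℕ y) σ refl
               , stack-cong ls (λ q q< → setCell-neq 8 (+ length ls) (+ toℕ y) σ (ℕ.<⇒≢ q< ∘ ℤ.+-injective)) stk )
             , eq) , refl , refl , λ _ → refl)) , ℕ.≤-refl
      room : length (x ∷ bs) ≤ m
      room = ℕ.≤-trans (ℕ.≤-trans (ℕ.m≤n+m (length (x ∷ bs)) (length as′)) (ℕ.≤-reflexive (sym (List.length-++ as′))))
        (length-≤-m (subst Unique move (Queue.unique Q)))
      -- The 59 is 16 for the test and three loads, 2 · 17 + 5 for scanning at most two children,
      -- and 4 for advancing the head of the queue.
      fits : 5 + (3 + (3 + (5 + (budget 17 (children x) + 4)))) + (5 + (m ∸ suc (length bs)) * 59) ≤ 5 + (m ∸ length bs) * 59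
      fits = begin
        5 + (3 + (3 + (5 + (budget 17 (children x) + 4)))) + (5 + (m ∸ suc (length bs)) * 59)
          ≤⟨ ℕ.+-monoˡ-≤ (5 + (m ∸ suc (length bs)) * 59) (ℕ.+-monoʳ-≤ 16 (ℕ.+-monoˡ-≤ 4
               (ℕ.≤-trans (ℕ.≤-reflexive (budget-length 17 (children x))) (ℕ.+-monoˡ-≤ 5 (ℕ.*-monoˡ-≤ 17 (binary x)))))) ⟩
        59 + (5 + (m ∸ suc (length bs)) * 59)
          ≡⟨ cong (λ k → 5 + k * 59) (ℕ.+-∸-assoc 1 room) ⟨
        5 + (suc m ∸ suc (length bs)) * 59 ∎

-- Processing a node

-- Registers 11 and 12 receive the children (or the fictitious node m), and
-- register 13 the number of choices for each vertex of the bag.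
choose : Program
choose =
  5 ≔ load 2 (reg 10) ⨾
  6 ≔ load 2 (reg 10 ⊕ lit (+ 1)) ⨾
  11 ≔ reg 1 ⨾
  12 ≔ reg 1 ⨾
  13 ≔ lit (+ 2) ⨾
  cond (reg 5 ≺ reg 6) (11 ≔ load 3 (reg 5)) skip ⨾
  cond ((reg 5 ⊕ lit (+ 1)) ≺ reg 6) (12 ≔ load 3 (reg 5 ⊕ lit (+ 1)) ⨾ 13 ≔ lit (+ 3)) skip

block : ℕ → Expr
block d = (lit (+ d) ⊗ reg 15) ⊕ reg 16

-- Blocks 1 and 2 are written whatever the number of choices. With two choices the length kept in
-- register 15 ends before block 2.
extend : Program
extend =
  17 ≔ load 9 (reg 16) ⨾
  20 ≔ load 10 (reg 16) ⨾
  store 9 (block 1) (reg 17 ⊕ reg 18) ⨾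
  store 9 (block 2) (reg 17) ⨾
  store 10 (block 1) (reg 20) ⨾
  store 10 (block 2) (reg 20 ⊕ reg 18)

enumerate : Program
enumerate =
  15 ≔ lit (+ 1) ⨾
  store 9 (lit (+ 0)) (lit (+ 0)) ⨾
  store 10 (lit (+ 0)) (lit (+ 0)) ⨾
  19 ≔ lit (+ 0) ⨾
  5 ≔ load 4 (reg 10) ⨾
  6 ≔ load 4 (reg 10 ⊕ lit (+ 1)) ⨾
  scan (
    18 ≔ load 6 (load 5 (reg 5)) ⨾
    19 ≔ (reg 19 ⊕ reg 18) ⨾
    16 ≔ lit (+ 0) ⨾
    count extend ⨾
    15 ≔ (reg 13 ⊗ reg 15))

-- Register 14 receives 3^v if v is forgotten at this node, and 0 otherwise.
compare : Program
compare =
  store 12 (reg 10) (reg 19) ⨾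
  14 ≔ (load 12 (reg 11) ⊖ reg 19) ⨾
  cond (reg 14 ≼ lit (+ 0)) (14 ≔ lit (+ 0)) skip

entry : Expr → ℕ → Expr
entry z x = (z ⊗ reg 9) ⊕ reg x

partners : Program
partners =
  5 ≔ load 4 (reg 10) ⨾
  6 ≔ load 4 (reg 10 ⊕ lit (+ 1)) ⨾
  scan (17 ≔ (reg 17 ⊕ (load 7 ((reg 14 ⊗ reg 0) ⊕ load 5 (reg 5))
                        ⊗ load 11 (entry (load 9 (reg 16) ⊖ load 6 (load 5 (reg 5))) 11))))

deposit : Program
deposit =
  store 11 (entry (load 9 (reg 16) ⊕ load 10 (reg 16)) 10)
    (load 11 (entry (load 9 (reg 16) ⊕ load 10 (reg 16)) 10) ⊕ (reg 17 ⊗ load 11 (entry (load 10 (reg 16)) 12)))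

multiply : Program
multiply =
  17 ≔ load 11 (entry (load 9 (reg 16) ⊕ reg 14) 11) ⨾
  cond (reg 14 ≐ lit (+ 0)) skip partners ⨾
  deposit

accumulate : Program
accumulate = 16 ≔ lit (+ 0) ⨾ count multiply

process : Program
process = choose ⨾ enumerate ⨾ compare ⨾ accumulate

clip : ℤ → ℤ
clip z = if does (z ℤ.≤? + 0) then + 0 else z

-- After t rounds of extend, block d of an array holds the first t entries of
-- block 0, increased by p if δ d.
Spread : (ℤ → ℤ) → (ℕ → ℤ) → (ℕ → Bool) → ℕ → ℤ → ℕ → Set
Spread f a δ N p t = ∀ d s → d < 3 → s < N → d ≡ 0 ⊎ s < t → f (cell N (+ d) s) ≡ plus (δ d) p (a s)

cell-0 : ∀ N s → cell N (+ 0) s ≡ + s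
cell-0 N s = cong (ℤ._+ + s) (ℤ.*-zeroˡ (+ N))

spread-start : ∀ f δ N p → δ 0 ≡ false → Spread f (λ s → f (+ s)) δ N p 0
spread-start f δ N p δ0 .0 s _ _ (inj₁ refl) rewrite δ0 = cong f (cell-0 N s)

-- The writes go to entry t of blocks 1 and 2, so block 0, the source of the copies, stays intact
-- during the round.
spread-step : ∀ k σ a δ N p t → t < N → δ 0 ≡ false → Spread (arrs σ k) a δ N p t →
  Spread (arrs (setCell k (cell N (+ 2) t) (plus (δ 2) p (a t)) (setCell k (cell N (+ 1) t) (plus (δ 1) p (a t)) σ)) k)
         a δ N p (suc t)
spread-step k σ a δ N p t t<N δ0 S d s d<3 s<N which = go d refl which
  where
  σ₁ : State
  σ₁ = setCell k (cell N (+ 1) t) (plus (δ 1) p (a t)) σ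
  apart : ∀ d d′ {s} → s < N → d ≢ d′ ⊎ s ≢ t → cell N (+ d) s ≢ cell N (+ d′) t
  apart d d′ s<N ne eq with cell-injective N s<N t<N eq
  ... | p , q = [ (λ d≢ → d≢ (ℤ.+-injective p)) , (λ s≢ → s≢ q) ]′ ne
  old : ∀ {q} → q ≢ cell N (+ 1) t → q ≢ cell N (+ 2) t →
        arrs (setCell k (cell N (+ 2) t) (plus (δ 2) p (a t)) σ₁) k q ≡ arrs σ k q
  old q≢₁ q≢₂ = trans (setCell-neq k _ _ σ₁ q≢₂) (setCell-neq k _ _ σ q≢₁)
  go : ∀ e → e ≡ d → d ≡ 0 ⊎ s < suc t → arrs (setCell k (cell N (+ 2) t) (plus (δ 2) p (a t)) σ₁) k (cell N (+ d) s) ≡ plus (δ d) p (a s)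
  go 0 refl _ = trans (old (apart 0 1 s<N (inj₁ λ ())) (apart 0 2 s<N (inj₁ λ ()))) (S 0 s d<3 s<N (inj₁ refl))
  go (suc e) refl (inj₂ s<1+t) with s ℕ.≟ t
  ... | no s≢t = trans (old (apart d 1 s<N (inj₂ s≢t)) (apart d 2 s<N (inj₂ s≢t)))
                       (S d s d<3 s<N (inj₂ (ℕ.≤∧≢⇒< (ℕ.≤-pred s<1+t) s≢t)))
  go 1 refl (inj₂ _) | yes refl = trans (setCell-neq k _ _ σ₁ (apart 1 2 s<N (inj₁ λ ()))) (setCell-eq k _ _ σ refl)
  go 2 refl (inj₂ _) | yes refl = setCell-eq k _ _ σ₁ refl
  go (suc (suc (suc _))) refl (inj₂ _) | yes refl = contradiction d<3 λ { (s≤s (s≤s (s≤s ()))) }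

-- Block d holds the pairs in which y received digit d. Exchanging the sum over blocks with the sum
-- over entries restores one unfolding of `spread` at each old entry.
sumN-extend : ∀ {n} κ N (y : Fin n) ys h (f g : ℤ → ℤ) (a b : ℕ → ℤ) → κ ≤ 3 →
  Spread f a left N (+ (3 ^ toℕ y)) N → Spread g b right N (+ (3 ^ toℕ y)) N →
  sumN (κ * N) (λ s → spread κ ys h (f (+ s)) (g (+ s))) ≡ sumN N (λ s → spread κ (y ∷ ys) h (a s) (b s))
sumN-extend κ N y ys h f g a b κ≤3 S T =
  trans (sumN-* κ N _) (trans (sumN-cong κ λ d d<κ → sumN-cong N λ s s<N →
    cong₂ (spread κ ys h) (trans (cong f (address d s)) (S d s (ℕ.<-≤-trans d<κ κ≤3) s<N (inj₂ s<N)))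
                          (trans (cong g (address d s)) (T d s (ℕ.<-≤-trans d<κ κ≤3) s<N (inj₂ s<N))))
    (sumN-swap κ N _))
  where
  address : ∀ d s → + (s + d * N) ≡ cell N (+ d) s
  address d s = trans (cong +_ (ℕ.+-comm s (d * N))) (cong (ℤ._+ + s) (ℤ.pos-* d N))

-- Correctness of the code for one node

module _ {n m : ℕ} {G : Graph n} (D : TreeDecomposition G m) where
  open Graph G
  open TreeDecomposition D

  record Context (ys : List (Fin m)) (r0 r1 r2 r7 r9 : ℤ) (a2 a3 a4 a5 a6 a7 a8 : ℤ → ℤ) : Set where
    field
      order-n     : r0 ≡ + n
      order-m     : r1 ≡ + m
      root-node   : r2 ≡ + toℕ root
      height      : r7 ≡ + length ys
      modulus     : r9 ≡ + (m + 1)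
      child-lists : Family a2 a3 children
      bag-lists   : Family a4 a5 (bagElems D)
      powers      : Powers D a6
      adjacency   : Adjacency D a7
      stack       : Stack a8 ys
  open Context

  ContextIn : List (Fin m) → State → Set
  ContextIn ys σ = Context ys (regs σ 0) (regs σ 1) (regs σ 2) (regs σ 7) (regs σ 9)
                     (arrs σ 2) (arrs σ 3) (arrs σ 4) (arrs σ 5) (arrs σ 6) (arrs σ 7) (arrs σ 8)

  first second ways : List (Fin m) → ℕ
  first []           = m
  first (j ∷ _)      = toℕ j
  second []          = m
  second (_ ∷ [])    = m
  second (_ ∷ k ∷ _) = toℕ k
  ways []            = 2
  ways (_ ∷ [])      = 2
  ways (_ ∷ _ ∷ _)   = 3

  stride : ℕ
  stride = m + 1

  rise : Maybe (Fin n) → ℤ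
  rise nothing  = + 0
  rise (just v) = + (3 ^ toℕ v)

  module _ (ys : List (Fin m)) (i : Fin m) (tables codes : ℤ → ℤ) where

    xs : List (Fin n)
    xs = elems (bag i)

    J K κ : ℕ
    J = first (children i)
    K = second (children i)
    κ = ways (children i)

    Held : State → Set
    Held σ = ContextIn ys σ × regs σ 10 ≡ + toℕ i × (∀ q → arrs σ 11 q ≡ tables q) × (∀ q → arrs σ 12 q ≡ codes q)

    Chosen : State → Set
    Chosen σ = Held σ × regs σ 11 ≡ + J × regs σ 12 ≡ + K × regs σ 13 ≡ + κ

    choose-run : ∀ σ → Held σ → Run choose σ Chosen 36
    choose-run σ held@(ctx , h10 , _) with child-lists ctx i
    ... | s , hs , he , seg =
      assign {σ} (trans (cong (arrs σ 2) h10) hs) (assign {σ₁} (trans (cong (λ z → arrs σ 2 (z ℤ.+ + 1)) h10) he)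
        (assign {σ₂} (order-m ctx) (assign {setReg 11 (+ m) σ₂} (order-m ctx) (assign {setReg 12 (+ m) (setReg 11 (+ m) σ₂)} refl
          (branch (children i) σ₃ held refl refl refl refl refl seg)))))
      where
      σ₁ σ₂ σ₃ : State
      σ₁ = setReg 5 (+ s) σ
      σ₂ = setReg 6 (+ (s + length (children i))) σ₁
      σ₃ = setReg 13 (+ 2) (setReg 12 (+ m) (setReg 11 (+ m) σ₂))
      branch : ∀ cs τ → Held τ → regs τ 5 ≡ + s → regs τ 6 ≡ + (s + length cs) → regs τ 11 ≡ + m → regs τ 12 ≡ + m →
               regs τ 13 ≡ + 2 → Segment (arrs τ 3) s cs →
               Run (cond (reg 5 ≺ reg 6) (11 ≔ load 3 (reg 5)) skip ⨾
                    cond ((reg 5 ⊕ lit (+ 1)) ≺ reg 6) (12 ≔ load 3 (reg 5 ⊕ lit (+ 1)) ⨾ 13 ≔ lit (+ 3)) skip) τ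
                   (λ τ → Held τ × regs τ 11 ≡ + first cs × regs τ 12 ≡ + second cs × regs τ 13 ≡ + ways cs) 22
      branch [] τ held h5 h6 h11 h12 h13 _ = weaken id (ℕ.≤ᵇ⇒≤ 14 22 tt)
        (else-run {τ} {reg 5 ≺ reg 6} (≺-false {τ} {reg 5} {reg 6} h5 h6 (ℕ.≤-reflexive (ℕ.+-identityʳ s)))
           (skip-run {τ} {λ τ′ → τ′ ≡ τ} refl) ⨾ᴿ λ { refl →
         else-run {τ} {(reg 5 ⊕ lit (+ 1)) ≺ reg 6}
           (≺-false {τ} {reg 5 ⊕ lit (+ 1)} {reg 6} (cong (ℤ._+ + 1) h5) h6 (ℕ.+-monoʳ-≤ s z≤n))
           (skip-run {τ} (held , h11 , h12 , h13)) })
      branch (j ∷ []) τ held h5 h6 h11 h12 h13 (hj , _) = weaken id (ℕ.≤ᵇ⇒≤ 16 22 tt)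
        (then-run {τ} {reg 5 ≺ reg 6} (≺-true {τ} {reg 5} {reg 6} h5 h6 (ℕ.m<m+n s (s≤s z≤n)))
           (assign-run {τ} {Q = λ τ′ → τ′ ≡ setReg 11 (+ toℕ j) τ} (trans (cong (arrs τ 3) h5) hj) refl) ⨾ᴿ λ { refl →
         else-run {setReg 11 (+ toℕ j) τ} {(reg 5 ⊕ lit (+ 1)) ≺ reg 6}
           (≺-false {setReg 11 (+ toℕ j) τ} {reg 5 ⊕ lit (+ 1)} {reg 6} (cong (ℤ._+ + 1) h5) h6 ℕ.≤-refl)
           (skip-run {setReg 11 (+ toℕ j) τ} (held , refl , h12 , h13)) })
      branch (j ∷ k ∷ cs) τ held h5 h6 h11 h12 h13 (hj , hk , _) = weaken id ℕ.≤-refl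
        (then-run {τ} {reg 5 ≺ reg 6} (≺-true {τ} {reg 5} {reg 6} h5 h6 (ℕ.m<m+n s (s≤s z≤n)))
           (assign-run {τ} {Q = λ τ′ → τ′ ≡ setReg 11 (+ toℕ j) τ} (trans (cong (arrs τ 3) h5) hj) refl) ⨾ᴿ λ { refl →
         then-run {setReg 11 (+ toℕ j) τ} {(reg 5 ⊕ lit (+ 1)) ≺ reg 6}
           (≺-true {setReg 11 (+ toℕ j) τ} {reg 5 ⊕ lit (+ 1)} {reg 6} (cong (ℤ._+ + 1) h5) h6 (ℕ.+-monoʳ-< s (s≤s (s≤s z≤n))))
           (assign {setReg 11 (+ toℕ j) τ} (trans (cong (λ z → arrs τ 3 (z ℤ.+ + 1)) h5) hk)
             (assign-run {setReg 12 (+ toℕ k) (setReg 11 (+ toℕ j) τ)} refl (held , refl , refl , refl))) })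

    ways≤3 : ∀ cs → ways cs ≤ 3
    ways≤3 []          = ℕ.≤ᵇ⇒≤ 2 3 tt
    ways≤3 (_ ∷ [])    = ℕ.≤ᵇ⇒≤ 2 3 tt
    ways≤3 (_ ∷ _ ∷ _) = ℕ.≤-refl

    Enumerated : State → Set
    Enumerated σ = Chosen σ × ∃[ N ] (regs σ 15 ≡ + N × N ≡ κ ^ length xs × regs σ 19 ≡ + enc (bag i) ×
      (∀ h → sumN N (λ s → h (arrs σ 9 (+ s)) (arrs σ 10 (+ s))) ≡ spread κ xs h (+ 0) (+ 0)))

    enumerateCost : ℕ → List (Fin n) → ℕ
    enumerateCost N []       = 5
    enumerateCost N (y ∷ us) = 28 + N * 47 + enumerateCost (κ * N) us

    enumerate-run : ∀ σ → Chosen σ → Run enumerate σ Enumerated (18 + enumerateCost 1 xs)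
    enumerate-run σ chosen@((ctx , h10 , _) , _) with bag-lists ctx i
    ... | s , hs , he , seg =
      assign {σ} refl (store-then {σ₁} refl refl (store-then {σ₂} refl refl (assign {σ₃} refl
        (assign {σ₄} (trans (cong (arrs σ 4) h10) hs) (assign {setReg 5 (+ s) σ₄} (trans (cong (λ z → arrs σ 4 (z ℤ.+ + 1)) h10) he)
          (weaken (λ {τ} → finish {τ}) ℕ.≤-refl
            (scan-run 5 I enumerateCost (λ _ j → j) (λ _ → ℕ.≤-refl) body 1 xs
              (setReg 6 (+ (s + length xs)) (setReg 5 (+ s) σ₄)) s refl refl seg
              (chosen , refl , (0 , refl , weight-elems (bag i)) , start , ℕ.*-identityˡ _))))))))
      where
      σ₁ σ₂ σ₃ σ₄ : State
      σ₁ = setReg 15 (+ 1) σ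
      σ₂ = setCell 9 (+ 0) (+ 0) σ₁
      σ₃ = setCell 10 (+ 0) (+ 0) σ₂
      σ₄ = setReg 19 (+ 0) σ₃

      -- The invariant says that the stored pairs, completed over the unread vertices, always give
      -- the full sum. It holds for all `h` at once because later every address z is inspected with
      -- its own summand.
      Sums : ℕ → List (Fin n) → (ℤ → ℤ) → (ℤ → ℤ) → Set
      Sums N us f g = ∀ h → sumN N (λ s → spread κ us h (f (+ s)) (g (+ s))) ≡ spread κ xs h (+ 0) (+ 0)

      I : ℕ → List (Fin n) → State → Set
      I N us τ = Chosen τ × regs τ 15 ≡ + N × (∃[ w ] (regs τ 19 ≡ + w × w + weight us ≡ enc (bag i))) ×
                 Sums N us (arrs τ 9) (arrs τ 10) × N * κ ^ length us ≡ κ ^ length xs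

      start : Sums 1 xs (arrs σ₄ 9) (arrs σ₄ 10)
      start h = trans (ℤ.+-identityˡ _) (cong₂ (spread κ xs h) (setCell-eq 9 (+ 0) (+ 0) σ₁ refl) (setCell-eq 10 (+ 0) (+ 0) σ₂ refl))

      finish : ∀ {τ} → ∃[ N ] I N [] τ → Enumerated τ
      finish (N , ch , h15 , (w , h19 , hw) , sums , hN) = ch , N , h15 , trans (sym (ℕ.*-identityʳ N)) hN ,
        trans h19 (cong +_ (trans (sym (ℕ.+-identityʳ w)) hw)) , sums

      body : ∀ N y us τ s → regs τ 5 ≡ + s → arrs τ 5 (+ s) ≡ + toℕ y → I N (y ∷ us) τ → _
      body N y us τ s h5 hy (ch@((ctx , _) , _ , _ , h13) , h15 , (w , h19 , hw) , sums , hN) = κ * N , _ ,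
        assign {τ} {z = + p} (trans (cong (arrs τ 6) (trans (cong (arrs τ 5) h5) hy)) (powers ctx y))
          (assign {setReg 18 (+ p) τ} (cong (ℤ._+ + p) h19)
            (assign {setReg 19 (+ (w + p)) (setReg 18 (+ p) τ)} refl
              (count-run N 38 L (λ _ j → j) round (setReg 16 (+ 0) (setReg 19 (+ (w + p)) (setReg 18 (+ p) τ))) refl h15
                 (ch , h15 , refl , refl , refl , refl , (λ _ → refl) , spread-start (arrs τ 9) left N (+ p) refl , spread-start (arrs τ 10) right N (+ p) refl)
               ⨾ᴿ λ { {υ} (ch′ , k15 , _ , k19 , k5 , k6 , kA , S , T) →
                  assign-run {υ} (trans (cong₂ ℤ._*_ (proj₂ (proj₂ (proj₂ ch′))) k15) (sym (ℤ.pos-* κ N)))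
                    ((ch′ , refl , (w + p , k19 , trans (ℕ.+-assoc w p (weight us)) hw)
                      , (λ h → trans (sumN-extend κ N y us h (arrs υ 9) (arrs υ 10) _ _ (ways≤3 (children i)) S T) (sums h))
                      , trans (arith κ N (κ ^ length us)) hN)
                    , k5 , k6 , kA) })))
        , ℕ.≤-reflexive (arith′ N (enumerateCost (κ * N) us))
        where
        p : ℕ
        p = 3 ^ toℕ y
        arith : ∀ k N z → k * N * z ≡ N * (k * z)
        arith = ℕ-solve
        arith′ : ∀ N c → 9 + (4 + (4 + (2 + ((N * 47 + 5) + 4)))) + c ≡ 28 + N * 47 + c
        arith′ = ℕ-solve
        L : ℕ → State → Set
        L t υ = Chosen υ × regs υ 15 ≡ + N × regs υ 18 ≡ + p × regs υ 19 ≡ + (w + p) × regs υ 5 ≡ regs τ 5 × regs υ 6 ≡ regs τ 6 × (∀ q → arrs υ 5 q ≡ arrs τ 5 q) ×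
                Spread (arrs υ 9) (λ s → arrs τ 9 (+ s)) left N (+ p) t × Spread (arrs υ 10) (λ s → arrs τ 10 (+ s)) right N (+ p) t
        round : ∀ t υ → t < N → regs υ 16 ≡ + t → L t υ → _
        round t υ t<N h16 (ch , k15 , k18 , k19 , k5 , k6 , kA , S , T) =
          assign {υ} {z = arrs τ 9 (+ t)} (trans (cong (arrs υ 9) (trans h16 (sym (cell-0 N t)))) (S 0 t (s≤s z≤n) t<N (inj₁ refl)))
            (assign {υ₁} {z = arrs τ 10 (+ t)} (trans (cong (arrs υ 10) (trans h16 (sym (cell-0 N t)))) (T 0 t (s≤s z≤n) t<N (inj₁ refl)))
              (store-then {υ₂} {9} (at 1) (cong (λ x → arrs τ 9 (+ t) ℤ.+ x) k18)
                (store-then {υ₃} {9} (at 2) refl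
                  (store-then {υ₄} {10} (at 1) refl
                    (store-run {υ₅} {10} (at 2) (cong (λ x → arrs τ 10 (+ t) ℤ.+ x) k18)
                      ((ch , k15 , k18 , k19 , k5 , k6 , kA
                       , spread-step 9 υ₂ _ left N (+ p) t t<N refl S
                       , spread-step 10 υ₄ _ right N (+ p) t t<N refl T) , refl , refl))))))
          where
          at : ∀ d → + d ℤ.* regs υ 15 ℤ.+ regs υ 16 ≡ cell N (+ d) t
          at d = cong₂ (λ x y → + d ℤ.* x ℤ.+ y) k15 h16
          υ₁ υ₂ υ₃ υ₄ υ₅ : State
          υ₁ = setReg 17 (arrs τ 9 (+ t)) υ
          υ₂ = setReg 20 (arrs τ 10 (+ t)) υ₁
          υ₃ = setCell 9 (cell N (+ 1) t) (arrs τ 9 (+ t) ℤ.+ + p) υ₂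
          υ₄ = setCell 9 (cell N (+ 2) t) (arrs τ 9 (+ t)) υ₃
          υ₅ = setCell 10 (cell N (+ 1) t) (arrs τ 10 (+ t)) υ₄

    Compared : Maybe (Fin n) → State → Set
    Compared mv σ =
      ContextIn ys σ × regs σ 10 ≡ + toℕ i × regs σ 11 ≡ + J × regs σ 12 ≡ + K × regs σ 14 ≡ rise mv ×
      (∀ q → arrs σ 11 q ≡ tables q) × arrs σ 12 (+ toℕ i) ≡ + enc (bag i) × (∀ q → q ≢ + toℕ i → arrs σ 12 q ≡ codes q) ×
      ∃[ N ] (regs σ 15 ≡ + N × N ≡ κ ^ length xs ×
        (∀ h → sumN N (λ s → h (arrs σ 9 (+ s)) (arrs σ 10 (+ s))) ≡ spread κ xs h (+ 0) (+ 0)))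

    compare-run : ∀ mv → J ≢ toℕ i → clip (codes (+ J) ℤ.- + enc (bag i)) ≡ rise mv →
                  ∀ σ → Enumerated σ → Run compare σ (Compared mv) 14
    compare-run mv J≢i clipped σ (((ctx , h10 , hT , hC) , h11 , h12 , _) , N , h15 , hN , h19 , sums) =
      store-then {σ} {12} h10 h19 (assign {σ₁} {z = z} (cong₂ ℤ._-_ code h19) (branch (z ℤ.≤? + 0)))
      where
      z : ℤ
      z = codes (+ J) ℤ.- + enc (bag i)
      σ₁ σ₂ : State
      σ₁ = setCell 12 (+ toℕ i) (+ enc (bag i)) σ
      σ₂ = setReg 14 z σ₁
      code : arrs σ₁ 12 (regs σ 11) ≡ codes (+ J)
      code = trans (cong (arrs σ₁ 12) h11) (trans (setCell-neq 12 _ _ σ (J≢i ∘ ℤ.+-injective)) (hC (+ J)))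
      others : ∀ q → q ≢ + toℕ i → arrs σ₁ 12 q ≡ codes q
      others q ne = trans (setCell-neq 12 _ _ σ ne) (hC q)
      branch : Dec (z ℤ.≤ + 0) → Run (cond (reg 14 ≼ lit (+ 0)) (14 ≔ lit (+ 0)) skip) σ₂ (Compared mv) 6
      branch (yes le) = then-run {σ₂} {reg 14 ≼ lit (+ 0)} (dec-true (z ℤ.≤? + 0) le)
            (assign-run {σ₂} refl (ctx , h10 , h11 , h12 , trans (sym (cong (λ b → if b then + 0 else z) (dec-true (z ℤ.≤? + 0) le))) clipped
              , hT , setCell-eq 12 (+ toℕ i) _ σ refl , others , N , h15 , hN , sums))
      branch (no nle) = weaken id (ℕ.≤ᵇ⇒≤ 5 6 tt) (else-run {σ₂} {reg 14 ≼ lit (+ 0)} (dec-false (z ℤ.≤? + 0) nle)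
            (skip-run {σ₂} (ctx , h10 , h11 , h12 , trans (sym (cong (λ b → if b then + 0 else z) (dec-false (z ℤ.≤? + 0) nle))) clipped
              , hT , setCell-eq 12 (+ toℕ i) _ σ refl , others , N , h15 , hN , sums)))

    -- The summand + 0 mirrors the program, which adds register 14 at every node.
    leftEntry : ℕ → Maybe (Fin n) → ℤ → ℤ
    leftEntry j nothing  a = tables (cell stride (a ℤ.+ + 0) j)
    leftEntry j (just v) a = tables (cell stride (a ℤ.+ + (3 ^ toℕ v)) j)
      ℤ.+ lsum (λ u → adj D v u ℤ.* tables (cell stride (a ℤ.- + (3 ^ toℕ u)) j)) xs

    product : ℕ → ℕ → Maybe (Fin n) → ℤ → ℤ → ℤ
    product j k mv a b = leftEntry j mv a ℤ.* tables (cell stride b k)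

    Processed : Maybe (Fin n) → State → Set
    Processed mv σ =
      ContextIn ys σ × arrs σ 12 (+ toℕ i) ≡ + enc (bag i) × (∀ q → q ≢ + toℕ i → arrs σ 12 q ≡ codes q) ×
      (∀ z j → j < stride → j ≢ toℕ i → arrs σ 11 (cell stride z j) ≡ tables (cell stride z j)) ×
      (∀ z → arrs σ 11 (cell stride z (toℕ i)) ≡ combine κ (bag i) (product J K mv) z)

    partnersCost : Maybe (Fin n) → ℕ
    partnersCost nothing  = 1
    partnersCost (just _) = 8 + budget 31 xs

    module Accumulate (mv : Maybe (Fin n)) (J<M : J < stride) (K<M : K < stride) (J≢i : J ≢ toℕ i) (K≢i : K ≢ toℕ i)
                      (empty : ∀ z → tables (cell stride z (toℕ i)) ≡ + 0)
                      (N : ℕ) (a b : ℕ → ℤ) where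

      i<M : toℕ i < stride
      i<M = ℕ.<-≤-trans (Fin.toℕ<n i) (ℕ.m≤m+n m 1)

      term : ℤ → ℕ → ℤ
      term z s = if does ((a s ℤ.+ b s) ℤ.≟ z) then product J K mv (a s) (b s) else + 0

      -- Only column i of array 11 is written, while the factors are read from columns J and K; as
      -- these differ from i, partial results are never read back as factors.
      Sofar : ℕ → State → Set
      Sofar t σ =
        ContextIn ys σ × regs σ 10 ≡ + toℕ i × regs σ 11 ≡ + J × regs σ 12 ≡ + K × regs σ 14 ≡ rise mv × regs σ 15 ≡ + N ×
        (∀ s → arrs σ 9 (+ s) ≡ a s) × (∀ s → arrs σ 10 (+ s) ≡ b s) ×
        arrs σ 12 (+ toℕ i) ≡ + enc (bag i) × (∀ q → q ≢ + toℕ i → arrs σ 12 q ≡ codes q) ×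
        (∀ z j → j < stride → j ≢ toℕ i → arrs σ 11 (cell stride z j) ≡ tables (cell stride z j)) ×
        (∀ z → arrs σ 11 (cell stride z (toℕ i)) ≡ sumN t (term z))

      partners-run : ∀ t σ → regs σ 16 ≡ + t → Sofar t σ → regs σ 17 ≡ tables (cell stride (a t ℤ.+ rise mv) J) →
        Run (cond (reg 14 ≐ lit (+ 0)) skip partners) σ
          (λ τ → Sofar t τ × regs τ 16 ≡ + t × regs τ 17 ≡ leftEntry J mv (a t)) (4 + partnersCost mv)
      partners-run t σ h16 so@(ctx , h10 , h11 , h12 , h14 , h15 , hA , hB , hc , hC , hT , hS) h17 = go mv h14 h17 refl
        where
        go : ∀ mv′ → regs σ 14 ≡ rise mv′ → regs σ 17 ≡ tables (cell stride (a t ℤ.+ rise mv′) J) → mv′ ≡ mv →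
             Run (cond (reg 14 ≐ lit (+ 0)) skip partners) σ
               (λ τ → Sofar t τ × regs τ 16 ≡ + t × regs τ 17 ≡ leftEntry J mv (a t)) (4 + partnersCost mv′)
        go nothing g14 g17 refl = then-run {σ} {reg 14 ≐ lit (+ 0)} (dec-true (regs σ 14 ℤ.≟ + 0) g14) (skip-run {σ} (so , h16 , g17))
        go (just v) g14 g17 refl with bag-lists ctx i
        ... | s , hs , he , seg = else-run {σ} {reg 14 ≐ lit (+ 0)}
            (dec-false (regs σ 14 ℤ.≟ + 0) (λ eq → ℕ.<⇒≢ (ℕ.m^n>0 3 (toℕ v)) (sym (ℤ.+-injective (trans (sym g14) eq)))))
            (assign {σ} (trans (cong (arrs σ 4) h10) hs) (assign {setReg 5 (+ s) σ} (trans (cong (λ z → arrs σ 4 (z ℤ.+ + 1)) h10) he)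
              (weaken (λ { (_ , so′ , k16 , k17) → so′ , k16 , trans (sym (ℤ.+-identityʳ _)) k17 }) ℕ.≤-refl
                (scan-run 5 I (λ _ us → budget 31 us) (λ _ j → j) (λ _ → ℕ.≤-refl) body tt xs
                  (setReg 6 (+ (s + length xs)) (setReg 5 (+ s) σ)) s refl refl seg (so , h16 , cong (ℤ._+ lsum f xs) g17)))))
          where
          f : Fin n → ℤ
          f u = adj D v u ℤ.* tables (cell stride (a t ℤ.- + (3 ^ toℕ u)) J)
          I : Unit → List (Fin n) → State → Set
          I _ us τ = Sofar t τ × regs τ 16 ≡ + t × regs τ 17 ℤ.+ lsum f us ≡ leftEntry J (just v) (a t)
          body : ∀ (_ : Unit) u us τ s → regs τ 5 ≡ + s → arrs τ 5 (+ s) ≡ + toℕ u → I tt (u ∷ us) τ → _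
          body _ u us τ s g5 gu (so@(ctx , k10 , k11 , k12 , k14 , _ , kA , _ , _ , _ , kT , _) , k16 , k17) = tt , _ ,
            assign-run {τ} {z = regs τ 17 ℤ.+ f u} (cong (λ x → regs τ 17 ℤ.+ x) (cong₂ ℤ._*_
                (trans (cong (arrs τ 7) (cong₂ ℤ._+_ (cong₂ ℤ._*_ k14 (order-n ctx)) at-u)) (adjacency ctx v u))
                (trans (cong (arrs τ 11) (cong₂ ℤ._+_ (cong₂ ℤ._*_ (cong₂ ℤ._-_ (trans (cong (arrs τ 9) k16) (kA t))
                   (trans (cong (arrs τ 6) at-u) (powers ctx u))) (modulus ctx)) k11)) (kT (a t ℤ.- + (3 ^ toℕ u)) J J<M J≢i))))
              ((so , k16 , trans (ℤ.+-assoc (regs τ 17) (f u) (lsum f us)) k17) , refl , refl , λ _ → refl) , ℕ.≤-refl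
            where
            at-u : arrs τ 5 (regs τ 5) ≡ + toℕ u
            at-u = trans (cong (arrs τ 5) g5) gu

      round : ∀ t σ → t < N → regs σ 16 ≡ + t → Sofar t σ →
        Run multiply σ (λ υ → Sofar (suc t) υ × regs υ 16 ≡ regs σ 16 × regs υ 15 ≡ regs σ 15)
          (10 + ((4 + partnersCost mv) + 30))
      round t σ t<N h16 so@(ctx , h10 , h11 , h12 , h14 , h15 , hA , hB , hc , hC , hT , hS) =
        assign {σ} {z = tables (cell stride (a t ℤ.+ rise mv) J)}
          (trans (cong (arrs σ 11) (cong₂ ℤ._+_ (cong₂ ℤ._*_ (cong₂ ℤ._+_ (trans (cong (arrs σ 9) h16) (hA t)) h14) (modulus ctx)) h11))
                 (hT (a t ℤ.+ rise mv) J J<M J≢i))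
          (partners-run t (setReg 17 _ σ) h16 so refl ⨾ᴿ λ { {τ} (so′ , k16 , k17) → final τ so′ k16 k17 })
        where
        final : ∀ τ → Sofar t τ → regs τ 16 ≡ + t → regs τ 17 ≡ leftEntry J mv (a t) → Run deposit τ
                  (λ υ → Sofar (suc t) υ × regs υ 16 ≡ regs σ 16 × regs υ 15 ≡ regs σ 15) 30
        final τ (ctx , k10 , k11 , k12 , k14 , k15 , kA , kB , kc , kC , kT , kS) k16 k17 =
          store-run {τ} {11} {p = goal} {z = arrs τ 11 goal ℤ.+ product J K mv (a t) (b t)} target
            (cong₂ ℤ._+_ (cong (arrs τ 11) target) (cong₂ ℤ._*_ k17
              (trans (cong (arrs τ 11) (cong₂ ℤ._+_ (cong₂ ℤ._*_ at-b (modulus ctx)) k12)) (kT (b t) K K<M K≢i))))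
            ((ctx , k10 , k11 , k12 , k14 , k15 , kA , kB , kc , kC
             , (λ z j j<M j≢i → trans (setCell-neq 11 goal w τ (j≢i ∘ proj₂ ∘ cell-injective stride {z} {a t ℤ.+ b t} j<M i<M)) (kT z j j<M j≢i))
             , sums) , trans k16 (sym h16) , trans k15 (sym h15))
          where
          goal : ℤ
          goal = cell stride (a t ℤ.+ b t) (toℕ i)
          at-b : arrs τ 10 (regs τ 16) ≡ b t
          at-b = trans (cong (arrs τ 10) k16) (kB t)
          target : (arrs τ 9 (regs τ 16) ℤ.+ arrs τ 10 (regs τ 16)) ℤ.* regs τ 9 ℤ.+ regs τ 10 ≡ goal
          target = cong₂ ℤ._+_ (cong₂ ℤ._*_ (cong₂ ℤ._+_ (trans (cong (arrs τ 9) k16) (kA t)) at-b) (modulus ctx)) k10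
          w : ℤ
          w = arrs τ 11 goal ℤ.+ product J K mv (a t) (b t)
          sums : ∀ z → arrs (setCell 11 goal w τ) 11 (cell stride z (toℕ i)) ≡ sumN (suc t) (term z)
          sums z = add ((a t ℤ.+ b t) ℤ.≟ z)
            where
            add : Dec (a t ℤ.+ b t ≡ z) → arrs (setCell 11 goal w τ) 11 (cell stride z (toℕ i)) ≡ sumN (suc t) (term z)
            add (yes refl) = trans (setCell-eq 11 goal w τ refl) (cong₂ ℤ._+_ (kS z)
                  (sym (cong (λ c → if c then product J K mv (a t) (b t) else + 0) (dec-true ((a t ℤ.+ b t) ℤ.≟ z) refl))))
            add (no ne) = trans (setCell-neq 11 goal w τ (ne ∘ sym ∘ proj₁ ∘ cell-injective stride {z} {a t ℤ.+ b t} i<M i<M))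
                  (trans (kS z) (trans (sym (ℤ.+-identityʳ _)) (cong (λ x → sumN t (term z) ℤ.+ x)
                    (sym (cong (λ c → if c then product J K mv (a t) (b t) else + 0) (dec-false ((a t ℤ.+ b t) ℤ.≟ z) ne))))))

    accumulateCost : Maybe (Fin n) → ℕ
    accumulateCost mv = 2 + (κ ^ length xs * (53 + partnersCost mv) + 5)

    accumulate-run : ∀ mv → J < stride → K < stride → J ≢ toℕ i → K ≢ toℕ i → (∀ z → tables (cell stride z (toℕ i)) ≡ + 0) →
                     ∀ σ → Compared mv σ → Run accumulate σ (Processed mv) (accumulateCost mv)
    accumulate-run mv J<M K<M J≢i K≢i empty σ (ctx , h10 , h11 , h12 , h14 , hT , hc , hC , N , h15 , refl , sums) =
      assign {σ} refl (weaken (λ {τ} → finish {τ}) (ℕ.≤-reflexive (cong (λ c → N * c + 5) (arith (partnersCost mv))))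
        (count-run N (10 + ((4 + partnersCost mv) + 30)) Sofar (λ _ j → j) round (setReg 16 (+ 0) σ) refl h15
          (ctx , h10 , h11 , h12 , h14 , h15 , (λ _ → refl) , (λ _ → refl) , hc , hC , (λ z j _ _ → hT _) , (λ z → trans (hT _) (empty z)))))
      where
      open Accumulate mv J<M K<M J≢i K≢i empty N (λ s → arrs σ 9 (+ s)) (λ s → arrs σ 10 (+ s))
      arith : ∀ c → 9 + (10 + ((4 + c) + 30)) ≡ 53 + c
      arith = ℕ-solve
      finish : ∀ {τ} → Sofar N τ → Processed mv τ
      finish (ctx , _ , _ , _ , _ , _ , _ , _ , kc , kC , kT , kS) = ctx , kc , kC , kT , λ z →
        trans (kS z) (trans (sums (λ a b → if does ((a ℤ.+ b) ℤ.≟ z) then product J K mv a b else + 0)) (spread-elems κ (bag i) _))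

    processCost : Maybe (Fin n) → ℕ
    processCost mv = 36 + ((18 + enumerateCost 1 xs) + (14 + accumulateCost mv))

    process-run : ∀ mv → clip (codes (+ J) ℤ.- + enc (bag i)) ≡ rise mv →
                  J < stride → K < stride → J ≢ toℕ i → K ≢ toℕ i → (∀ z → tables (cell stride z (toℕ i)) ≡ + 0) →
                  ∀ σ → Held σ → Run process σ (Processed mv) (processCost mv)
    process-run mv clipped J<M K<M J≢i K≢i empty σ held =
      choose-run σ held ⨾ᴿ λ {τ} ch → enumerate-run τ ch ⨾ᴿ λ {υ} en → compare-run mv J≢i clipped υ en ⨾ᴿ λ {φ} co →
      accumulate-run mv J<M K<M J≢i K≢i empty φ co

-- The main loop

solve : Program
solve =
  9 ≔ (reg 1 ⊕ lit (+ 1)) ⨾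
  store 11 (reg 1) (lit (+ 1)) ⨾
  while (lit (+ 0) ≺ reg 7) (
    7 ≔ (reg 7 ⊖ lit (+ 1)) ⨾
    10 ≔ load 8 (reg 7) ⨾
    process) ⨾
  0 ≔ load 11 (reg 2)

matchingCounter : Program
matchingCounter = setup ⨾ traverse ⨾ solve

clip-≤ : ∀ {a b} → a ≤ b → clip (+ a ℤ.- + b) ≡ + 0
clip-≤ {a} {b} a≤b = cong (λ c → if c then + 0 else + a ℤ.- + b)
  (dec-true ((+ a ℤ.- + b) ℤ.≤? + 0) (ℤ.i≤j⇒i-j≤0 (ℤ.+≤+ a≤b)))

clip-> : ∀ a p → 0 < p → clip (+ (a + p) ℤ.- + a) ≡ + p
clip-> a p 0<p = trans (cong clip (arith (+ a) (+ p)))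
  (cong (λ c → if c then + 0 else + p) (dec-false (+ p ℤ.≤? + 0) λ { (ℤ.+≤+ p≤0) → ℕ.<⇒≱ 0<p p≤0 }))
  where
  arith : ∀ a p → a ℤ.+ p ℤ.- a ≡ p
  arith = ℤ-solve

module _ {n m : ℕ} {G : Graph n} (D : TreeDecomposition G m) where
  open Graph G
  open TreeDecomposition D

  table-cong : ∀ {X F s t} → (∀ z → t z ≡ s z) → Table D X F s → Table D X F t
  table-cong eq T = record
    { hit  = λ S S⊆X → trans (eq _) (Table.hit T S S⊆X)
    ; miss = λ z h → trans (eq z) (Table.miss T z h) }

  Correct : (ℤ → ℤ) → (ℤ → ℤ) → Fin m → Set
  Correct tables codes j = codes (+ toℕ j) ≡ + enc (bag j) ×
    ∃[ F ] (Forgotten D j F × Table D (bag j) F (λ z → tables (cell (stride D) z (toℕ j))))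

  -- `mv` is the vertex forgotten at this node, if any. The alternative
  -- `ways D cs ≡ 2 ⊎ mv ≡ nothing` serves the running time: the scan for partners, linear in the
  -- bag, happens only where there are 2^k pairs and never at a join.
  node-correct : ∀ ys i tables codes cs → children i ≡ cs → NiceNode D i cs →
    (∀ {c} → c List.∈ cs → Correct tables codes c) → tables (cell (stride D) (+ 0) m) ≡ + 1 → codes (+ m) ≡ + 0 →
    ∃[ mv ] (clip (codes (+ first D cs) ℤ.- + enc (bag i)) ≡ rise D mv × (ways D cs ≡ 2 ⊎ mv ≡ nothing) ×
      ∃[ F ] (Forgotten D i F ×
        Table D (bag i) F (combine (ways D cs) (bag i) (product D ys i tables codes (first D cs) (second D cs) mv))))
  node-correct ys i tables codes [] eq empty ok unit code = nothing
    , trans (cong (λ c → clip (c ℤ.- + enc (bag i))) code) (clip-≤ {0} {enc (bag i)} z≤n) , inj₁ refl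
    , ∅ , leaf-forgotten D eq
    , leaf-table D {i} {product D ys i tables codes m m nothing} empty
        (cong₂ ℤ._*_ unit unit)
  node-correct ys i tables codes (j ∷ []) eq (inj₁ (v , v∉j , bag-eq)) ok unit code with ok (here refl)
  ... | hc , F , f , T = nothing
    , trans (cong (λ c → clip (c ℤ.- + enc (bag i))) hc)
        (clip-≤ (ℕ.≤-trans (ℕ.m≤m+n (enc (bag j)) (3 ^ toℕ v)) (ℕ.≤-reflexive (sym (trans (cong enc bag-eq) (enc-insert v (bag j) v∉j))))))
    , inj₁ refl , F , Introduce.forgotten D eq v∉j bag-eq f
    , Introduce.table D eq v∉j bag-eq f {V = product D ys i tables codes (toℕ j) m nothing} T (λ a →
        trans (cong₂ ℤ._*_ (cong (λ z → tables (cell (stride D) z (toℕ j))) (ℤ.+-identityʳ a)) unit) (ℤ.*-identityʳ _))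
  node-correct ys i tables codes (j ∷ []) eq (inj₂ (v , v∉i , bag-eq)) ok unit code with ok (here refl)
  ... | hc , F , f , T = just v
    , trans (cong (λ c → clip (c ℤ.- + enc (bag i))) (trans hc (cong +_ (trans (cong enc bag-eq) (enc-insert v (bag i) v∉i)))))
        (clip-> (enc (bag i)) (3 ^ toℕ v) (ℕ.m^n>0 3 (toℕ v)))
    , inj₁ refl , _ , Forget.forgotten D eq v∉i bag-eq f
    , table-combine₂ D {V = product D ys i tables codes (toℕ j) m (just v)} (λ S S⊆i →
        trans (cong (leftEntry D ys i tables codes (toℕ j) (just v) (+ enc S) ℤ.*_) unit)
          (trans (ℤ.*-identityʳ _) (Forget.value D eq v∉i bag-eq f S⊆i T)))
  node-correct ys i tables codes (j ∷ k ∷ []) eq (bag-j , bag-k) ok unit code with ok (here refl) | ok (there (here refl))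
  ... | hc , F₁ , f₁ , T₁ | _ , F₂ , f₂ , T₂ = nothing
    , trans (cong (λ c → clip (c ℤ.- + enc (bag i))) hc) (clip-≤ (ℕ.≤-reflexive (cong enc (sym bag-j)))) , inj₂ refl
    , _ , Join.forgotten D eq bag-j bag-k f₁ f₂
    , Join.table D eq bag-j bag-k f₁ f₂ {V = product D ys i tables codes (toℕ j) (toℕ k) nothing} T₁ T₂ (λ a b →
        cong (ℤ._* tables (cell (stride D) b (toℕ k))) (cong (λ z → tables (cell (stride D) z (toℕ j))) (ℤ.+-identityʳ a)))

  first-cases : ∀ i → (first D (children i) ≡ m) ⊎ ∃[ j ] (parent j ≡ just i × first D (children i) ≡ toℕ j)
  first-cases i = go (children i) (λ p → ∈-children D p)
    where
    go : ∀ cs → (∀ {c} → c List.∈ cs → parent c ≡ just i) → first D cs ≡ m ⊎ ∃[ j ] (parent j ≡ just i × first D cs ≡ toℕ j)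
    go []      h = inj₁ refl
    go (j ∷ _) h = inj₂ (j , h (here refl) , refl)

  second-cases : ∀ i → (second D (children i) ≡ m) ⊎ ∃[ j ] (parent j ≡ just i × second D (children i) ≡ toℕ j)
  second-cases i = go (children i) (λ p → ∈-children D p)
    where
    go : ∀ cs → (∀ {c} → c List.∈ cs → parent c ≡ just i) → second D cs ≡ m ⊎ ∃[ j ] (parent j ≡ just i × second D cs ≡ toℕ j)
    go []          h = inj₁ refl
    go (_ ∷ [])    h = inj₁ refl
    go (_ ∷ k ∷ _) h = inj₂ (k , h (there (here refl)) , refl)

  source-bound : ∀ {i x} → x ≡ m ⊎ ∃[ j ] (parent j ≡ just i × x ≡ toℕ j) → x < stride D
  source-bound (inj₁ refl)           = ℕ.m<m+n m (s≤s z≤n)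
  source-bound (inj₂ (j , _ , refl)) = ℕ.<-≤-trans (Fin.toℕ<n j) (ℕ.m≤m+n m 1)

  source-≢ : ∀ {i x} → x ≡ m ⊎ ∃[ j ] (parent j ≡ just i × x ≡ toℕ j) → x ≢ toℕ i
  source-≢ {i} (inj₁ refl) eq = ℕ.<-irrefl (sym eq) (Fin.toℕ<n i)
  source-≢ (inj₂ (j , e , refl)) eq with Fin.toℕ-injective eq
  ... | refl = acyclic D e ε

  solve-run : Nice D → ∀ B → (∀ ys i tables codes mv → ways D (children i) ≡ 2 ⊎ mv ≡ nothing → processCost D ys i tables codes mv ≤ B) →
    ∀ σ → Ready D σ → ∀ rs → regs σ 7 ≡ + length rs → Stack (arrs σ 8) rs → Queue D [] rs →
    Run solve σ (λ τ → regs τ 0 ≡ + #perfectMatchings G) (4 + (3 + ((length rs * (12 + B) + 5) + 3)))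
  solve-run (nice , empty-root) B bound σ₀ (given , pow , adja) rs h7 stk queue =
    assign {σ₀} (cong (ℤ._+ + 1) (Given.order-m given)) (store-then {σ₁} {11} (Given.order-m given) refl
      (while-run I (λ ys → length ys * (12 + B) + 5) (I []) step rs σ₂
        (record { order-n = Given.order-n given ; order-m = Given.order-m given ; root-node = Given.root-node given
                ; height = h7 ; modulus = refl ; child-lists = Given.child-lists given ; bag-lists = Given.bag-lists given
                ; powers = pow ; adjacency = adja ; stack = stk }
        , Queue.unique queue , [] , Queue.scheduled queue , (λ ()) , inj₂ (Queue.rooted queue)
        , (λ {y} _ z → trans (setCell-neq 11 (+ m) (+ 1) σ₁ (dummy-≢ z (Fin.toℕ<n y))) (Given.no-tables given _))
        , setCell-eq 11 (+ m) (+ 1) σ₁ (cell-0 (stride D) m) , Given.no-codes given _)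
       ⨾ᴿ λ { {τ} inv → assign-run {τ} {load 11 (reg 2)} {0} refl (answer τ inv) }))
    where
    m<stride : m < stride D
    m<stride = ℕ.m<m+n m (s≤s z≤n)
    in-range : (y : Fin m) → toℕ y < stride D
    in-range y = ℕ.<-trans (Fin.toℕ<n y) m<stride
    dummy-≢ : ∀ {y} z → y < m → cell (stride D) z y ≢ + m
    dummy-≢ {y} z y<m eq =
      ℕ.<⇒≢ y<m (proj₂ (cell-injective (stride D) {z} {+ 0} (ℕ.<-trans y<m m<stride) m<stride (trans eq (sym (cell-0 (stride D) m)))))
    σ₁ σ₂ : State
    σ₁ = setReg 9 (+ stride D) σ₀
    σ₂ = setCell 11 (+ m) (+ 1) σ₁

    -- The columns of waiting nodes must be blank because tables arise by adding to them. The cells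
    -- of the fictitious node have to survive every round, as each later node may read them.
    I : List (Fin m) → State → Set
    I ys σ = ContextIn D ys σ × Unique ys × ∃[ done ]
      (Scheduled D done ys × (∀ {j} → j List.∈ done → Correct (arrs σ 11) (arrs σ 12) j) × (root List.∈ done ⊎ root List.∈ ys) ×
       (∀ {y} → y List.∈ ys → ∀ z → arrs σ 11 (cell (stride D) z (toℕ y)) ≡ + 0) × arrs σ 11 (cell (stride D) (+ 0) m) ≡ + 1 × arrs σ 12 (+ m) ≡ + 0)

    answer : ∀ τ → I [] τ → arrs τ 11 (regs τ 2) ≡ + #perfectMatchings G
    answer τ (ctx , _ , _ , _ , ok , inj₁ root∈ , _) with ok root∈
    ... | _ , F , f , T = trans (cong (arrs τ 11) (trans (Context.root-node ctx) (sym (cell-0 (stride D) (toℕ root))))) (root-value D empty-root f T)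

    step : ∀ ys σ → I ys σ → _
    step [] σ inv@(ctx , _) = inj₁ (≺-false {σ} {lit (+ 0)} {reg 7} refl (Context.height ctx) z≤n , inv , ℕ.≤-refl)
    step (y ∷ ys) σ (ctx , uniq@(y∉ ∷ uniq′) , done , (sched-y , sched) , ok , where-root , blank , unit , code)
      with node-correct ys y (arrs σ 11) (arrs σ 12) (children y) refl (nice y) (λ c∈ → ok (sched-y (∈-children D c∈))) unit code
    ... | mv , clipped , shape , F , f , T = inj₂
      ( ≺-true {σ} {lit (+ 0)} {reg 7} refl (Context.height ctx) (s≤s z≤n) , ys , _
      , assign {σ} {z = + length ys} (cong (ℤ._- + 1) (Context.height ctx))
          (assign {setReg 7 (+ length ys) σ} {z = + toℕ y} (proj₁ (Context.stack ctx))
            (weaken (λ {τ} → finish {τ}) ℕ.≤-refl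
              (process-run D ys y (arrs σ 11) (arrs σ 12) mv clipped (source-bound (first-cases y)) (source-bound (second-cases y))
                (source-≢ (first-cases y)) (source-≢ (second-cases y)) (blank (here refl))
                (setReg 10 (+ toℕ y) (setReg 7 (+ length ys) σ)) (ctx′ , refl , (λ _ → refl) , (λ _ → refl)))))
      , fits )
      where
      open Context ctx
      ctx′ : ContextIn D ys (setReg 10 (+ toℕ y) (setReg 7 (+ length ys) σ))
      ctx′ = record { order-n = order-n ; order-m = order-m ; root-node = root-node ; height = refl ; modulus = modulus
                    ; child-lists = child-lists ; bag-lists = bag-lists ; powers = powers ; adjacency = adjacency ; stack = proj₂ stack }
      fits : 5 + (4 + (3 + processCost D ys y (arrs σ 11) (arrs σ 12) mv)) + (length ys * (12 + B) + 5) ≤ (12 + B) + length ys * (12 + B) + 5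
      fits = ℕ.≤-trans (ℕ.+-monoˡ-≤ (length ys * (12 + B) + 5) (ℕ.+-monoʳ-≤ 12 (bound ys y (arrs σ 11) (arrs σ 12) mv shape)))
        (ℕ.≤-reflexive (sym (ℕ.+-assoc (12 + B) (length ys * (12 + B)) 5)))
      finish : ∀ {τ} → Processed D ys y (arrs σ 11) (arrs σ 12) mv τ → I ys τ
      finish {τ} (ctx″ , hc , hC , hT , hS) = ctx″ , uniq′ , y ∷ done , sched , ok′ , moved where-root
        , (λ {x} x∈ z → trans (hT z (toℕ x) (in-range x) (λ eq → All.lookup y∉ x∈ (sym (Fin.toℕ-injective eq)))) (blank (there x∈) z))
        , trans (hT (+ 0) m m<stride (ℕ.<⇒≢ (Fin.toℕ<n y) ∘ sym)) unit
        , trans (hC (+ m) (ℕ.<⇒≢ (Fin.toℕ<n y) ∘ sym ∘ ℤ.+-injective)) code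
        where
        moved : root List.∈ done ⊎ root List.∈ y ∷ ys → root List.∈ y ∷ done ⊎ root List.∈ ys
        moved (inj₁ p)         = inj₁ (there p)
        moved (inj₂ (here e))  = inj₁ (here e)
        moved (inj₂ (there p)) = inj₂ p
        correct-y : Correct (arrs τ 11) (arrs τ 12) y
        correct-y = hc , F , f , table-cong hS T
        ok′ : ∀ {j} → j List.∈ y ∷ done → Correct (arrs τ 11) (arrs τ 12) j
        ok′ (here refl) = correct-y
        ok′ {j} (there j∈) with j Fin.≟ y
        -- Should j coincide with y, the table just written is correct as well, so `done` and the
        -- waiting nodes need not be shown disjoint.
        ... | yes refl = correct-y
        ... | no j≢y with ok j∈
        ...   | jc , E , e , S = trans (hC (+ toℕ j) (j≢y ∘ Fin.toℕ-injective ∘ ℤ.+-injective)) jc , E , e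
              , table-cong (λ z → hT z (toℕ j) (in-range j) (j≢y ∘ Fin.toℕ-injective)) S

-- Running time

length-product : {A B : Set} (xs : List A) (ys : List B) → length (cartesianProduct xs ys) ≡ length xs * length ys
length-product []       ys = refl
length-product (x ∷ xs) ys = trans (List.length-++ (map (x ,_) ys)) (cong₂ _+_ (List.length-map (x ,_) ys) (length-product xs ys))

1≤κ^ : ∀ {κ} k → 2 ≤ κ → 1 ≤ κ ^ k
1≤κ^ zero    _     = ℕ.≤-refl
1≤κ^ (suc k) 2≤κ = ℕ.*-mono-≤ (ℕ.≤-trans (s≤s z≤n) 2≤κ) (1≤κ^ k 2≤κ)

k≤2^k : ∀ k → k ≤ 2 ^ k
k≤2^k zero    = z≤n
k≤2^k (suc k) = ℕ.≤-trans (ℕ.+-mono-≤ (1≤κ^ k ℕ.≤-refl) (k≤2^k k)) (ℕ.≤-reflexive (cong (λ x → 2 ^ k + x) (sym (ℕ.+-identityʳ _))))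

-- The shift by 2 makes the induction go through: 2 (3 + k) ≤ 3 (2 + k) for every k, while the
-- analogous step for 1 + k fails at k = 0.
[2+k]2^k≤2*3^k : ∀ k → (2 + k) * 2 ^ k ≤ 2 * 3 ^ k
[2+k]2^k≤2*3^k zero    = ℕ.≤-refl
[2+k]2^k≤2*3^k (suc k) = begin
  (3 + k) * (2 * 2 ^ k)             ≤⟨ ℕ.m≤m+n _ (k * 2 ^ k) ⟩
  (3 + k) * (2 * 2 ^ k) + k * 2 ^ k ≡⟨ arith k (2 ^ k) ⟩
  3 * ((2 + k) * 2 ^ k)             ≤⟨ ℕ.*-monoʳ-≤ 3 ([2+k]2^k≤2*3^k k) ⟩
  3 * (2 * 3 ^ k)                   ≡⟨ arith′ (3 ^ k) ⟩
  2 * (3 * 3 ^ k)                   ∎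
  where
  open ℕ.≤-Reasoning
  arith : ∀ k p → (3 + k) * (2 * p) + k * p ≡ 3 * ((2 + k) * p)
  arith = ℕ-solve
  arith′ : ∀ p → 3 * (2 * p) ≡ 2 * (3 * p)
  arith′ = ℕ-solve

module _ {n m : ℕ} {G : Graph n} (D : TreeDecomposition G m) where
  open Graph G
  open TreeDecomposition D

  totalDegree : List (Fin n) → ℕ
  totalDegree []       = 0
  totalDegree (v ∷ vs) = length (neighbours v) + totalDegree vs

  adjacent? : Decidable (λ (e : Fin n × Fin n) → proj₁ e ~ proj₂ e)
  adjacent? e = proj₁ e ~? proj₂ e

  totalDegree-pairs : ∀ vs → totalDegree vs ≡ length (filter adjacent? (cartesianProduct vs (allFin n)))
  totalDegree-pairs []       = refl
  totalDegree-pairs (v ∷ vs) = sym (trans (cong length (List.filter-++ adjacent? (map (v ,_) (allFin n)) _))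
    (trans (List.length-++ (filter adjacent? (map (v ,_) (allFin n))))
      (cong₂ _+_ (length-filter-map adjacent? (v ,_) (allFin n)) (sym (totalDegree-pairs vs)))))

  bagPairs : List (Fin m) → List (Fin n × Fin n)
  bagPairs []       = []
  bagPairs (i ∷ is) = cartesianProduct (elems (bag i)) (elems (bag i)) ++ bagPairs is

  ∈-bagPairs : ∀ {i u v is} → i List.∈ is → u ∈ bag i → v ∈ bag i → (u , v) List.∈ bagPairs is
  ∈-bagPairs (here refl) u∈ v∈ = ∈-++⁺ˡ (∈-cartesianProduct⁺ (∈-elems⁺ u∈) (∈-elems⁺ v∈))
  ∈-bagPairs {is = j ∷ _} (there p) u∈ v∈ = ∈-++⁺ʳ (cartesianProduct (elems (bag j)) (elems (bag j))) (∈-bagPairs p u∈ v∈)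

  length-bagPairs : ∀ {Y} → (∀ i → ∣ bag i ∣ * ∣ bag i ∣ ≤ Y) → ∀ is → length (bagPairs is) ≤ length is * Y
  length-bagPairs h []       = z≤n
  length-bagPairs h (i ∷ is) = ℕ.≤-trans (ℕ.≤-reflexive (List.length-++ (cartesianProduct (elems (bag i)) (elems (bag i)))))
    (ℕ.+-mono-≤ (ℕ.≤-trans (ℕ.≤-reflexive (trans (length-product (elems (bag i)) (elems (bag i)))
      (cong₂ _*_ (length-elems (bag i)) (length-elems (bag i))))) (h i)) (length-bagPairs h is))

  -- Each ordered adjacent pair occurs in the square of some bag. The adjacent pairs are listed
  -- without repetition, so inclusion bounds their number even though the squares may overlap.
  totalDegree-bound : ∀ {Y} → (∀ i → ∣ bag i ∣ * ∣ bag i ∣ ≤ Y) → totalDegree (allFin n) ≤ m * Y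
  totalDegree-bound {Y} h = begin
    totalDegree (allFin n)
      ≡⟨ totalDegree-pairs (allFin n) ⟩
    length (filter adjacent? (cartesianProduct (allFin n) (allFin n)))
      ≤⟨ unique-length (Unique.filter⁺ adjacent? (Unique.cartesianProduct⁺ (Unique.allFin⁺ n) (Unique.allFin⁺ n))) in-bags ⟩
    length (bagPairs (allFin m))
      ≤⟨ length-bagPairs h (allFin m) ⟩
    length (allFin m) * Y
      ≡⟨ cong (_* Y) (List.length-tabulate {n = m} id) ⟩
    m * Y ∎
    where
    open ℕ.≤-Reasoning
    in-bags : ∀ {e} → e List.∈ filter adjacent? (cartesianProduct (allFin n) (allFin n)) → e List.∈ bagPairs (allFin m)
    in-bags p with edge-covered (proj₂ (∈-filter⁻ adjacent? {xs = cartesianProduct (allFin n) (allFin n)} p))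
    ... | i , u∈ , v∈ = ∈-bagPairs (∈-allFin i) u∈ v∈

  setupCost-sum : ∀ vs → setupCost D vs ≡ 5 + (length vs * 29 + totalDegree vs * 17)
  setupCost-sum []       = refl
  setupCost-sum (v ∷ vs) = trans (cong₂ (λ b c → 24 + b + c) (budget-length 17 (neighbours v)) (setupCost-sum vs))
    (arith (length (neighbours v)) (length vs) (totalDegree vs))
    where
    arith : ∀ d l t → 24 + (d * 17 + 5) + (5 + (l * 29 + t * 17)) ≡ 5 + ((29 + l * 29) + (d + t) * 17)
    arith = ℕ-solve

  module _ (ys : List (Fin m)) (i : Fin m) (tables codes : ℤ → ℤ) where

    private
      k κ′ : ℕ
      k = length (elems (bag i))
      κ′ = ways D (children i)

    2≤ways : ∀ cs → 2 ≤ ways D cs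
    2≤ways []          = ℕ.≤-refl
    2≤ways (_ ∷ [])    = ℕ.≤-refl
    2≤ways (_ ∷ _ ∷ _) = s≤s (s≤s z≤n)

    -- The term `N * 75` strengthens the induction: a round costs at most 75 N, and 75 N + 75 N is
    -- at most 75 times the next length κ N. The 80 adds the final test, 5.
    enumerateCost-bound : ∀ N us → 1 ≤ N → enumerateCost D ys i tables codes N us + N * 75 ≤ N * κ′ ^ length us * 80
    enumerateCost-bound N [] 1≤N = ℕ.≤-trans (ℕ.+-monoˡ-≤ (N * 75) (ℕ.*-monoˡ-≤ 5 1≤N)) (ℕ.≤-reflexive (arith N))
      where
      arith : ∀ N → N * 5 + N * 75 ≡ N * 1 * 80
      arith = ℕ-solve
    enumerateCost-bound N (u ∷ us) 1≤N = begin
      28 + N * 47 + E + N * 75          ≤⟨ ℕ.+-monoˡ-≤ (N * 75) (ℕ.+-monoˡ-≤ E (ℕ.+-monoˡ-≤ (N * 47) (ℕ.*-monoˡ-≤ 28 1≤N))) ⟩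
      N * 28 + N * 47 + E + N * 75      ≡⟨ arith N E ⟩
      E + 2 * N * 75                    ≤⟨ ℕ.+-monoʳ-≤ E (ℕ.*-monoˡ-≤ 75 (ℕ.*-monoˡ-≤ N (2≤ways (children i)))) ⟩
      E + κ′ * N * 75                   ≤⟨ enumerateCost-bound (κ′ * N) us (ℕ.*-mono-≤ (ℕ.≤-trans (s≤s z≤n) (2≤ways (children i))) 1≤N) ⟩
      κ′ * N * κ′ ^ length us * 80      ≡⟨ arith′ κ′ N (κ′ ^ length us) ⟩
      N * (κ′ * κ′ ^ length us) * 80    ∎
      where
      open ℕ.≤-Reasoning
      E : ℕ
      E = enumerateCost D ys i tables codes (κ′ * N) us
      arith : ∀ N E → N * 28 + N * 47 + E + N * 75 ≡ E + 2 * N * 75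
      arith = ℕ-solve
      arith′ : ∀ k N p → k * N * p * 80 ≡ N * (k * p) * 80
      arith′ = ℕ-solve

    process-bound : ∀ {Y} mv → κ′ ^ k * (53 + partnersCost D ys i tables codes mv) ≤ Y * 66 → κ′ ^ k ≤ Y →
                    processCost D ys i tables codes mv ≤ Y * 221
    process-bound {Y} mv h h′ = begin
      -- The fixed costs add up to 75, which is the surplus in `enumerateCost-bound` for N = 1.
      36 + ((18 + E) + (14 + (2 + (A + 5))))    ≡⟨ arith E A ⟩
      E + 1 * 75 + A                            ≤⟨ ℕ.+-mono-≤ (enumerateCost-bound 1 (elems (bag i)) ℕ.≤-refl) h ⟩
      1 * κ′ ^ k * 80 + Y * 66                  ≤⟨ ℕ.+-monoˡ-≤ (Y * 66) (ℕ.*-monoˡ-≤ 80 (ℕ.≤-trans (ℕ.≤-reflexive (ℕ.*-identityˡ _)) h′)) ⟩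
      Y * 80 + Y * 66                           ≤⟨ ℕ.m≤m+n _ (Y * 75) ⟩
      Y * 80 + Y * 66 + Y * 75                  ≡⟨ arith′ Y ⟩
      Y * 221                                   ∎
      where
      open ℕ.≤-Reasoning
      E A : ℕ
      E = enumerateCost D ys i tables codes 1 (elems (bag i))
      A = κ′ ^ k * (53 + partnersCost D ys i tables codes mv)
      arith : ∀ E A → 36 + ((18 + E) + (14 + (2 + (A + 5)))) ≡ E + 1 * 75 + A
      arith = ℕ-solve
      arith′ : ∀ Y → Y * 80 + Y * 66 + Y * 75 ≡ Y * 221
      arith′ = ℕ-solve

    -- At a forget node each of the 2^k pairs costs 53 + 8 + 5 = 66 plus 31 per vertex of the bag,
    -- at most 66 (1 + k); without a partner scan a pair costs 54.
    process-cost : ∀ {Y} → (1 + ∣ bag i ∣) * 2 ^ ∣ bag i ∣ ≤ Y → (κ′ ≡ 3 → 3 ^ ∣ bag i ∣ ≤ Y) →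
                   ∀ mv → κ′ ≡ 2 ⊎ mv ≡ nothing → processCost D ys i tables codes mv ≤ Y * 221
    process-cost {Y} two three mv shape = process-bound mv (total mv shape) power
      where
      open ℕ.≤-Reasoning
      k≡ : k ≡ ∣ bag i ∣
      k≡ = length-elems (bag i)
      two-or-three : ∀ cs → ways D cs ≡ 2 ⊎ ways D cs ≡ 3
      two-or-three []          = inj₁ refl
      two-or-three (_ ∷ [])    = inj₁ refl
      two-or-three (_ ∷ _ ∷ _) = inj₂ refl
      linear : (1 + k) * 2 ^ k ≤ Y
      linear = subst (λ k → (1 + k) * 2 ^ k ≤ Y) (sym k≡) two
      power : κ′ ^ k ≤ Y
      power with two-or-three (children i)
      ... | inj₁ e = ℕ.≤-trans (ℕ.≤-reflexive (cong (_^ k) e)) (ℕ.≤-trans (ℕ.m≤m+n (2 ^ k) (k * 2 ^ k)) linear)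
      ... | inj₂ e = ℕ.≤-trans (ℕ.≤-reflexive (cong₂ _^_ e k≡)) (three e)
      total : ∀ mv → κ′ ≡ 2 ⊎ mv ≡ nothing → κ′ ^ k * (53 + partnersCost D ys i tables codes mv) ≤ Y * 66
      total nothing  _        = ℕ.*-mono-≤ power (ℕ.≤ᵇ⇒≤ 54 66 tt)
      total (just _) (inj₁ e) = begin
        κ′ ^ k * (53 + (8 + budget 31 (elems (bag i))))
          ≡⟨ cong₂ (λ x b → x ^ k * (53 + (8 + b))) e (budget-length 31 (elems (bag i))) ⟩
        2 ^ k * (53 + (8 + (k * 31 + 5)))
          ≤⟨ ℕ.m≤m+n _ (2 ^ k * (k * 35)) ⟩
        2 ^ k * (53 + (8 + (k * 31 + 5))) + 2 ^ k * (k * 35)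
          ≡⟨ arith k (2 ^ k) ⟩
        (1 + k) * 2 ^ k * 66
          ≤⟨ ℕ.*-monoˡ-≤ 66 linear ⟩
        Y * 66 ∎
        where
        arith : ∀ k p → p * (53 + (8 + (k * 31 + 5))) + p * (k * 35) ≡ (1 + k) * p * 66
        arith = ℕ-solve

  nice-binary : Nice D → ∀ i → length (children i) ≤ 2
  nice-binary (nice , _) i = go (children i) (nice i)
    where
    go : ∀ cs → NiceNode D i cs → length cs ≤ 2
    go []          _ = z≤n
    go (_ ∷ [])    _ = s≤s z≤n
    go (_ ∷ _ ∷ []) _ = ℕ.≤-refl

  -- 65 = 36 + 29 collects the constant and the cost per vertex. 309 = 71 + 238 is the cost per
  -- node, where 238 = 221 + 17 also pays for the adjacency lists through `d ≤ m * Y`.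
  total-cost : ∀ c Y d → 1 ≤ n → 1 ≤ Y → m ≤ c * n → d ≤ m * Y →
    (4 + (5 + (n * 29 + d * 17))) + ((12 + m * 59) + (4 + (3 + ((m * (12 + Y * 221) + 5) + 3)))) ≤ (65 + c * 309) * (Y * n)
  total-cost c Y d 1≤n 1≤Y m≤cn d≤ = begin
    (4 + (5 + (n * 29 + d * 17))) + ((12 + m * 59) + (4 + (3 + ((m * (12 + Y * 221) + 5) + 3))))
      ≤⟨ ℕ.+-monoˡ-≤ ((12 + m * 59) + (4 + (3 + ((m * (12 + Y * 221) + 5) + 3)))) (ℕ.+-monoʳ-≤ 9 (ℕ.+-monoʳ-≤ (n * 29) (ℕ.*-monoˡ-≤ 17 d≤))) ⟩
    (4 + (5 + (n * 29 + m * Y * 17))) + ((12 + m * 59) + (4 + (3 + ((m * (12 + Y * 221) + 5) + 3))))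
      ≡⟨ arith₁ n m Y ⟩
    36 * 1 * 1 + n * 29 * 1 + m * 71 * 1 + m * Y * 238
      ≤⟨ ℕ.+-monoˡ-≤ (m * Y * 238) (ℕ.+-mono-≤ (ℕ.+-mono-≤ (ℕ.*-mono-≤ (ℕ.*-monoʳ-≤ 36 1≤n) 1≤Y) (ℕ.*-monoʳ-≤ (n * 29) 1≤Y)) (ℕ.*-monoʳ-≤ (m * 71) 1≤Y)) ⟩
    36 * n * Y + n * 29 * Y + m * 71 * Y + m * Y * 238
      ≡⟨ arith₂ n m Y ⟩
    65 * (Y * n) + m * (Y * 309)
      ≤⟨ ℕ.+-monoʳ-≤ (65 * (Y * n)) (ℕ.*-monoˡ-≤ (Y * 309) m≤cn) ⟩
    65 * (Y * n) + c * n * (Y * 309)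
      ≡⟨ arith₃ n c Y ⟩
    (65 + c * 309) * (Y * n) ∎
    where
    open ℕ.≤-Reasoning
    arith₁ : ∀ n m Y → (4 + (5 + (n * 29 + m * Y * 17))) + ((12 + m * 59) + (4 + (3 + ((m * (12 + Y * 221) + 5) + 3)))) ≡ 36 * 1 * 1 + n * 29 * 1 + m * 71 * 1 + m * Y * 238
    arith₁ = ℕ-solve
    arith₂ : ∀ n m Y → 36 * n * Y + n * 29 * Y + m * 71 * Y + m * Y * 238 ≡ 65 * (Y * n) + m * (Y * 309)
    arith₂ = ℕ-solve
    arith₃ : ∀ n c Y → 65 * (Y * n) + c * n * (Y * 309) ≡ (65 + c * 309) * (Y * n)
    arith₃ = ℕ-solve

  -- Y bounds the work at a single node, including its share k² ≤ (1 + k) 2^k of the adjacency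
  -- lists. Since 3^k ≤ Y is asked for only at joins, both time bounds are instances of this lemma.
  counter-run : Nice D → ∀ c Y → 1 ≤ n → m ≤ c * n → (∀ i → (1 + ∣ bag i ∣) * 2 ^ ∣ bag i ∣ ≤ Y) →
    (∀ i → ways D (children i) ≡ 3 → 3 ^ ∣ bag i ∣ ≤ Y) →
    matchingCounter on input G D Returns + (#perfectMatchings G) Within ((65 + c * 309) * (Y * n))
  counter-run nice c Y 1≤n m≤cn two three = weaken id
    (ℕ.≤-trans (ℕ.≤-reflexive (cong (λ s → (4 + s) + ((12 + m * 59) + (4 + (3 + ((m * (12 + Y * 221) + 5) + 3))))) setup-cost))
      (total-cost c Y (totalDegree (allFin n)) 1≤n 1≤Y m≤cn (totalDegree-bound squares)))
    (setup-run D (input G D) (given-input D) (input-family neighbours) (λ _ → refl) ⨾ᴿ λ {τ} ready →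
     traverse-run D (nice-binary nice) τ ready ⨾ᴿ λ { {υ} (ready′ , rs , h7 , stk , Q) →
     weaken id (ℕ.+-monoʳ-≤ 7 (ℕ.+-monoˡ-≤ 3 (ℕ.+-monoˡ-≤ 5 (ℕ.*-monoˡ-≤ (12 + Y * 221) (length-≤-m D (Queue.unique Q))))))
       (solve-run D nice (Y * 221) (λ ys i tables codes mv shape → process-cost ys i tables codes (two i) (three i) mv shape)
         υ ready′ rs h7 stk Q) })
    where
    setup-cost : setupCost D (allFin n) ≡ 5 + (n * 29 + totalDegree (allFin n) * 17)
    setup-cost = trans (setupCost-sum (allFin n)) (cong (λ l → 5 + (l * 29 + totalDegree (allFin n) * 17)) (List.length-tabulate {n = n} id))
    1≤Y : 1 ≤ Y
    1≤Y = ℕ.≤-trans (ℕ.*-mono-≤ (s≤s (z≤n {∣ bag root ∣})) (1≤κ^ ∣ bag root ∣ (ℕ.≤-refl {2}))) (two root)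
    squares : ∀ i → ∣ bag i ∣ * ∣ bag i ∣ ≤ Y
    squares i = ℕ.≤-trans (ℕ.*-mono-≤ (ℕ.n≤1+n ∣ bag i ∣) (k≤2^k ∣ bag i ∣)) (two i)

  -- The truncated subtraction in `width` does no harm, as x ≤ 1 + (x ∸ 1) holds for x = 0 too.
  bag-size : ∀ i → ∣ bag i ∣ ≤ 1 + width
  bag-size i = ℕ.≤-trans (All.lookup (xs≤max 0 sizes) (∈-tabulate⁺ {f = λ i → ∣ bag i ∣} i)) (ℕ.m≤n+m∸n (max 0 sizes) 1)
    where
    sizes : List ℕ
    sizes = tabulate (λ i → ∣ bag i ∣)

-- Bounds in terms of the width

counting : ∀ {n m} (G : Graph n) (D : TreeDecomposition G m) c → Nice D → m ≤ c * n →
  let w = TreeDecomposition.width D in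
  (matchingCounter on input G D Returns + (#perfectMatchings G) Within ((65 + c * 309) * 6 * (3 ^ w * n))) ×
  (IsPathDecomposition D →
   matchingCounter on input G D Returns + (#perfectMatchings G) Within ((65 + c * 309) * 6 * ((w ⊔ 1) * 2 ^ w * n)))
counting {zero} {m} G D c nice m≤cn =
  -- The tree has a root, so m is positive and m ≤ c * 0 is impossible; for positive n the additive
  -- constants are absorbed.
  contradiction (ℕ.≤-trans (Fin.toℕ<n (TreeDecomposition.root D)) (ℕ.≤-trans m≤cn (ℕ.≤-reflexive (ℕ.*-zeroʳ c)))) λ ()
counting {n@(suc _)} {m} G D c nice m≤cn =
  weaken id (ℕ.≤-reflexive (arith₁ (65 + c * 309) (3 ^ w) n))
    -- This value dominates 3^k and also (1 + k) 2^k for every bag size k ≤ 1 + w, and it equals 6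
    -- times 3^w.
    (counter-run D nice c (2 * 3 ^ (1 + w)) (s≤s z≤n) m≤cn
      (λ i → ℕ.≤-trans (ℕ.≤-trans (ℕ.*-monoˡ-≤ (2 ^ ∣ bag i ∣) (ℕ.n≤1+n (1 + ∣ bag i ∣))) ([2+k]2^k≤2*3^k ∣ bag i ∣))
                       (ℕ.*-monoʳ-≤ 2 (ℕ.^-monoʳ-≤ 3 (bag-size D i))))
      (λ i _ → ℕ.≤-trans (ℕ.^-monoʳ-≤ 3 (bag-size D i)) (ℕ.m≤m+n (3 ^ (1 + w)) _))) ,
  λ path → weaken id (path-bound (65 + c * 309))
    (counter-run D nice c ((2 + w) * 2 ^ (1 + w)) (s≤s z≤n) m≤cn
      (λ i → ℕ.*-mono-≤ (s≤s (bag-size D i)) (ℕ.^-monoʳ-≤ 2 (bag-size D i)))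
      (λ i e → contradiction (proj₁ nice i) (no-join i path (children i) refl e)))
  where
  open TreeDecomposition D
  w : ℕ
  w = width
  arith₁ : ∀ C p n → C * (2 * (3 * p) * n) ≡ C * 6 * (p * n)
  arith₁ = ℕ-solve
  no-join : ∀ i → IsPathDecomposition D → ∀ cs → children i ≡ cs → ways D cs ≡ 3 → ¬ NiceNode D i cs
  no-join i path (_ ∷ _ ∷ [])    eq _ _ = path i (cong length eq)
  no-join i path (_ ∷ _ ∷ _ ∷ _) eq _ ()
  -- The maximum with 1 covers width 0, where w 2^w vanishes although the running time does not.
  -- From 2 + w ≤ 3 (w ⊔ 1) and 2^(1 + w) = 2 · 2^w comes the same factor 6 as in the general case.
  path-bound : ∀ C → C * ((2 + w) * 2 ^ (1 + w) * n) ≤ C * 6 * ((w ⊔ 1) * 2 ^ w * n)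
  path-bound C = begin
    C * ((2 + w) * (2 * 2 ^ w) * n)
      ≤⟨ ℕ.*-monoʳ-≤ C (ℕ.*-monoˡ-≤ n (ℕ.*-monoˡ-≤ (2 * 2 ^ w) (ℕ.+-mono-≤ (ℕ.*-monoʳ-≤ 2 (ℕ.m≤n⊔m w 1)) (ℕ.m≤m⊔n w 1)))) ⟩
    C * ((2 * (w ⊔ 1) + (w ⊔ 1)) * (2 * 2 ^ w) * n)
      ≡⟨ arith₂ C (w ⊔ 1) (2 ^ w) n ⟩
    C * 6 * ((w ⊔ 1) * 2 ^ w * n) ∎
    where
    open ℕ.≤-Reasoning
    arith₂ : ∀ C v p n → C * ((2 * v + v) * (2 * p) * n) ≡ C * 6 * (v * p * n)
    arith₂ = ℕ-solve

mainTheorem6 : Σ[ P ∈ Program ]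
    (∀ (c : ℕ) → Σ[ C ∈ ℕ ]
    (∀ {n m : ℕ} (G : Graph n) (D : TreeDecomposition G m) →
    Nice D → m ≤ c * n →
    let w = TreeDecomposition.width D in
    (P on input G D Returns + (#perfectMatchings G) Within (C * (3 ^ w * n)))
    × (IsPathDecomposition D →
    P on input G D Returns + (#perfectMatchings G) Within (C * ((w ⊔ 1) * 2 ^ w * n)))))
mainTheorem6 = matchingCounter , λ c → (65 + c * 309) * 6 , λ G D → counting G D c
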